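{- For all integers $2 \leq p \leq q$, the graph $K_{p,q}^-$ is determined by its spectrum.
   Context: All graphs are simple. The spectrum of a graph is the multiset of eigenvalues of its adjacency matrix. Two graphs are cospectral if they have the same spectrum (in particular the same number of vertices). A graph $G$ is determined by its spectrum (DS) if every graph cospectral with $G$ is isomorphic to $G$. $K_{p,q}$ denotes the complete bipartite graph with parts of sizes $p$ and $q$, and for $2 \leq \min\{p,q\}$, $K_{p,q}^-$ denotes the graph with $pq-1$ edges obtained from $K_{p,q}$ by deleting one edge. -}

module Defs where

open import Data.Nat using (ℕ; zero; suc; _+_; _<ᵇ_)
import Data.Nat
open import Data.Integer as ℤ using (ℤ; +_; -_)
open import Data.Bool using (Bool; true; false; if_then_else_; _∧_; _∨_; not; _xor_)
open import Data.Fin using (Fin; zero; suc; toℕ; punchIn)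
open import Data.Fin.Properties using () renaming (_≟_ to _≟ᶠ_)
open import Data.List using (List; []; _∷_; map)
open import Relation.Nullary using (does)
open import Relation.Binary.PropositionalEquality using (_≡_; refl; cong; cong₂)
open import Function.Bundles using (_↔_; Inverse)

record Graph (n : ℕ) : Set where
  field
    adj    : Fin n → Fin n → Bool
    sym    : ∀ i j → adj i j ≡ adj j i
    irrefl : ∀ i → adj i i ≡ false
open Graph public

Isomorphic : ∀ {n m} → Graph n → Graph m → Set
Isomorphic {n} {m} G H =
  Σ' (Fin n ↔ Fin m) λ σ → ∀ i j → adj H (Inverse.to σ i) (Inverse.to σ j) ≡ adj G i j
  where
  open import Data.Product using (Σ)
  Σ' : (A : Set) → (A → Set) → Set
  Σ' = Σ

-- Polynomials with integer coefficients (coefficient lists, constant first)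

Poly : Set
Poly = List ℤ

infixl 6 _+P_
infixl 7 _*P_

_+P_ : Poly → Poly → Poly
[] +P q = q
(a ∷ p) +P [] = a ∷ p
(a ∷ p) +P (b ∷ q) = (a ℤ.+ b) ∷ (p +P q)

scaleP : ℤ → Poly → Poly
scaleP a p = map (a ℤ.*_) p

_*P_ : Poly → Poly → Poly
[] *P q = []
(a ∷ p) *P q = scaleP a q +P (+ 0 ∷ (p *P q))

coeff : Poly → ℕ → ℤ
coeff [] k = + 0
coeff (a ∷ p) zero = a
coeff (a ∷ p) (suc k) = coeff p k

constP : ℤ → Poly
constP a = a ∷ []

X : Poly
X = + 0 ∷ + 1 ∷ []

sumP : ∀ n → (Fin n → Poly) → Poly
sumP zero f = []
sumP (suc n) f = f zero +P sumP n (λ j → f (suc j))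

signℤ : ℕ → ℤ
signℤ zero = + 1
signℤ (suc k) = - signℤ k

det : ∀ n → (Fin n → Fin n → Poly) → Poly
det zero M = constP (+ 1)
det (suc n) M =
  sumP (suc n) λ j →
    scaleP (signℤ (toℕ j)) (M zero j *P det n (λ r c → M (suc r) (punchIn j c)))

adjℤ : ∀ {n} → Graph n → Fin n → Fin n → ℤ
adjℤ G i j = if adj G i j then + 1 else + 0

charPoly : ∀ {n} → Graph n → Poly
charPoly {n} G = det n λ i j →
  (if does (i ≟ᶠ j) then X else []) +P constP (- adjℤ G i j)

-- Cospectral: same multiset of adjacency eigenvalues, i.e. same characteristic
-- polynomial (its degree is the number of vertices, so this forces equal order).
Cospectral : ∀ {n m} → Graph n → Graph m → Set
Cospectral G H = ∀ k → coeff (charPoly G) k ≡ coeff (charPoly H) k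

DS : ∀ {n} → Graph n → Set
DS {n} G = ∀ (m : ℕ) (H : Graph m) → Cospectral G H → Isomorphic G H

-- K_{p,q} minus one edge.  Vertices Fin (p + q); vertex i lies in the
-- first part iff toℕ i < p.  The deleted edge is {0, p} (vertex 0 of the
-- first part, first vertex p of the second part); this needs p ≥ 1, q ≥ 1.

inFirst : ∀ {p q} → Fin (p + q) → Bool
inFirst {p} i = toℕ i <ᵇ p

isDeleted : ∀ {p q} → Fin (p + q) → Fin (p + q) → Bool
isDeleted {p} i j =
  (does (toℕ i Data.Nat.≟ 0) ∧ does (toℕ j Data.Nat.≟ p)) ∨
  (does (toℕ j Data.Nat.≟ 0) ∧ does (toℕ i Data.Nat.≟ p))

KpqMinusAdj : ∀ p q → Fin (p + q) → Fin (p + q) → Bool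
KpqMinusAdj p q i j = (inFirst {p} {q} i xor inFirst {p} {q} j) ∧ not (isDeleted {p} {q} i j)

private
  xor-comm : ∀ a b → (a xor b) ≡ (b xor a)
  xor-comm false false = refl
  xor-comm false true = refl
  xor-comm true false = refl
  xor-comm true true = refl

  xor-self : ∀ a → (a xor a) ≡ false
  xor-self false = refl
  xor-self true = refl

  ∨-comm' : ∀ a b → (a ∨ b) ≡ (b ∨ a)
  ∨-comm' false false = refl
  ∨-comm' false true = refl
  ∨-comm' true false = refl
  ∨-comm' true true = refl

KpqMinus : ∀ p q → Graph (p + q)
KpqMinus p q = record
  { adj = KpqMinusAdj p q
  ; sym = λ i j → cong₂ (λ a b → a ∧ not b)
                    (xor-comm (inFirst {p} {q} i) (inFirst {p} {q} j))
                    (∨-comm' (does (toℕ i Data.Nat.≟ 0) ∧ does (toℕ j Data.Nat.≟ p))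
                              (does (toℕ j Data.Nat.≟ 0) ∧ does (toℕ i Data.Nat.≟ p)))
  ; irrefl = λ i → cong (λ a → a ∧ not (isDeleted {p} {q} i i)) (xor-self (inFirst {p} {q} i))
  }

{-# OPTIONS --safe #-}

-- Expanding the determinants of xI − A with one row replaced by a row of Aᵏ gives Newton's
-- identities, so cospectral graphs have the same order and the same traces tr Aᵏ.  Write
-- a = p − 1, b = q − 1, e = ab + a + b and P = ab.  The adjacency matrix of K⁻ satisfies
-- A⁵ − eA³ + PA = 0; the sum of the squares of the entries of the left-hand side is a combination
-- of traces, so the same equation holds for a cospectral mate H.
--
-- H has no triangles (tr A³ = 0) and no 5-cycles (diagonal of A⁵), and P is the number of pairs
-- of disjoint edges of H that do not lie on a common 4-cycle.  An induced 2K₂ would force at least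
-- e − 1 such pairs, whereas e − P = a + b ≥ 2.  Hence H is 2K₂-free; splitting it at the
-- neighbourhood of a vertex of maximal degree shows that it is bipartite with nested
-- neighbourhoods.  The off-diagonal entries of the matrix equation leave at most two different
-- nonempty neighbourhoods on each side.  Such a graph is given by five class sizes, and e, P and the
-- number of vertices leave only those of K⁻.
module Submission where

open import Defs hiding (det; sym)
import Defs
open import Algebra.Bundles using (CommutativeRing)
import Algebra.Construct.Pointwise as Pointwise
open import Data.Bool using (Bool; true; false; if_then_else_; _∧_; _∨_; not; _xor_)
import Data.Bool.Properties as Bool
open import Data.Empty using (⊥; ⊥-elim)
open import Data.Fin using (Fin; zero; suc; toℕ; punchIn; punchOut)
open import Data.Fin.Permutation using (_⟨$⟩ʳ_; insert) renaming (id to idₚ)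
open import Data.Fin.Properties using (_≟_; any?; punchInᵢ≢i; punchOut-punchIn; punchOut-cong; suc-injective)
open import Data.Integer as ℤ using (ℤ; +_; -[1+_]; +≤+)
import Data.Integer.Properties as ℤ
open import Data.Integer.Solver using (module +-*-Solver)
open import Data.Integer.Tactic.RingSolver using (solve-∀)
open import Data.List using ([]; _∷_)
open import Data.Nat as ℕ using (ℕ; zero; suc; _≤_; z≤n; s≤s; _<ᵇ_; _≡ᵇ_)
import Data.Nat.Properties as ℕ
import Data.Nat.Tactic.RingSolver as ℕSolver
open import Data.Product using (∃-syntax; _×_; _,_; proj₁; proj₂)
open import Data.Sum using (_⊎_; inj₁; inj₂)
open import Data.Vec using (Vec; []; _∷_)
open import Data.Vec.Functional using (updateAt)
open import Data.Vec.Functional.Properties using (updateAt-updates; updateAt-minimal; updateAt-id-local; map-updateAt)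
open import Function using (_∘_)
open import Relation.Binary.Definitions using (tri<; tri≈; tri>)
open import Relation.Binary.PropositionalEquality as ≡ using (_≡_; _≢_)
open import Relation.Nullary using (Dec; yes; no; does; contradiction; _×-dec_)
open import Relation.Nullary.Decidable using (dec-true)

-- The Diophantine equation

-- The matrix equation replaces diagonalisation. The nonzero eigenvalues of K⁻ are ±λ and ±μ with λ²
-- + μ² = e and λ²μ² = P, so x⁵ - ex³ + Px vanishes on the spectrum. The same relations give tr A² =
-- 2e and tr A⁴ = 2λ⁴ + 2μ⁴ = 2e² - 4P, from which the count P of edge pairs arises. The main
-- obstacle is that traces do not see connectedness: a mate could a priori have several components
-- with edges. Excluding an induced 2K₂ removes these as well. The five class sizes r₁, r₂, c₁, c₂,
-- z at the end satisfy e = r₁c₁ + r₁c₂ + r₂c₁ and P = r₁c₁r₂c₂. These two equations have foreign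
-- solutions: a = 3, b = 4 also admits r₁ = 6, r₂ = c₁ = 1, c₂ = 2, on ten vertices instead of nine.

module Diophantine where
  open import Data.Nat using (_+_; _*_)
  open import Relation.Binary.PropositionalEquality using (refl; sym; trans; cong; subst)
  open import Data.Nat.Tactic.RingSolver using () renaming (solve-∀ to solve-ℕ)

  -- Both pairs are the roots of one quadratic. Without subtraction: if a = r + d, then c = d + b,
  -- and r(d + b) = (r + d)b leaves dr = db, so d = 0 or r = b. The case a ≤ r is symmetric.
  same-sum-and-product : ∀ a b r c → r + c ≡ a + b → r * c ≡ a * b → (r ≡ a × c ≡ b) ⊎ (r ≡ b × c ≡ a)
  same-sum-and-product a b r c sum≡ product≡ with ℕ.≤-total r a
  ... | inj₁ r≤a = go (ℕ.m≤n⇒∃[o]m+o≡n r≤a)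
    where
    lemma₁ : ∀ r d b → r * (d + b) ≡ d * r + r * b
    lemma₁ = solve-ℕ
    lemma₂ : ∀ r d b → (r + d) * b ≡ d * b + r * b
    lemma₂ = solve-ℕ
    go : ∃[ d ] r + d ≡ a → (r ≡ a × c ≡ b) ⊎ (r ≡ b × c ≡ a)
    go (d , refl) with ℕ.+-cancelˡ-≡ r c (d + b) (trans sum≡ (ℕ.+-assoc r d b))
    go (zero , refl) | refl = inj₁ (sym (ℕ.+-identityʳ r) , refl)
    go (suc d , refl) | refl with ℕ.*-cancelˡ-≡ r b (suc d) (ℕ.+-cancelʳ-≡ (r * b) (suc d * r) (suc d * b)
                          (trans (sym (lemma₁ r (suc d) b)) (trans product≡ (lemma₂ r (suc d) b))))
    ... | refl = inj₂ (refl , ℕ.+-comm (suc d) b)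
  ... | inj₂ a≤r = go (ℕ.m≤n⇒∃[o]m+o≡n a≤r)
    where
    lemma₁ : ∀ a d c → (a + d) * c ≡ d * c + a * c
    lemma₁ = solve-ℕ
    lemma₂ : ∀ a d c → a * (d + c) ≡ d * a + a * c
    lemma₂ = solve-ℕ
    go : ∃[ d ] a + d ≡ r → (r ≡ a × c ≡ b) ⊎ (r ≡ b × c ≡ a)
    go (d , refl) with ℕ.+-cancelˡ-≡ a b (d + c) (trans (sym sum≡) (ℕ.+-assoc a d c))
    go (zero , refl) | refl = inj₁ (ℕ.+-identityʳ a , refl)
    go (suc d , refl) | refl with ℕ.*-cancelˡ-≡ c a (suc d) (ℕ.+-cancelʳ-≡ (a * c) (suc d * c) (suc d * a)
                          (trans (sym (lemma₁ a (suc d) c)) (trans product≡ (lemma₂ a (suc d) c))))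
    ... | refl = inj₂ (ℕ.+-comm c (suc d) , refl)

  -- (x − 2)(y − 2) ≥ 0 and 2s ≤ st bound twice the left-hand side of the first equation by 2ab + 4.
  sum-too-small : ∀ a b r₁ r₂ c₁ c₂ → 1 ≤ a → 1 ≤ b →
    r₁ * c₁ + r₁ * c₂ + r₂ * c₁ ≡ a * b + a + b →
    r₁ * c₁ * (r₂ * c₂) ≡ a * b →
    2 ≤ r₂ * c₂ → 2 ≤ r₁ * c₂ → 2 ≤ r₂ * c₁ → ⊥
  sum-too-small a b r₁ r₂ c₁ c₂ 1≤a 1≤b edges product 2≤t 2≤x 2≤y = finish a b 1≤a 1≤b a+b≤2 4≤D
    where
    open ℕ.≤-Reasoning
    s = r₁ * c₁
    t = r₂ * c₂
    x = r₁ * c₂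
    y = r₂ * c₁
    D = a * b
    xy≡D : x * y ≡ D
    xy≡D = trans (lemma r₁ r₂ c₁ c₂) product
      where
      lemma : ∀ r r′ c c′ → r * c′ * (r′ * c) ≡ r * c * (r′ * c′)
      lemma = solve-ℕ
    2s≤D : s * 2 ≤ D
    2s≤D = ℕ.≤-trans (ℕ.*-monoʳ-≤ s 2≤t) (ℕ.≤-reflexive product)
    2x+2y≤D+4 : ∀ {x y} → 2 ≤ x → 2 ≤ y → 2 * x + 2 * y ≤ x * y + 4
    2x+2y≤D+4 {suc (suc x)} {suc (suc y)} (s≤s (s≤s _)) (s≤s (s≤s _)) =
      subst (2 * (2 + x) + 2 * (2 + y) ≤_) (lemma x y) (ℕ.m≤m+n (2 * (2 + x) + 2 * (2 + y)) (x * y))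
      where
      lemma : ∀ x y → 2 * (2 + x) + 2 * (2 + y) + x * y ≡ (2 + x) * (2 + y) + 4
      lemma = solve-ℕ
    a+b≤2 : a + b ≤ 2
    a+b≤2 = ℕ.*-cancelˡ-≤ 2 (ℕ.+-cancelˡ-≤ (D + D) (2 * (a + b)) 4 (begin
      D + D + 2 * (a + b)          ≡⟨ lemma₁ D a b ⟩
      2 * (D + a + b)              ≡⟨ cong (2 *_) (sym edges) ⟩
      2 * (s + x + y)              ≡⟨ lemma₂ s x y ⟩
      s * 2 + (2 * x + 2 * y)      ≤⟨ ℕ.+-mono-≤ 2s≤D (2x+2y≤D+4 2≤x 2≤y) ⟩
      D + (x * y + 4)              ≡⟨ cong (λ d → D + (d + 4)) xy≡D ⟩
      D + (D + 4)                  ≡⟨ sym (ℕ.+-assoc D D 4) ⟩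
      D + D + 4                    ∎))
      where
      lemma₁ : ∀ d a b → d + d + 2 * (a + b) ≡ 2 * (d + a + b)
      lemma₁ = solve-ℕ
      lemma₂ : ∀ s x y → 2 * (s + x + y) ≡ s * 2 + (2 * x + 2 * y)
      lemma₂ = solve-ℕ
    4≤D : 4 ≤ D
    4≤D = subst (4 ≤_) xy≡D (ℕ.*-mono-≤ 2≤x 2≤y)
    finish : ∀ a b → 1 ≤ a → 1 ≤ b → a + b ≤ 2 → 4 ≤ a * b → ⊥
    finish 1 1 _ _ _ (s≤s ())
    finish 1 (suc (suc b)) _ _ (s≤s (s≤s ())) _
    finish (suc (suc a)) (suc b) _ _ (s≤s (s≤s le)) _ with ℕ.≤-trans (ℕ.m≤n+m (suc b) a) le
    ... | ()

  -- Subtracting the product from the edge count leaves r + 1 = a + b, and then the vertex count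
  -- would give k + 1 + z = 0. The shape is r₁ = r, r₂ = c₁ = 1, c₂ = k + 2, or its transpose; here
  -- it is the number of vertices that decides.
  hook : ∀ a b r k z → r * 1 + r * suc (suc k) + 1 ≡ a * b + a + b → r * suc (suc k) ≡ a * b →
    r + suc (suc k) + 2 + z ≡ a + b + 2 → ⊥
  hook a b r k z edges product order = contra
    where
    r+1≡a+b : r + 1 ≡ a + b
    r+1≡a+b = ℕ.+-cancelˡ-≡ (a * b) (r + 1) (a + b) (trans (cong (_+ (r + 1)) (sym product))
      (trans (lemma r (r * suc (suc k))) (trans edges (ℕ.+-assoc (a * b) a b))))
      where
      lemma : ∀ r p → p + (r + 1) ≡ r * 1 + p + 1
      lemma = solve-ℕ
    contra : ⊥
    contra with ℕ.+-cancelˡ-≡ (r + 1 + 2) (suc k + z) 0 (trans (lemma r k z) (trans order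
                  (trans (cong (_+ 2) (sym r+1≡a+b)) (sym (ℕ.+-identityʳ _)))))
      where
      lemma : ∀ r k z → r + 1 + 2 + (suc k + z) ≡ r + suc (suc k) + 2 + z
      lemma = solve-ℕ
    ... | ()

  positive : ∀ {a b} → 1 ≤ a → 1 ≤ b → 0 ≢ a * b
  positive (s≤s _) (s≤s _) ()

  2≤*ˡ : ∀ m n → 2 ≤ suc (suc m) * suc n
  2≤*ˡ m n = ℕ.≤-trans (s≤s (s≤s z≤n)) (ℕ.m≤m*n (suc (suc m)) (suc n))

  2≤*ʳ : ∀ m n → 2 ≤ suc m * suc (suc n)
  2≤*ʳ m n = ℕ.≤-trans (s≤s (s≤s z≤n)) (ℕ.m≤n*m (suc (suc n)) (suc m))

  -- The product is positive, so all four classes are nonempty. If r₂c₂ = 1, then r₁ and c₁ have the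
  -- sum and the product of a and b. Otherwise r₂c₂ ≥ 2, and either r₁c₂ and r₂c₁ are both at least
  -- 2, which `sum-too-small` refutes, or one of them is 1, which is the case of `hook` up to
  -- exchanging the sides.
  parameters : ∀ a b r₁ r₂ c₁ c₂ z → 1 ≤ a → 1 ≤ b →
    r₁ * c₁ + r₁ * c₂ + r₂ * c₁ ≡ a * b + a + b →
    r₁ * c₁ * (r₂ * c₂) ≡ a * b →
    r₁ + r₂ + c₁ + c₂ + z ≡ a + b + 2 →
    r₂ ≡ 1 × c₂ ≡ 1 × z ≡ 0 × ((r₁ ≡ a × c₁ ≡ b) ⊎ (r₁ ≡ b × c₁ ≡ a))
  parameters a b r₁ 1 c₁ 1 z _ _ edges product order =
    refl , refl , z≡0 , same-sum-and-product a b r₁ c₁ sum≡ product′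
    where
    product′ : r₁ * c₁ ≡ a * b
    product′ = trans (sym (ℕ.*-identityʳ _)) product
    lemma₁ : ∀ r c → r * c + r * 1 + 1 * c ≡ r * c + (r + c)
    lemma₁ = solve-ℕ
    sum≡ : r₁ + c₁ ≡ a + b
    sum≡ = ℕ.+-cancelˡ-≡ (r₁ * c₁) _ _ (trans (sym (lemma₁ r₁ c₁)) (trans edges
      (trans (ℕ.+-assoc (a * b) a b) (cong (_+ (a + b)) (sym product′)))))
    lemma₂ : ∀ r c z → r + 1 + c + 1 + z ≡ r + c + 2 + z
    lemma₂ = solve-ℕ
    z≡0 : z ≡ 0
    z≡0 = ℕ.+-cancelˡ-≡ (r₁ + c₁ + 2) z 0 (trans (sym (lemma₂ r₁ c₁ z)) (trans order
      (trans (cong (_+ 2) (sym sum≡)) (sym (ℕ.+-identityʳ _)))))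
  parameters a b r₁ zero c₁ c₂ z 1≤a 1≤b edges product order =
    ⊥-elim (positive 1≤a 1≤b (trans (sym (ℕ.*-zeroʳ (r₁ * c₁))) product))
  parameters a b r₁ (suc r) c₁ zero z 1≤a 1≤b edges product order =
    ⊥-elim (positive 1≤a 1≤b (trans (sym (trans (cong (r₁ * c₁ *_) (ℕ.*-zeroʳ (suc r))) (ℕ.*-zeroʳ (r₁ * c₁)))) product))
  parameters a b zero (suc r) c₁ (suc c) z 1≤a 1≤b edges product order = ⊥-elim (positive 1≤a 1≤b product)
  parameters a b (suc r₁) (suc r) zero (suc c) z 1≤a 1≤b edges product order =
    ⊥-elim (positive 1≤a 1≤b (trans (sym (cong (_* (suc r * suc c)) (ℕ.*-zeroʳ (suc r₁)))) product))
  parameters a b (suc r₁) 1 1 (suc (suc c)) z 1≤a 1≤b edges product order = ⊥-elim (hook a b (suc r₁) c z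
    edges (trans (lemma (suc r₁) c) product) (trans (lemma′ (suc r₁) c z) order))
    where
    lemma : ∀ r c → r * suc (suc c) ≡ r * 1 * (1 * suc (suc c))
    lemma = solve-ℕ
    lemma′ : ∀ r c z → r + suc (suc c) + 2 + z ≡ r + 1 + 1 + suc (suc c) + z
    lemma′ = solve-ℕ
  parameters a b 1 (suc (suc r)) (suc c₁) 1 z 1≤a 1≤b edges product order = ⊥-elim (hook a b (suc c₁) r z
    (trans (lemma₀ (suc c₁) r) edges) (trans (lemma (suc c₁) r) product) (trans (lemma′ (suc c₁) r z) order))
    where
    lemma₀ : ∀ c r → c * 1 + c * suc (suc r) + 1 ≡ 1 * c + 1 * 1 + suc (suc r) * c
    lemma₀ = solve-ℕ
    lemma : ∀ c r → c * suc (suc r) ≡ 1 * c * (suc (suc r) * 1)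
    lemma = solve-ℕ
    lemma′ : ∀ c r z → c + suc (suc r) + 2 + z ≡ 1 + suc (suc r) + c + 1 + z
    lemma′ = solve-ℕ
  parameters a b (suc r₁) 1 (suc (suc c₁)) (suc (suc c)) z 1≤a 1≤b edges product order =
    ⊥-elim (sum-too-small a b (suc r₁) 1 (suc (suc c₁)) (suc (suc c)) 1≤a 1≤b edges product
      (2≤*ʳ 0 c) (2≤*ʳ r₁ c) (2≤*ʳ 0 c₁))
  parameters a b (suc (suc r₁)) (suc (suc r)) (suc c₁) 1 z 1≤a 1≤b edges product order =
    ⊥-elim (sum-too-small a b (suc (suc r₁)) (suc (suc r)) (suc c₁) 1 1≤a 1≤b edges product
      (2≤*ˡ r 0) (2≤*ˡ r₁ 0) (2≤*ˡ r c₁))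
  parameters a b (suc r₁) (suc (suc r)) (suc c₁) (suc (suc c)) z 1≤a 1≤b edges product order =
    ⊥-elim (sum-too-small a b (suc r₁) (suc (suc r)) (suc c₁) (suc (suc c)) 1≤a 1≤b edges product
      (2≤*ˡ r (suc c)) (2≤*ʳ r₁ c) (2≤*ˡ r c₁))

-- Determinants

-- Here `punchOut p` is the position of column k among the columns other than j. Both sides
-- enumerate, in increasing order, the columns that remain after deleting j and k.
punchIn-punchOut-swap : ∀ {n} (j k : Fin (suc (suc n))) (p : j ≢ k) (q : k ≢ j) (c : Fin n) →
  punchIn j (punchIn (punchOut p) c) ≡ punchIn k (punchIn (punchOut q) c)
punchIn-punchOut-swap zero    zero    p q c = ⊥-elim (p ≡.refl)
punchIn-punchOut-swap zero    (suc k) p q c = ≡.refl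
punchIn-punchOut-swap (suc j) zero    p q c = ≡.refl
punchIn-punchOut-swap {suc n} (suc j) (suc k) p q zero = ≡.refl
punchIn-punchOut-swap {suc n} (suc j) (suc k) p q (suc c) =
  ≡.cong suc (punchIn-punchOut-swap j k (p ∘ ≡.cong suc) (q ∘ ≡.cong suc) c)

-- The double expansion of a determinant with two equal rows only shows that it equals its own
-- negative; `torsion-free` turns this into zero.
module Determinant {c ℓ} (R : CommutativeRing c ℓ)
  (torsion-free : ∀ x → CommutativeRing._≈_ R (CommutativeRing._+_ R x x) (CommutativeRing.0# R) →
    CommutativeRing._≈_ R x (CommutativeRing.0# R)) where

  open CommutativeRing R hiding (zero)
  open import Algebra.Properties.Semiring.Sum semiring
  open import Algebra.Properties.Ring ring
  open import Relation.Binary.Reasoning.Setoid setoid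
  open import Algebra.Properties.CommutativeSemigroup *-commutativeSemigroup
    using (x∙yz≈y∙xz)

  Matrix : ℕ → Set c
  Matrix n = Fin n → Fin n → Carrier

  sg : ℕ → Carrier
  sg zero    = 1#
  sg (suc k) = - sg k

  _[_≔_] : ∀ {n k} → (Fin n → Fin k → Carrier) → Fin n → (Fin k → Carrier) → Fin n → Fin k → Carrier
  M [ i ≔ v ] = updateAt M i (λ _ → v)

  minor : ∀ {n} → Fin (suc n) → Matrix (suc n) → Matrix n
  minor j M r c = M (suc r) (punchIn j c)

  det : ∀ n → Matrix n → Carrier
  det zero    M = 1#
  det (suc n) M = ∑[ j < suc n ] (sg (toℕ j) * (M zero j * det n (minor j M)))

  det-cong : ∀ n {M N : Matrix n} → (∀ r c → M r c ≈ N r c) → det n M ≈ det n N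
  det-cong zero    M≈N = refl
  det-cong (suc n) {M} {N} M≈N = begin
    ∑[ j < suc n ] (sg (toℕ j) * (M zero j * det n (minor j M)))
      ≈⟨ sum-cong-≋ (λ j → *-congˡ {x = sg (toℕ j)} (*-cong (M≈N zero j) (det-cong n λ r c → M≈N (suc r) (punchIn j c)))) ⟩
    ∑[ j < suc n ] (sg (toℕ j) * (N zero j * det n (minor j N))) ∎

  -- The matrices `N s` are described by how they compare with `M`, instead of being row updates of
  -- it, so that the hypotheses pass to minors as they stand. Either the first row is the one that
  -- is decomposed, or the induction hypothesis applies to every minor.
  det-linear : ∀ n (i : Fin n) {k} (a : Fin k → Carrier) (M : Matrix n) (N : Fin k → Matrix n) →
    (∀ c → M i c ≈ ∑[ s < k ] (a s * N s i c)) →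
    (∀ s r c → r ≢ i → N s r c ≈ M r c) →
    det n M ≈ ∑[ s < k ] (a s * det n (N s))
  det-linear (suc n) zero {k} a M N row rest = begin
    ∑[ j < suc n ] (sg (toℕ j) * (M zero j * D j))
      ≈⟨ sum-cong-≋ (λ j → begin
           sg (toℕ j) * (M zero j * D j)
             ≈⟨ *-congˡ (*-congʳ (row j)) ⟩
           sg (toℕ j) * (∑[ s < k ] (a s * N s zero j) * D j)
             ≈⟨ *-congˡ (*-distribʳ-sum (D j) (λ s → a s * N s zero j)) ⟩
           sg (toℕ j) * ∑[ s < k ] (a s * N s zero j * D j)
             ≈⟨ *-distribˡ-sum (sg (toℕ j)) (λ s → a s * N s zero j * D j) ⟩
           ∑[ s < k ] (sg (toℕ j) * (a s * N s zero j * D j))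
             ≈⟨ sum-cong-≋ (λ s → begin
                  sg (toℕ j) * (a s * N s zero j * D j)
                    ≈⟨ *-congˡ (*-assoc _ _ _) ⟩
                  sg (toℕ j) * (a s * (N s zero j * D j))
                    ≈⟨ x∙yz≈y∙xz _ _ _ ⟩
                  a s * (sg (toℕ j) * (N s zero j * D j))
                    ≈⟨ *-congˡ (*-congˡ (*-congˡ (det-cong n λ r c →
                         sym (rest s (suc r) (punchIn j c) λ ())))) ⟩
                  a s * (sg (toℕ j) * (N s zero j * det n (minor j (N s)))) ∎) ⟩
           ∑[ s < k ] (a s * (sg (toℕ j) * (N s zero j * det n (minor j (N s))))) ∎) ⟩
    ∑[ j < suc n ] ∑[ s < k ] (a s * (sg (toℕ j) * (N s zero j * det n (minor j (N s)))))
      ≈⟨ ∑-comm (λ j s → a s * (sg (toℕ j) * (N s zero j * det n (minor j (N s))))) ⟩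
    ∑[ s < k ] ∑[ j < suc n ] (a s * (sg (toℕ j) * (N s zero j * det n (minor j (N s)))))
      ≈⟨ sum-cong-≋ (λ s → sym (*-distribˡ-sum (a s) (λ j → sg (toℕ j) * (N s zero j * det n (minor j (N s)))))) ⟩
    ∑[ s < k ] (a s * det (suc n) (N s)) ∎
    where
    D : Fin (suc n) → Carrier
    D j = det n (minor j M)
  det-linear (suc n) (suc i) {k} a M N row rest = begin
    ∑[ j < suc n ] (sg (toℕ j) * (M zero j * det n (minor j M)))
      ≈⟨ sum-cong-≋ (λ j → begin
           sg (toℕ j) * (M zero j * det n (minor j M))
             ≈⟨ *-congˡ (*-congˡ (det-linear n i a (minor j M) (λ s → minor j (N s))
                  (λ c → row (punchIn j c))
                  (λ s r c r≢i → rest s (suc r) (punchIn j c) (r≢i ∘ suc-injective)))) ⟩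
           sg (toℕ j) * (M zero j * ∑[ s < k ] (a s * D s j))
             ≈⟨ sym (*-assoc _ _ _) ⟩
           sg (toℕ j) * M zero j * ∑[ s < k ] (a s * D s j)
             ≈⟨ *-distribˡ-sum (sg (toℕ j) * M zero j) (λ s → a s * D s j) ⟩
           ∑[ s < k ] (sg (toℕ j) * M zero j * (a s * D s j))
             ≈⟨ sum-cong-≋ (λ s → begin
                  sg (toℕ j) * M zero j * (a s * D s j)
                    ≈⟨ x∙yz≈y∙xz _ _ _ ⟩
                  a s * (sg (toℕ j) * M zero j * D s j)
                    ≈⟨ *-congˡ (*-assoc _ _ _) ⟩
                  a s * (sg (toℕ j) * (M zero j * D s j))
                    ≈⟨ *-congˡ (*-congˡ (*-congʳ (sym (rest s zero j λ ())))) ⟩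
                  a s * (sg (toℕ j) * (N s zero j * D s j)) ∎) ⟩
           ∑[ s < k ] (a s * (sg (toℕ j) * (N s zero j * D s j))) ∎) ⟩
    ∑[ j < suc n ] ∑[ s < k ] (a s * (sg (toℕ j) * (N s zero j * D s j)))
      ≈⟨ ∑-comm (λ j s → a s * (sg (toℕ j) * (N s zero j * D s j))) ⟩
    ∑[ s < k ] ∑[ j < suc n ] (a s * (sg (toℕ j) * (N s zero j * D s j)))
      ≈⟨ sum-cong-≋ (λ s → sym (*-distribˡ-sum (a s) (λ j → sg (toℕ j) * (N s zero j * D s j)))) ⟩
    ∑[ s < k ] (a s * det (suc n) (N s)) ∎
    where
    D : Fin k → Fin (suc n) → Carrier
    D s j = det n (minor j (N s))

  private
    -- If j < k, deleting column j first moves k down one place, whereas deleting k first leaves j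
    -- where it is. The two exponents therefore differ by one.
    sg-punchOut : ∀ {n} (j k : Fin (suc n)) (p : j ≢ k) (q : k ≢ j) →
      sg (toℕ j) * sg (toℕ (punchOut p)) ≈ - (sg (toℕ k) * sg (toℕ (punchOut q)))
    sg-punchOut zero    zero    p q = ⊥-elim (p ≡.refl)
    sg-punchOut {suc n} zero (suc k) p q = begin
      1# * sg (toℕ k)       ≈⟨ *-comm _ _ ⟩
      sg (toℕ k) * 1#       ≈⟨ sym (-‿involutive _) ⟩
      - - (sg (toℕ k) * 1#) ≈⟨ -‿cong (-‿distribˡ-* _ _) ⟩
      - (- sg (toℕ k) * 1#) ∎
    sg-punchOut {suc n} (suc j) zero p q = begin
      - sg (toℕ j) * 1#   ≈⟨ sym (-‿distribˡ-* _ _) ⟩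
      - (sg (toℕ j) * 1#) ≈⟨ -‿cong (*-comm _ _) ⟩
      - (1# * sg (toℕ j)) ∎
    sg-punchOut {suc n} (suc j) (suc k) p q = begin
      - sg (toℕ j) * - sg (toℕ (punchOut p′)) ≈⟨ neg*neg _ _ ⟩
      sg (toℕ j) * sg (toℕ (punchOut p′))     ≈⟨ sg-punchOut j k p′ q′ ⟩
      - (sg (toℕ k) * sg (toℕ (punchOut q′))) ≈⟨ -‿cong (sym (neg*neg _ _)) ⟩
      - (- sg (toℕ k) * - sg (toℕ (punchOut q′))) ∎
      where
      p′ = p ∘ ≡.cong suc
      q′ = q ∘ ≡.cong suc
      neg*neg : ∀ x y → - x * - y ≈ x * y
      neg*neg x y = trans (sym (-‿distribˡ-* x (- y)))
        (trans (-‿cong (sym (-‿distribʳ-* x y))) (-‿involutive _))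

  -- Expanding along both equal rows gives a sum over ordered pairs of columns
  -- whose summand changes sign when the two columns are exchanged.
  det-first-rows-equal : ∀ n (M : Matrix (suc (suc n))) →
    (∀ c → M zero c ≈ M (suc zero) c) → det (suc (suc n)) M ≈ 0#
  det-first-rows-equal n M eq = torsion-free _ (begin
    det (2+ n) M + det (2+ n) M                  ≈⟨ +-cong expand expand ⟩
    S + S                                        ≈⟨ +-congʳ S≈-S ⟩
    - S + S                                      ≈⟨ -‿inverseˡ S ⟩
    0# ∎)
    where
    2+ : ℕ → ℕ
    2+ m = suc (suc m)
    C : Fin (2+ n) → Fin (suc n) → Carrier
    C j l = det n (minor l (minor j M))
    term : Fin (2+ n) → Fin (2+ n) → Fin (suc n) → Carrier
    term j k l = sg (toℕ j) * (M zero j * (sg (toℕ l) * (M (suc zero) k * C j l)))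
    -- Extended by zero to the diagonal, so that the sum runs over a full square and the two indices
    -- can be exchanged.
    h : Fin (2+ n) → Fin (2+ n) → Carrier
    h j k with j ≟ k
    ... | yes _ = 0#
    ... | no j≢k = term j k (punchOut j≢k)
    S : Carrier
    S = ∑[ j < 2+ n ] ∑[ k < 2+ n ] h j k

    h-diag : ∀ j → h j j ≈ 0#
    h-diag j with j ≟ j
    ... | yes _ = refl
    ... | no j≢j = ⊥-elim (j≢j ≡.refl)

    h-punchIn : ∀ j l → h j (punchIn j l) ≈ term j (punchIn j l) l
    h-punchIn j l with j ≟ punchIn j l
    ... | yes j≡ = ⊥-elim (punchInᵢ≢i j l (≡.sym j≡))
    ... | no j≢ = reflexive (≡.cong (term j (punchIn j l))
            (≡.trans (punchOut-cong j ≡.refl) (punchOut-punchIn j)))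

    reorder : ∀ a x b y d → a * (x * (b * (y * d))) ≈ (a * b) * (x * (y * d))
    reorder a x b y d = begin
      a * (x * (b * (y * d))) ≈⟨ *-congˡ (x∙yz≈y∙xz x b (y * d)) ⟩
      a * (b * (x * (y * d))) ≈⟨ sym (*-assoc _ _ _) ⟩
      (a * b) * (x * (y * d)) ∎

    h-antisym : ∀ j k → h j k ≈ - h k j
    h-antisym j k with j ≟ k | k ≟ j
    ... | yes _ | yes _ = sym -0#≈0#
    ... | yes j≡k | no k≢j = ⊥-elim (k≢j (≡.sym j≡k))
    ... | no j≢k | yes k≡j = ⊥-elim (j≢k (≡.sym k≡j))
    ... | no p | no q = begin
      term j k (punchOut p)
        ≈⟨ reorder _ _ _ _ _ ⟩
      (sg (toℕ j) * sg (toℕ (punchOut p))) * (M zero j * (M (suc zero) k * C j (punchOut p)))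
        ≈⟨ *-cong (sg-punchOut j k p q) (begin
             M zero j * (M (suc zero) k * C j (punchOut p))
               ≈⟨ x∙yz≈y∙xz _ _ _ ⟩
             M (suc zero) k * (M zero j * C j (punchOut p))
               ≈⟨ *-cong (sym (eq k)) (*-cong (eq j) (det-cong n λ r c →
                    reflexive (≡.cong (M (suc (suc r))) (punchIn-punchOut-swap j k p q c)))) ⟩
             M zero k * (M (suc zero) j * C k (punchOut q)) ∎) ⟩
      - (sg (toℕ k) * sg (toℕ (punchOut q))) * (M zero k * (M (suc zero) j * C k (punchOut q)))
        ≈⟨ sym (-‿distribˡ-* _ _) ⟩
      - ((sg (toℕ k) * sg (toℕ (punchOut q))) * (M zero k * (M (suc zero) j * C k (punchOut q))))
        ≈⟨ -‿cong (sym (reorder _ _ _ _ _)) ⟩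
      - term k j (punchOut q) ∎

    expand : det (2+ n) M ≈ S
    expand = sum-cong-≋ λ j → begin
      sg (toℕ j) * (M zero j * ∑[ l < suc n ] (sg (toℕ l) * (M (suc zero) (punchIn j l) * C j l)))
        ≈⟨ sym (*-assoc _ _ _) ⟩
      sg (toℕ j) * M zero j * ∑[ l < suc n ] (sg (toℕ l) * (M (suc zero) (punchIn j l) * C j l))
        ≈⟨ *-distribˡ-sum (sg (toℕ j) * M zero j) (λ l → sg (toℕ l) * (M (suc zero) (punchIn j l) * C j l)) ⟩
      ∑[ l < suc n ] (sg (toℕ j) * M zero j * (sg (toℕ l) * (M (suc zero) (punchIn j l) * C j l)))
        ≈⟨ sum-cong-≋ (λ l → trans (*-assoc _ _ _) (sym (h-punchIn j l))) ⟩
      ∑[ l < suc n ] h j (punchIn j l)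
        ≈⟨ sym (+-identityˡ _) ⟩
      0# + ∑[ l < suc n ] h j (punchIn j l)
        ≈⟨ +-congʳ (sym (h-diag j)) ⟩
      h j j + ∑[ l < suc n ] h j (punchIn j l)
        ≈⟨ sym (sum-remove {i = j} (h j)) ⟩
      ∑[ k < 2+ n ] h j k ∎

    -‿sum : ∀ {m} (f : Fin m → Carrier) → ∑[ i < m ] (- f i) ≈ - ∑[ i < m ] f i
    -‿sum {zero}  f = sym -0#≈0#
    -‿sum {suc m} f = trans (+-congˡ (-‿sum (f ∘ suc))) (-‿+-comm _ _)

    S≈-S : S ≈ - S
    S≈-S = begin
      ∑[ j < 2+ n ] ∑[ k < 2+ n ] h j k      ≈⟨ ∑-comm h ⟩
      ∑[ k < 2+ n ] ∑[ j < 2+ n ] h j k      ≈⟨ sum-cong-≋ (λ k → sum-cong-≋ λ j → h-antisym j k) ⟩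
      ∑[ k < 2+ n ] ∑[ j < 2+ n ] (- h k j)  ≈⟨ sum-cong-≋ (λ k → -‿sum (h k)) ⟩
      ∑[ k < 2+ n ] (- ∑[ j < 2+ n ] h k j)  ≈⟨ -‿sum (λ k → ∑[ j < 2+ n ] h k j) ⟩
      - S ∎

  det-additive : ∀ n (i : Fin n) (M N₁ N₂ : Matrix n) →
    (∀ c → M i c ≈ N₁ i c + N₂ i c) →
    (∀ r c → r ≢ i → N₁ r c ≈ M r c) → (∀ r c → r ≢ i → N₂ r c ≈ M r c) →
    det n M ≈ det n N₁ + det n N₂
  det-additive n i M N₁ N₂ row rest₁ rest₂ = begin
    det n M
      ≈⟨ det-linear n i {2} (λ _ → 1#) M N
           (λ c → trans (row c) (sym (two (N₁ i c) (N₂ i c))))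
           (λ { zero → rest₁ ; (suc zero) → rest₂ }) ⟩
    1# * det n N₁ + (1# * det n N₂ + 0#)
      ≈⟨ two _ _ ⟩
    det n N₁ + det n N₂ ∎
    where
    N : Fin 2 → Matrix n
    N zero       = N₁
    N (suc zero) = N₂
    two : ∀ x y → 1# * x + (1# * y + 0#) ≈ x + y
    two x y = +-cong (*-identityˡ x) (trans (+-identityʳ _) (*-identityˡ y))

  Alternating : ℕ → Set _
  Alternating n = (M : Matrix n) (i k : Fin n) → i ≢ k → (∀ c → M i c ≈ M k c) → det n M ≈ 0#

  private
    det-tail-rows-equal : ∀ n → Alternating n → (M : Matrix (suc n)) (i k : Fin n) → i ≢ k →
      (∀ c → M (suc i) c ≈ M (suc k) c) → det (suc n) M ≈ 0#
    det-tail-rows-equal n alt M i k i≢k eq = begin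
      ∑[ j < suc n ] (sg (toℕ j) * (M zero j * det n (minor j M)))
        ≈⟨ sum-cong-≋ (λ j → trans
             (*-congˡ (trans (*-congˡ (alt (minor j M) i k i≢k λ c → eq (punchIn j c)))
                             (zeroʳ (M zero j))))
             (zeroʳ (sg (toℕ j)))) ⟩
      ∑[ j < suc n ] 0#
        ≈⟨ sum-replicate-zero (suc n) ⟩
      0# ∎

    -- With f u v the determinant after rows 1 and 2 + k are replaced by u and v,
    -- f is biadditive and alternating, and f b v vanishes for b = row 0.
    det-row-zero-equal : ∀ n → Alternating n → (M : Matrix (suc n)) (k : Fin n) →
      (∀ c → M zero c ≈ M (suc k) c) → det (suc n) M ≈ 0#
    det-row-zero-equal (suc n) alt M zero    eq = det-first-rows-equal n M eq
    det-row-zero-equal (suc n) alt M (suc k) eq = begin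
      det _ M                           ≈⟨ det-cong _ M≈Wab ⟩
      f a b                             ≈⟨ sym (+-identityˡ _) ⟩
      0# + f a b                        ≈⟨ +-congʳ (sym (tail≈ a)) ⟩
      f a a + f a b                     ≈⟨ sym (det-additive _ (suc (suc k)) (W a (a ⊕ b)) (W a a) (W a b)
                                             (λ c → trans (reflexive (hit a (a ⊕ b) c)) (sym (+-cong (reflexive (hit a a c)) (reflexive (hit a b c))))) (second a a (a ⊕ b)) (second a b (a ⊕ b))) ⟩
      f a (a ⊕ b)                       ≈⟨ sym (+-identityʳ _) ⟩
      f a (a ⊕ b) + 0#                  ≈⟨ +-congˡ (sym (det-first-rows-equal n (W b (a ⊕ b)) λ c → eq c)) ⟩
      f a (a ⊕ b) + f b (a ⊕ b)         ≈⟨ sym (det-additive _ (suc zero) (W (a ⊕ b) (a ⊕ b)) (W a (a ⊕ b)) (W b (a ⊕ b))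
                                             (λ c → refl) (first a (a ⊕ b) (a ⊕ b)) (first b (a ⊕ b) (a ⊕ b))) ⟩
      f (a ⊕ b) (a ⊕ b)                 ≈⟨ tail≈ (a ⊕ b) ⟩
      0# ∎
      where
      Row = Fin (suc (suc n)) → Carrier
      _⊕_ : Row → Row → Row
      (u ⊕ v) c = u c + v c
      W : Row → Row → Matrix (suc (suc n))
      W u v = (M [ suc zero ≔ u ]) [ suc (suc k) ≔ v ]
      f : Row → Row → Carrier
      f u v = det _ (W u v)
      a b : Row
      a = M (suc zero)
      b = M (suc (suc k))
      M≈Wab : ∀ r c → M r c ≈ W a b r c
      M≈Wab zero          c = refl
      M≈Wab (suc zero)    c = refl
      M≈Wab (suc (suc r)) c = reflexive (≡.sym (≡.cong-app (updateAt-id-local k (λ s → M (suc (suc s))) ≡.refl r) c))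
      hit : ∀ u v c → W u v (suc (suc k)) c ≡ v c
      hit u v c = ≡.cong-app (updateAt-updates k (λ s → M (suc (suc s)))) c
      tail≈ : ∀ u → f u u ≈ 0#
      tail≈ u = det-tail-rows-equal _ alt (W u u) zero (suc k) (λ ()) λ c →
        reflexive (≡.sym (hit u u c))
      first : ∀ u v w r c → r ≢ suc zero → W u v r c ≈ W w v r c
      first u v w zero          c r≢ = refl
      first u v w (suc zero)    c r≢ = ⊥-elim (r≢ ≡.refl)
      first u v w (suc (suc r)) c r≢ = refl
      second : ∀ u v w r c → r ≢ suc (suc k) → W u v r c ≈ W u w r c
      second u v w zero          c r≢ = refl
      second u v w (suc zero)    c r≢ = refl
      second u v w (suc (suc r)) c r≢ = reflexive (≡.cong-app (≡.trans
        (updateAt-minimal r k _ (λ eq → r≢ (≡.cong (λ i → suc (suc i)) eq)))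
        (≡.sym (updateAt-minimal r k _ (λ eq → r≢ (≡.cong (λ i → suc (suc i)) eq))))) c)

  det-rows-equal : ∀ n → Alternating n
  det-rows-equal (suc n) M zero    zero    i≢k eq = ⊥-elim (i≢k ≡.refl)
  det-rows-equal (suc n) M zero    (suc k) i≢k eq = det-row-zero-equal n (det-rows-equal n) M k eq
  det-rows-equal (suc n) M (suc i) zero    i≢k eq = det-row-zero-equal n (det-rows-equal n) M i λ c → sym (eq c)
  det-rows-equal (suc n) M (suc i) (suc k) i≢k eq = det-tail-rows-equal n (det-rows-equal n) M i k (i≢k ∘ ≡.cong suc) eq

  -- By linearity, row i is replaced by each row s in turn with weight `a s`. For s ≠ i that row
  -- then occurs twice and the term vanishes.
  det-replace-combination : ∀ n (i : Fin n) (a : Fin n → Carrier) (M : Matrix n) (v : Fin n → Carrier) →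
    (∀ c → v c ≈ ∑[ s < n ] (a s * M s c)) → det n (M [ i ≔ v ]) ≈ a i * det n M
  det-replace-combination (suc n) i a M v v≈ = begin
    det _ (M [ i ≔ v ])
      ≈⟨ det-linear _ i a (M [ i ≔ v ]) (λ s → M [ i ≔ M s ])
           (λ c → trans (reflexive (hit v c)) (trans (v≈ c)
             (sum-cong-≋ λ s → *-congˡ {x = a s} (reflexive (≡.sym (hit (M s) c))))))
           (λ s r c r≢i → reflexive (≡.cong-app (≡.trans (updateAt-minimal r i M r≢i)
             (≡.sym (updateAt-minimal r i M r≢i))) c)) ⟩
    ∑[ s < suc n ] (a s * det _ (M [ i ≔ M s ]))
      ≈⟨ sum-remove {i = i} (λ s → a s * det _ (M [ i ≔ M s ])) ⟩
    a i * det _ (M [ i ≔ M i ]) + ∑[ s < n ] (a (punchIn i s) * det _ (M [ i ≔ M (punchIn i s) ]))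
      ≈⟨ +-cong
           (*-congˡ (det-cong _ λ r c → reflexive (≡.cong-app (updateAt-id-local i M ≡.refl r) c)))
           (begin
             ∑[ s < n ] (a (punchIn i s) * det _ (M [ i ≔ M (punchIn i s) ]))
               ≈⟨ sum-cong-≋ (λ s → trans (*-congˡ {x = a (punchIn i s)} (repeated s)) (zeroʳ _)) ⟩
             ∑[ s < n ] 0#
               ≈⟨ sum-replicate-zero n ⟩
             0# ∎) ⟩
    a i * det _ M + 0#
      ≈⟨ +-identityʳ _ ⟩
    a i * det _ M ∎
    where
    hit : ∀ u c → (M [ i ≔ u ]) i c ≡ u c
    hit u c = ≡.cong-app (updateAt-updates i M) c
    repeated : ∀ s → det _ (M [ i ≔ M (punchIn i s) ]) ≈ 0#
    repeated s = det-rows-equal _ (M [ i ≔ M (punchIn i s) ]) i (punchIn i s)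
      (λ eq → punchInᵢ≢i i s (≡.sym eq))
      (λ c → reflexive (≡.trans (hit (M (punchIn i s)) c)
        (≡.sym (≡.cong-app (updateAt-minimal (punchIn i s) i M (punchInᵢ≢i i s)) c))))

  det-replace-linear : ∀ n (i : Fin n) (M : Matrix n) (a b : Carrier) (u v w : Fin n → Carrier) →
    (∀ c → w c ≈ a * u c + b * v c) →
    det n (M [ i ≔ w ]) ≈ a * det n (M [ i ≔ u ]) + b * det n (M [ i ≔ v ])
  det-replace-linear n i M a b u v w w≈ = begin
    det n (M [ i ≔ w ])
      ≈⟨ det-linear n i ab (M [ i ≔ w ]) (λ s → M [ i ≔ uv s ])
           (λ c → trans (reflexive (hit w c)) (trans (w≈ c)
             (+-cong (*-congˡ (reflexive (≡.sym (hit u c))))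
               (trans (*-congˡ (reflexive (≡.sym (hit v c)))) (sym (+-identityʳ _))))))
           (λ s r c r≢i → reflexive (≡.cong-app (≡.trans (updateAt-minimal r i M r≢i)
             (≡.sym (updateAt-minimal r i M r≢i))) c)) ⟩
    a * det n (M [ i ≔ u ]) + (b * det n (M [ i ≔ v ]) + 0#)
      ≈⟨ +-congˡ (+-identityʳ _) ⟩
    a * det n (M [ i ≔ u ]) + b * det n (M [ i ≔ v ]) ∎
    where
    ab : Fin 2 → Carrier
    ab zero       = a
    ab (suc zero) = b
    uv : Fin 2 → Fin n → Carrier
    uv zero       = u
    uv (suc zero) = v
    hit : ∀ u c → (M [ i ≔ u ]) i c ≡ u c
    hit u c = ≡.cong-app (updateAt-updates i M) c

  minor-replace : ∀ {n} (j : Fin (suc n)) (M : Matrix (suc n)) (i : Fin n) v r c →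
    minor j (M [ suc i ≔ v ]) r c ≡ (minor j M [ i ≔ (λ c → v (punchIn j c)) ]) r c
  minor-replace j M i v r c = ≡.cong-app
    (map-updateAt {f = λ u c → u (punchIn j c)} {g = λ _ → v} {h = λ _ c → v (punchIn j c)}
      (λ _ → ≡.refl) (λ r → M (suc r)) i r) c

  -- Differentiating a determinant row by row

  module Derivation (θ : Carrier → Carrier)
    (θ-cong : ∀ {x y} → x ≈ y → θ x ≈ θ y)
    (θ-+ : ∀ x y → θ (x + y) ≈ θ x + θ y)
    (θ-* : ∀ x y → θ (x * y) ≈ θ x * y + x * θ y)
    (θ-0 : θ 0# ≈ 0#) (θ-1 : θ 1# ≈ 0#) (θ-neg : ∀ x → θ (- x) ≈ - θ x) where

    θ-sum : ∀ {n} (f : Fin n → Carrier) → θ (∑[ i < n ] f i) ≈ ∑[ i < n ] θ (f i)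
    θ-sum {zero}  f = θ-0
    θ-sum {suc n} f = trans (θ-+ _ _) (+-congˡ (θ-sum (f ∘ suc)))

    θ-sg : ∀ k → θ (sg k) ≈ 0#
    θ-sg zero    = θ-1
    θ-sg (suc k) = trans (θ-neg _) (trans (-‿cong (θ-sg k)) -0#≈0#)

    -- Leibniz on each term of the first-row expansion: θ kills the sign, and it hits either the
    -- entry of row zero, which gives the summand of that row, or the minor, where the induction
    -- applies. Exchanging the sums reassembles the other rows.
    θ-det : ∀ n (M : Matrix n) →
      θ (det n M) ≈ ∑[ i < n ] det n (M [ i ≔ (λ c → θ (M i c)) ])
    θ-det zero    M = θ-1
    θ-det (suc n) M = begin
      θ (∑[ j < suc n ] (s j * (m j * D j)))
        ≈⟨ θ-sum (λ j → s j * (m j * D j)) ⟩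
      ∑[ j < suc n ] θ (s j * (m j * D j))
        ≈⟨ sum-cong-≋ leibniz ⟩
      ∑[ j < suc n ] (s j * (θ (m j) * D j) + ∑[ i < n ] (s j * (m j * E i j)))
        ≈⟨ ∑-distrib-+ (λ j → s j * (θ (m j) * D j)) (λ j → ∑[ i < n ] (s j * (m j * E i j))) ⟩
      ∑[ j < suc n ] (s j * (θ (m j) * D j)) + ∑[ j < suc n ] ∑[ i < n ] (s j * (m j * E i j))
        ≈⟨ +-congˡ (∑-comm (λ j i → s j * (m j * E i j))) ⟩
      ∑[ j < suc n ] (s j * (θ (m j) * D j)) + ∑[ i < n ] ∑[ j < suc n ] (s j * (m j * E i j))
        ≈⟨ +-congˡ (sum-cong-≋ λ i → row i) ⟩
      det (suc n) (M [ zero ≔ (λ c → θ (M zero c)) ])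
        + ∑[ i < n ] det (suc n) (M [ suc i ≔ (λ c → θ (M (suc i) c)) ]) ∎
      where
      s m D : Fin (suc n) → Carrier
      s j = sg (toℕ j)
      m j = M zero j
      D j = det n (minor j M)
      E : Fin n → Fin (suc n) → Carrier
      E i j = det n (minor j M [ i ≔ (λ c → θ (minor j M i c)) ])
      row : ∀ i → ∑[ j < suc n ] (s j * (m j * E i j)) ≈ det (suc n) (M [ suc i ≔ (λ c → θ (M (suc i) c)) ])
      row i = begin
        ∑[ j < suc n ] (s j * (m j * E i j))
          ≈⟨ sum-cong-≋ (λ j → *-congˡ {x = s j} (*-congˡ {x = m j} (det-cong n λ r c →
               reflexive (≡.sym (minor-replace j M i (λ c → θ (M (suc i) c)) r c))))) ⟩
        det (suc n) (M [ suc i ≔ (λ c → θ (M (suc i) c)) ]) ∎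
      leibniz : ∀ j → θ (s j * (m j * D j)) ≈ s j * (θ (m j) * D j) + ∑[ i < n ] (s j * (m j * E i j))
      leibniz j = begin
        θ (s j * (m j * D j))
          ≈⟨ θ-* _ _ ⟩
        θ (s j) * (m j * D j) + s j * θ (m j * D j)
          ≈⟨ +-cong (trans (*-congʳ (θ-sg (toℕ j))) (zeroˡ _)) (*-congˡ (θ-* _ _)) ⟩
        0# + s j * (θ (m j) * D j + m j * θ (D j))
          ≈⟨ trans (+-identityˡ _) (distribˡ _ _ _) ⟩
        s j * (θ (m j) * D j) + s j * (m j * θ (D j))
          ≈⟨ +-congˡ (*-congˡ (*-congˡ (θ-det n (minor j M)))) ⟩
        s j * (θ (m j) * D j) + s j * (m j * ∑[ i < n ] E i j)
          ≈⟨ +-congˡ (sym (*-assoc _ _ _)) ⟩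
        s j * (θ (m j) * D j) + s j * m j * ∑[ i < n ] E i j
          ≈⟨ +-congˡ (*-distribˡ-sum (s j * m j) (λ i → E i j)) ⟩
        s j * (θ (m j) * D j) + ∑[ i < n ] (s j * m j * E i j)
          ≈⟨ +-congˡ (sum-cong-≋ λ i → *-assoc (s j) (m j) (E i j)) ⟩
        s j * (θ (m j) * D j) + ∑[ i < n ] (s j * (m j * E i j)) ∎

-- Power series and the characteristic polynomial

open import Data.Integer using (-_; _+_; _-_; _*_)
open import Relation.Binary.PropositionalEquality
  using (refl; sym; trans; cong; cong₂; subst; subst₂; module ≡-Reasoning)
open import Algebra.Properties.Semiring.Sum (CommutativeRing.semiring ℤ.+-*-commutativeRing)
  using (sum; sum-cong-≗; sum-remove; sum-replicate-zero; *-distribˡ-sum; *-distribʳ-sum; ∑-distrib-+; ∑-comm)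

module Spectra where

  open ≡-Reasoning

  -- Coefficient lists are not a ring under `_≡_`, since trailing zeros are significant. Coefficient
  -- functions compared pointwise are, and `Cospectral` compares exactly these. Finite degree is
  -- carried separately by `Degree≤`.
  Series : Set
  Series = ℕ → ℤ

  infixl 7 _⊛_
  _⊛_ : Series → Series → Series
  (f ⊛ g) zero    = f 0 * g 0
  (f ⊛ g) (suc n) = f 0 * g (suc n) + ((f ∘ suc) ⊛ g) n

  infixl 6 _⊕_
  _⊕_ : Series → Series → Series
  (f ⊕ g) n = f n + g n

  infix 4 _≐_
  _≐_ : Series → Series → Set
  f ≐ g = ∀ n → f n ≡ g n

  constant : ℤ → Series
  constant a = coeff (constP a)

  ⊛-cong : ∀ {f f′ g g′} → f ≐ f′ → g ≐ g′ → f ⊛ g ≐ f′ ⊛ g′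
  ⊛-cong f≐ g≐ zero    = cong₂ _*_ (f≐ 0) (g≐ 0)
  ⊛-cong f≐ g≐ (suc n) = cong₂ _+_ (cong₂ _*_ (f≐ 0) (g≐ (suc n))) (⊛-cong (f≐ ∘ suc) g≐ n)

  ⊛-zeroˡ : ∀ g → (λ _ → + 0) ⊛ g ≐ λ _ → + 0
  ⊛-zeroˡ g zero    = refl
  ⊛-zeroˡ g (suc n) = cong (_+_ (+ 0)) (⊛-zeroˡ g n)

  ⊛-distribʳ : ∀ h f g → (f ⊕ g) ⊛ h ≐ f ⊛ h ⊕ g ⊛ h
  ⊛-distribʳ h f g zero    = ℤ.*-distribʳ-+ (h 0) (f 0) (g 0)
  ⊛-distribʳ h f g (suc n) = trans
    (cong (_+_ ((f 0 + g 0) * h (suc n))) (⊛-distribʳ h (f ∘ suc) (g ∘ suc) n))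
    (lemma (f 0) (g 0) (h (suc n)) _ _)
    where
    lemma : ∀ a b c x y → (a + b) * c + (x + y) ≡ (a * c + x) + (b * c + y)
    lemma = solve-∀

  ⊛-scale : ∀ a f g → (λ n → a * f n) ⊛ g ≐ λ n → a * (f ⊛ g) n
  ⊛-scale a f g zero    = ℤ.*-assoc a (f 0) (g 0)
  ⊛-scale a f g (suc n) = trans
    (cong (_+_ (a * f 0 * g (suc n))) (⊛-scale a (f ∘ suc) g n)) (lemma a (f 0) (g (suc n)) _)
    where
    lemma : ∀ a b c x → a * b * c + a * x ≡ a * (b * c + x)
    lemma = solve-∀

  ⊛-sucʳ : ∀ f g n → (f ⊛ g) (suc n) ≡ f (suc n) * g 0 + (f ⊛ (g ∘ suc)) n
  ⊛-sucʳ f g zero    = ℤ.+-comm (f 0 * g 1) (f 1 * g 0)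
  ⊛-sucʳ f g (suc n) = trans
    (cong (_+_ (f 0 * g (suc (suc n)))) (⊛-sucʳ (f ∘ suc) g n)) (lemma (f 0 * g (suc (suc n))) (f (suc (suc n)) * g 0) (((f ∘ suc) ⊛ (g ∘ suc)) n))
    where
    lemma : ∀ a b c → a + (b + c) ≡ b + (a + c)
    lemma = solve-∀

  ⊛-comm : ∀ f g → f ⊛ g ≐ g ⊛ f
  ⊛-comm f g zero    = ℤ.*-comm (f 0) (g 0)
  ⊛-comm f g (suc n) = trans
    (cong₂ _+_ (ℤ.*-comm (f 0) (g (suc n))) (⊛-comm (f ∘ suc) g n)) (sym (⊛-sucʳ g f n))

  ⊛-assoc : ∀ f g h → (f ⊛ g) ⊛ h ≐ f ⊛ (g ⊛ h)
  ⊛-assoc f g h zero    = ℤ.*-assoc (f 0) (g 0) (h 0)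
  ⊛-assoc f g h (suc n) = begin
    f 0 * g 0 * h (suc n) + (((λ k → f 0 * g (suc k)) ⊕ (f ∘ suc) ⊛ g) ⊛ h) n
      ≡⟨ cong (_+_ (f 0 * g 0 * h (suc n))) (⊛-distribʳ h (λ k → f 0 * g (suc k)) ((f ∘ suc) ⊛ g) n) ⟩
    f 0 * g 0 * h (suc n) + (((λ k → f 0 * g (suc k)) ⊛ h) n + (((f ∘ suc) ⊛ g) ⊛ h) n)
      ≡⟨ cong (_+_ (f 0 * g 0 * h (suc n))) (cong₂ _+_ (⊛-scale (f 0) (g ∘ suc) h n) (⊛-assoc (f ∘ suc) g h n)) ⟩
    f 0 * g 0 * h (suc n) + (f 0 * ((g ∘ suc) ⊛ h) n + ((f ∘ suc) ⊛ (g ⊛ h)) n)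
      ≡⟨ lemma (f 0) (g 0) (h (suc n)) _ _ ⟩
    f 0 * (g 0 * h (suc n) + ((g ∘ suc) ⊛ h) n) + ((f ∘ suc) ⊛ (g ⊛ h)) n ∎
    where
    lemma : ∀ a b c x y → a * b * c + (a * x + y) ≡ a * (b * c + x) + y
    lemma = solve-∀

  constant-⊛ : ∀ a f → constant a ⊛ f ≐ λ n → a * f n
  constant-⊛ a f zero    = refl
  constant-⊛ a f (suc n) = trans (cong (_+_ (a * f (suc n))) (⊛-zeroˡ f n)) (ℤ.+-identityʳ _)

  ⊛-identityˡ : ∀ f → constant (+ 1) ⊛ f ≐ f
  ⊛-identityˡ f n = trans (constant-⊛ (+ 1) f n) (ℤ.*-identityˡ (f n))

  seriesRing : CommutativeRing _ _
  seriesRing = record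
    { Carrier = Series
    ; _≈_ = _≐_
    ; _+_ = _⊕_
    ; _*_ = _⊛_
    ; -_ = λ f n → - f n
    ; 0# = λ _ → + 0
    ; 1# = constant (+ 1)
    ; isCommutativeRing = record
      { isRing = record
        { +-isAbelianGroup = Pointwise.isAbelianGroup ℕ ℤ.+-0-isAbelianGroup
        ; *-cong = ⊛-cong
        ; *-assoc = ⊛-assoc
        ; *-identity = ⊛-identityˡ , λ f n → trans (⊛-comm f _ n) (⊛-identityˡ f n)
        ; distrib = (λ f g h n → trans (⊛-comm f _ n) (trans (⊛-distribʳ f g h n)
                      (cong₂ _+_ (⊛-comm g f n) (⊛-comm h f n)))) , ⊛-distribʳ
        }
      ; *-comm = ⊛-comm
      }
    }

  double-zero : ∀ x → x + x ≡ + 0 → x ≡ + 0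
  double-zero (+ zero) _ = refl

  series-torsion-free : ∀ f → f ⊕ f ≐ (λ _ → + 0) → f ≐ λ _ → + 0
  series-torsion-free f 2f≐0 n = double-zero (f n) (2f≐0 n)

  open Determinant seriesRing series-torsion-free
  open CommutativeRing seriesRing using (0#; 1#)
  open import Algebra.Properties.Semiring.Sum (CommutativeRing.semiring seriesRing)
    using (sum-cong-≋) renaming (sum to sumS; *-distribˡ-sum to *-distribˡ-sumS)

  sumS-coeff : ∀ {m} (f : Fin m → Series) k → sumS f k ≡ sum (λ i → f i k)
  sumS-coeff {zero}  f k = refl
  sumS-coeff {suc m} f k = cong (_+_ (f zero k)) (sumS-coeff (f ∘ suc) k)

  coeff-+P : ∀ p q → coeff (p +P q) ≐ coeff p ⊕ coeff q
  coeff-+P []      q       k       = sym (ℤ.+-identityˡ _)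
  coeff-+P (a ∷ p) []      k       = sym (ℤ.+-identityʳ _)
  coeff-+P (a ∷ p) (b ∷ q) zero    = refl
  coeff-+P (a ∷ p) (b ∷ q) (suc k) = coeff-+P p q k

  coeff-scaleP : ∀ a p k → coeff (scaleP a p) k ≡ a * coeff p k
  coeff-scaleP a []      k       = sym (ℤ.*-zeroʳ a)
  coeff-scaleP a (b ∷ p) zero    = refl
  coeff-scaleP a (b ∷ p) (suc k) = coeff-scaleP a p k

  coeff-*P : ∀ p q → coeff (p *P q) ≐ coeff p ⊛ coeff q
  coeff-*P []      q k    = sym (⊛-zeroˡ (coeff q) k)
  coeff-*P (a ∷ p) q k    = trans (coeff-+P (scaleP a q) _ k) (step k)
    where
    step : ∀ k → coeff (scaleP a q) k + coeff (+ 0 ∷ (p *P q)) k ≡ (coeff (a ∷ p) ⊛ coeff q) k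
    step zero    = trans (ℤ.+-identityʳ _) (coeff-scaleP a q 0)
    step (suc k) = cong₂ _+_ (coeff-scaleP a q (suc k)) (coeff-*P p q k)

  coeff-sumP : ∀ n (f : Fin n → Poly) → coeff (sumP n f) ≐ sumS (λ i → coeff (f i))
  coeff-sumP zero    f k = refl
  coeff-sumP (suc n) f k = trans (coeff-+P (f zero) _ k) (cong (_+_ (coeff (f zero) k)) (coeff-sumP n (f ∘ suc) k))

  sg-constant : ∀ j → sg j ≐ constant (signℤ j)
  sg-constant zero    k       = refl
  sg-constant (suc j) zero    = cong -_ (sg-constant j 0)
  sg-constant (suc j) (suc k) = cong -_ (sg-constant j (suc k))

  coeff-det : ∀ n (M : Fin n → Fin n → Poly) → coeff (Defs.det n M) ≐ det n (λ i j → coeff (M i j))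
  coeff-det zero    M k = refl
  coeff-det (suc n) M k = begin
    coeff (sumP (suc n) (λ j → scaleP (signℤ (toℕ j)) (M zero j *P D j))) k
      ≡⟨ coeff-sumP (suc n) (λ j → scaleP (signℤ (toℕ j)) (M zero j *P D j)) k ⟩
    sumS (λ j → coeff (scaleP (signℤ (toℕ j)) (M zero j *P D j))) k
      ≡⟨ sum-cong-≋ {x = λ j → coeff (scaleP (signℤ (toℕ j)) (M zero j *P D j))}
           {y = λ j → sg (toℕ j) ⊛ (coeff (M zero j) ⊛ det n (minor j (λ i j → coeff (M i j))))} entry k ⟩
    det (suc n) (λ i j → coeff (M i j)) k ∎
    where
    D : Fin (suc n) → Poly
    D j = Defs.det n (λ r c → M (suc r) (punchIn j c))
    entry : ∀ j → coeff (scaleP (signℤ (toℕ j)) (M zero j *P D j)) ≐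
                  sg (toℕ j) ⊛ (coeff (M zero j) ⊛ det n (minor j (λ i j → coeff (M i j))))
    entry j k = begin
      coeff (scaleP (signℤ (toℕ j)) (M zero j *P D j)) k
        ≡⟨ coeff-scaleP (signℤ (toℕ j)) (M zero j *P D j) k ⟩
      signℤ (toℕ j) * coeff (M zero j *P D j) k
        ≡⟨ sym (constant-⊛ (signℤ (toℕ j)) (coeff (M zero j *P D j)) k) ⟩
      (constant (signℤ (toℕ j)) ⊛ coeff (M zero j *P D j)) k
        ≡⟨ ⊛-cong (λ k → sym (sg-constant (toℕ j) k))
             (λ k → trans (coeff-*P (M zero j) (D j) k) (⊛-cong (λ _ → refl) (coeff-det n (λ r c → M (suc r) (punchIn j c))) k)) k ⟩
      (sg (toℕ j) ⊛ (coeff (M zero j) ⊛ det n (minor j (λ i j → coeff (M i j))))) k ∎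

  -- Degrees of determinants with linear entries

  Degree≤ : ℕ → Series → Set
  Degree≤ d f = ∀ k → d ℕ.< k → f k ≡ + 0

  degree-⊛ : ∀ a b f g → Degree≤ a f → Degree≤ b g → Degree≤ (a ℕ.+ b) (f ⊛ g)
  degree-⊛ zero b f g df dg (suc k) b<k = cong₂ _+_
    (trans (cong (f 0 *_) (dg (suc k) b<k)) (ℤ.*-zeroʳ (f 0)))
    (trans (⊛-cong {f ∘ suc} {λ _ → + 0} {g} {g} (λ k → df (suc k) (s≤s z≤n)) (λ _ → refl) k) (⊛-zeroˡ g k))
  degree-⊛ (suc a) b f g df dg (suc k) (s≤s a+b<k) = cong₂ _+_
    (trans (cong (f 0 *_) (dg (suc k) (ℕ.≤-<-trans (ℕ.m≤n+m b a) (ℕ.<-trans a+b<k (ℕ.n<1+n k))))) (ℤ.*-zeroʳ (f 0)))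
    (degree-⊛ a b (f ∘ suc) g (λ k a<k → df (suc k) (s≤s a<k)) dg k a+b<k)

  degree-sumS : ∀ d {m} (f : Fin m → Series) → (∀ i → Degree≤ d (f i)) → Degree≤ d (sumS f)
  degree-sumS d {zero}  f df k d<k = refl
  degree-sumS d {suc m} f df k d<k = cong₂ _+_ (df zero k d<k) (degree-sumS d (f ∘ suc) (df ∘ suc) k d<k)

  degree-sg : ∀ j → Degree≤ 0 (sg j)
  degree-sg zero    (suc k) _ = refl
  degree-sg (suc j) (suc k) p = cong -_ (degree-sg j (suc k) p)

  degree-det : ∀ n (M : Matrix n) → (∀ i j → Degree≤ 1 (M i j)) → Degree≤ n (det n M)
  degree-det zero    M dM (suc k) _ = refl
  degree-det (suc n) M dM = degree-sumS (suc n) _ λ j →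
    degree-⊛ 0 (suc n) (sg (toℕ j)) _ (degree-sg (toℕ j))
      (degree-⊛ 1 n (M zero j) _ (dM zero j) (degree-det n (minor j M) (λ r c → dM (suc r) (punchIn j c))))

  -- Each term of the full expansion takes one factor from row i. That factor is now constant, so
  -- the bound for n + 1 linear rows drops by one.
  degree-det-constant-row : ∀ n (M : Matrix (suc n)) i → (∀ r c → Degree≤ 1 (M r c)) →
    (∀ c → Degree≤ 0 (M i c)) → Degree≤ n (det (suc n) M)
  degree-det-constant-row n M zero dM dMᵢ = degree-sumS n _ λ j →
    degree-⊛ 0 n (sg (toℕ j)) _ (degree-sg (toℕ j))
      (degree-⊛ 0 n (M zero j) _ (dMᵢ j) (degree-det n (minor j M) (λ r c → dM (suc r) (punchIn j c))))
  degree-det-constant-row (suc n) M (suc i) dM dMᵢ = degree-sumS (suc n) _ λ j →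
    degree-⊛ 0 (suc n) (sg (toℕ j)) _ (degree-sg (toℕ j))
      (degree-⊛ 1 n (M zero j) _ (dM zero j)
        (degree-det-constant-row n (minor j M) i (λ r c → dM (suc r) (punchIn j c)) (λ c → dMᵢ (punchIn j c))))

  -- Off-diagonal entries are constant, so every term of the first-row expansion except the first
  -- stays below the top degree, and the first passes on the top coefficient of its minor.
  det-monic : ∀ n (M : Matrix n) → (∀ i j → Degree≤ 1 (M i j)) →
    (∀ i → M i i 1 ≡ + 1) → (∀ i j → i ≢ j → M i j 1 ≡ + 0) → det n M n ≡ + 1
  det-monic zero    M dM one off = refl
  det-monic (suc n) M dM one off = begin
    (1# ⊛ (M zero zero ⊛ D)) (suc n) + sumS rest (suc n)
      ≡⟨ cong₂ _+_ (⊛-identityˡ (M zero zero ⊛ D) (suc n)) (degree-sumS n rest degree-rest (suc n) (ℕ.n<1+n n)) ⟩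
    M zero zero 0 * D (suc n) + ((M zero zero ∘ suc) ⊛ D) n + + 0
      ≡⟨ ℤ.+-identityʳ _ ⟩
    M zero zero 0 * D (suc n) + ((M zero zero ∘ suc) ⊛ D) n
      ≡⟨ cong₂ _+_ (trans (cong (M zero zero 0 *_) (degree-det n (minor zero M) (λ r c → dM (suc r) (suc c)) (suc n) (ℕ.n<1+n n)))
                          (ℤ.*-zeroʳ (M zero zero 0)))
                   (trans (⊛-cong {M zero zero ∘ suc} {1#} {D} {D} shifted (λ _ → refl) n) (⊛-identityˡ D n)) ⟩
    + 0 + D n
      ≡⟨ ℤ.+-identityˡ _ ⟩
    D n
      ≡⟨ det-monic n (minor zero M) (λ r c → dM (suc r) (suc c)) (one ∘ suc)
           (λ i j i≢j → off (suc i) (suc j) λ { refl → i≢j refl }) ⟩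
    + 1 ∎
    where
    D : Series
    D = det n (minor zero M)
    rest : Fin n → Series
    rest j = sg (toℕ (suc j)) ⊛ (M zero (suc j) ⊛ det n (minor (suc j) M))
    shifted : M zero zero ∘ suc ≐ 1#
    shifted zero    = one zero
    shifted (suc k) = dM zero zero (suc (suc k)) (s≤s (s≤s z≤n))
    degree-rest : ∀ j → Degree≤ n (rest j)
    degree-rest j = degree-⊛ 0 n (sg (toℕ (suc j))) _ (degree-sg (toℕ (suc j)))
      (degree-⊛ 0 n (M zero (suc j)) _ constant-entry
        (degree-det n (minor (suc j) M) (λ r c → dM (suc r) (punchIn (suc j) c))))
      where
      constant-entry : Degree≤ 0 (M zero (suc j))
      constant-entry (suc zero)    _ = off zero (suc j) λ ()
      constant-entry (suc (suc k)) _ = dM zero (suc j) (suc (suc k)) (s≤s (s≤s z≤n))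

  -- This is x d/dx. It leaves every coefficient at its index, unlike d/dx, at the price of a factor
  -- x that `euler-p` cancels.
  euler : Series → Series
  euler f n = + n * f n

  euler-⊛ : ∀ f g → euler (f ⊛ g) ≐ euler f ⊛ g ⊕ f ⊛ euler g
  euler-⊛ f g zero    = lemma (f 0) (g 0)
    where
    lemma : ∀ a b → + 0 * (a * b) ≡ + 0 * a * b + a * (+ 0 * b)
    lemma = solve-∀
  euler-⊛ f g (suc n) = begin
    + suc n * (f 0 * g (suc n) + (f′ ⊛ g) n)
      ≡⟨ lemma₁ (+ n) (f 0 * g (suc n)) ((f′ ⊛ g) n) ⟩
    + suc n * (f 0 * g (suc n)) + ((f′ ⊛ g) n + + n * (f′ ⊛ g) n)
      ≡⟨ cong (λ x → + suc n * (f 0 * g (suc n)) + ((f′ ⊛ g) n + x)) (euler-⊛ f′ g n) ⟩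
    + suc n * (f 0 * g (suc n)) + ((f′ ⊛ g) n + ((euler f′ ⊛ g) n + (f′ ⊛ euler g) n))
      ≡⟨ lemma₂ (+ suc n) (f 0) (g (suc n)) ((f′ ⊛ g) n) ((euler f′ ⊛ g) n) ((f′ ⊛ euler g) n) ⟩
    (+ 0 * f 0 * g (suc n) + ((f′ ⊛ g) n + (euler f′ ⊛ g) n)) + (f 0 * (+ suc n * g (suc n)) + (f′ ⊛ euler g) n)
      ≡⟨ cong (λ x → (+ 0 * f 0 * g (suc n) + x) + (f 0 * (+ suc n * g (suc n)) + (f′ ⊛ euler g) n))
           (trans (sym (⊛-distribʳ g f′ (euler f′) n))
                  (⊛-cong {f′ ⊕ euler f′} {euler f ∘ suc} {g} {g} (λ k → shift (+ k) (f′ k)) (λ _ → refl) n)) ⟩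
    (+ 0 * f 0 * g (suc n) + ((euler f ∘ suc) ⊛ g) n) + (f 0 * (+ suc n * g (suc n)) + (f′ ⊛ euler g) n) ∎
    where
    f′ = f ∘ suc
    shift : ∀ k a → a + k * a ≡ (+ 1 + k) * a
    shift = solve-∀
    lemma₁ : ∀ k a b → (+ 1 + k) * (a + b) ≡ (+ 1 + k) * a + (b + k * b)
    lemma₁ = solve-∀
    lemma₂ : ∀ m a b x y z → m * (a * b) + (x + (y + z)) ≡ (+ 0 * a * b + (x + y)) + (a * (m * b) + z)
    lemma₂ = solve-∀

  euler-1 : euler 1# ≐ 0#
  euler-1 zero    = refl
  euler-1 (suc n) = ℤ.*-zeroʳ (+ suc n)

  open Derivation euler (λ f≐g n → cong (+ n *_) (f≐g n)) (λ f g n → ℤ.*-distribˡ-+ (+ n) (f n) (g n))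
    euler-⊛ (λ n → ℤ.*-zeroʳ (+ n)) euler-1 (λ f n → sym (ℤ.neg-distribʳ-* (+ n) (f n)))

  -- Newton's identities for the traces of powers

  δ : ∀ {n} → Fin n → Fin n → ℤ
  δ i j = if does (i ≟ j) then + 1 else + 0

  δ-refl : ∀ {n} (i : Fin n) → δ i i ≡ + 1
  δ-refl i with i ≟ i
  ... | yes _ = refl
  ... | no i≢i = ⊥-elim (i≢i refl)

  δ-≢ : ∀ {n} {i j : Fin n} → i ≢ j → δ i j ≡ + 0
  δ-≢ {i = i} {j} i≢j with i ≟ j
  ... | yes i≡j = ⊥-elim (i≢j i≡j)
  ... | no _ = refl

  sum-δʳ : ∀ {n} (f : Fin n → ℤ) j → sum (λ i → f i * δ i j) ≡ f j
  sum-δʳ {suc n} f j = begin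
    sum (λ i → f i * δ i j)
      ≡⟨ sum-remove {i = j} (λ i → f i * δ i j) ⟩
    f j * δ j j + sum (λ i → f (punchIn j i) * δ (punchIn j i) j)
      ≡⟨ cong₂ _+_ (trans (cong (f j *_) (δ-refl j)) (ℤ.*-identityʳ (f j)))
           (trans (sum-cong-≗ λ i → trans (cong (f (punchIn j i) *_) (δ-≢ (punchInᵢ≢i j i))) (ℤ.*-zeroʳ (f (punchIn j i))))
                  (sum-replicate-zero n)) ⟩
    f j + + 0
      ≡⟨ ℤ.+-identityʳ (f j) ⟩
    f j ∎

  IntMatrix : ℕ → Set
  IntMatrix n = Fin n → Fin n → ℤ

  pow : ∀ {n} → IntMatrix n → ℕ → IntMatrix n
  pow A zero    i j = δ i j
  pow A (suc k) i j = sum (λ s → pow A k i s * A s j)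

  tr : ∀ {n} → IntMatrix n → ℕ → ℤ
  tr A k = sum (λ i → pow A k i i)

  module Newton {n} (A : IntMatrix n) where

    charEntry : Fin n → Fin n → Poly
    charEntry i j = (if does (i ≟ j) then X else []) +P constP (- A i j)

    M : Matrix n
    M i j = coeff (charEntry i j)

    p : Series
    p = det n M

    M-0 : ∀ i j → M i j 0 ≡ - A i j
    M-0 i j with i ≟ j
    ... | yes _ = ℤ.+-identityˡ _
    ... | no _  = refl

    M-1 : ∀ i j → M i j 1 ≡ δ i j
    M-1 i j with i ≟ j
    ... | yes _ = refl
    ... | no _  = refl

    M-2 : ∀ i j k → M i j (suc (suc k)) ≡ + 0
    M-2 i j k with i ≟ j
    ... | yes _ = refl
    ... | no _  = refl

    degree-M : ∀ i j → Degree≤ 1 (M i j)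
    degree-M i j (suc (suc k)) _ = M-2 i j k
    degree-M i j (suc zero) (s≤s ())

    degree-p : Degree≤ n p
    degree-p = degree-det n M degree-M

    p-monic : p n ≡ + 1
    p-monic = det-monic n M degree-M (λ i → trans (M-1 i i) (δ-refl i)) (λ i j i≢j → trans (M-1 i j) (δ-≢ i≢j))

    -- By expansion along row i this is the i-th diagonal entry of Aᵏ adj(xI - A), so `Q k` is the
    -- trace of that matrix. Row replacement makes it available without an adjugate.
    q : ℕ → Fin n → Series
    q k i = det n (M [ i ≔ (λ c → constant (pow A k i c)) ])

    Q : ℕ → Series
    Q k = sumS (q k)

    x⊛ : ∀ f k → (coeff X ⊛ f) (suc k) ≡ f k
    x⊛ f k = trans (ℤ.+-identityˡ _) (⊛-identityˡ f k)

    x·row : ∀ k i c → sumS (λ s → constant (pow A k i s) ⊛ M s c) ≐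
      coeff X ⊛ constant (pow A k i c) ⊕ constant (- (+ 1)) ⊛ constant (pow A (suc k) i c)
    x·row k i c d = trans (sumS-coeff (λ s → constant (pow A k i s) ⊛ M s c) d)
      (trans (sum-cong-≗ λ s → constant-⊛ (pow A k i s) (M s c) d)
        (trans (go d) (cong (_+_ ((coeff X ⊛ constant (pow A k i c)) d))
          (sym (constant-⊛ (- (+ 1)) (constant (pow A (suc k) i c)) d)))))
      where
      u = pow A k i
      v = pow A (suc k) i
      go : ∀ d → sum (λ s → u s * M s c d) ≡ (coeff X ⊛ constant (u c)) d + - (+ 1) * constant (v c) d
      go zero = begin
        sum (λ s → u s * M s c 0)
          ≡⟨ sum-cong-≗ (λ s → trans (cong (u s *_) (M-0 s c)) (lemma (u s) (A s c))) ⟩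
        sum (λ s → - (+ 1) * (u s * A s c))
          ≡⟨ sym (*-distribˡ-sum (- (+ 1)) (λ s → u s * A s c)) ⟩
        - (+ 1) * v c
          ≡⟨ sym (ℤ.+-identityˡ _) ⟩
        + 0 * u c + - (+ 1) * v c ∎
        where
        lemma : ∀ a b → a * - b ≡ - (+ 1) * (a * b)
        lemma = solve-∀
      go (suc d) = begin
        sum (λ s → u s * M s c (suc d))
          ≡⟨ high d ⟩
        constant (u c) d
          ≡⟨ sym (x⊛ (constant (u c)) d) ⟩
        (coeff X ⊛ constant (u c)) (suc d)
          ≡⟨ sym (ℤ.+-identityʳ _) ⟩
        (coeff X ⊛ constant (u c)) (suc d) + + 0 ∎
        where
        high : ∀ d → sum (λ s → u s * M s c (suc d)) ≡ constant (u c) d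
        high zero    = trans (sum-cong-≗ λ s → cong (u s *_) (M-1 s c)) (sum-δʳ u c)
        high (suc d) = trans (sum-cong-≗ λ s → trans (cong (u s *_) (M-2 s c d)) (ℤ.*-zeroʳ (u s)))
                             (sum-replicate-zero n)

    q-step : ∀ k i → constant (pow A k i i) ⊛ p ≐ coeff X ⊛ q k i ⊕ constant (- (+ 1)) ⊛ q (suc k) i
    q-step k i d = trans
      (sym (det-replace-combination n i (λ s → constant (pow A k i s)) M w (λ c d → refl) d))
      (det-replace-linear n i M (coeff X) (constant (- (+ 1)))
        (λ c → constant (pow A k i c)) (λ c → constant (pow A (suc k) i c)) w (x·row k i) d)
      where
      w : Fin n → Series
      w c = sumS (λ s → constant (pow A k i s) ⊛ M s c)

    -- This is the trace of p Aᵏ = Aᵏ (xI - A) adj(xI - A), and it serves as a recursion from `Q k`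
    -- to `Q (suc k)`.
    Q-step : ∀ k d → tr A k * p d ≡ (coeff X ⊛ Q k) d - Q (suc k) d
    Q-step k d = begin
      tr A k * p d
        ≡⟨ *-distribʳ-sum (p d) (λ i → pow A k i i) ⟩
      sum (λ i → pow A k i i * p d)
        ≡⟨ sum-cong-≗ (λ i → trans (sym (constant-⊛ (pow A k i i) p d)) (q-step k i d)) ⟩
      sum (λ i → (coeff X ⊛ q k i) d + (constant (- (+ 1)) ⊛ q (suc k) i) d)
        ≡⟨ ∑-distrib-+ (λ i → (coeff X ⊛ q k i) d) (λ i → (constant (- (+ 1)) ⊛ q (suc k) i) d) ⟩
      sum (λ i → (coeff X ⊛ q k i) d) + sum (λ i → (constant (- (+ 1)) ⊛ q (suc k) i) d)
        ≡⟨ cong₂ _+_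
             (trans (sym (sumS-coeff (λ i → coeff X ⊛ q k i) d)) (sym (*-distribˡ-sumS (coeff X) (q k) d)))
             (trans (sum-cong-≗ λ i → constant-⊛ (- (+ 1)) (q (suc k) i) d)
               (trans (sym (*-distribˡ-sum (- (+ 1)) (λ i → q (suc k) i d)))
                 (trans (ℤ.-1*i≡-i _) (cong -_ (sym (sumS-coeff (q (suc k)) d)))))) ⟩
      (coeff X ⊛ Q k) d - Q (suc k) d ∎

    -- Applying x d/dx to row i of xI - A leaves x times row i of the identity, so `θ-det` gives x
    -- p′ = x `Q 0`. Cancelling x shifts the index by one.
    euler-p : ∀ d → + suc d * p (suc d) ≡ Q 0 d
    euler-p d = trans (θ-det n M (suc d))
      (trans (sumS-coeff (λ i → det n (M [ i ≔ (λ c → euler (M i c)) ])) (suc d))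
        (trans (sum-cong-≗ row) (sym (sumS-coeff (q 0) d))))
      where
      -- The second summand is zero; it gives the row the two-term shape that `det-replace-linear`
      -- expects.
      x·δ : ∀ i c → euler (M i c) ≐ coeff X ⊛ constant (δ i c) ⊕ (λ _ → + 0) ⊛ constant (+ 0)
      x·δ i c zero          = refl
      x·δ i c (suc zero)    = trans (ℤ.*-identityˡ _) (trans (M-1 i c)
        (sym (trans (ℤ.+-identityʳ _) (x⊛ (constant (δ i c)) 0))))
      x·δ i c (suc (suc k)) = trans (cong (+ suc (suc k) *_) (M-2 i c k)) (trans (ℤ.*-zeroʳ (+ suc (suc k)))
        (sym (cong₂ _+_ (x⊛ (constant (δ i c)) (suc k)) (⊛-zeroˡ (constant (+ 0)) (suc (suc k))))))
      row : ∀ i → det n (M [ i ≔ (λ c → euler (M i c)) ]) (suc d) ≡ q 0 i d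
      row i = trans
        (det-replace-linear n i M (coeff X) (λ _ → + 0) (λ c → constant (δ i c)) (λ c → constant (+ 0))
          (λ c → euler (M i c)) (x·δ i) (suc d))
        (trans (cong₂ _+_ (x⊛ (q 0 i) d) (⊛-zeroˡ (det n (M [ i ≔ (λ c → constant (+ 0)) ])) (suc d)))
               (ℤ.+-identityʳ _))

  Q-top : ∀ {n} (A : IntMatrix (suc n)) k → Newton.Q A k (suc n) ≡ + 0
  Q-top {n} A k = degree-sumS n (q k) (λ i → degree-det-constant-row n
      (M [ i ≔ (λ c → constant (pow A k i c)) ]) i (linear i)
      (λ c d 0<d → trans (cong (λ v → v c d) (updateAt-updates i M)) (constant-degree d 0<d)))
      (suc n) (ℕ.n<1+n n)
    where
    open Newton A
    constant-degree : ∀ {a} → Degree≤ 0 (constant a)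
    constant-degree (suc d) _ = refl
    linear : ∀ i r c → Degree≤ 1 ((M [ i ≔ (λ c → constant (pow A k i c)) ]) r c)
    linear i r c with r ≟ i
    ... | yes refl = λ d 1<d → trans (cong (λ v → v c d) (updateAt-updates i M))
                                     (constant-degree d (ℕ.<-trans (s≤s z≤n) 1<d))
    ... | no r≢i   = λ d 1<d → trans (cong (λ v → v c d) (updateAt-minimal r i M r≢i)) (degree-M r c d 1<d)

  -- Compare the coefficients of xⁿ⁺¹ in `Q-step`: p is monic of degree n + 1, and `Q (suc k)` has
  -- degree at most n because each of its determinants has a constant row.
  tr-from-Q : ∀ {n} (A : IntMatrix (suc n)) k → tr A k ≡ Newton.Q A k n
  tr-from-Q {n} A k = begin
    tr A k                                       ≡⟨ sym (ℤ.*-identityʳ _) ⟩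
    tr A k * + 1                                 ≡⟨ cong (tr A k *_) (sym p-monic) ⟩
    tr A k * p (suc n)                           ≡⟨ Q-step k (suc n) ⟩
    (coeff X ⊛ Q k) (suc n) - Q (suc k) (suc n)  ≡⟨ cong₂ _-_ (x⊛ (Q k) n) (Q-top A (suc k)) ⟩
    Q k n - + 0                                  ≡⟨ ℤ.+-identityʳ _ ⟩
    Q k n ∎
    where open Newton A

  -- The polynomial p determines `Q 0` by `euler-p`; `Q k` determines tr Aᵏ and then, by `Q-step`,
  -- also `Q (suc k)`. Carrying the whole polynomial `Q k` through the induction merges Newton's
  -- identities into one recursion: nothing is divided by k, and exponents beyond n are not a
  -- separate case.
  traces-determined : ∀ {n} (A B : IntMatrix n) → Newton.p A ≐ Newton.p B → ∀ k → tr A k ≡ tr B k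
  traces-determined {zero}  A B p≐ k = refl
  traces-determined {suc n} A B p≐ k = trans (tr-from-Q A k) (trans (Q≐ k n) (sym (tr-from-Q B k)))
    where
    module A = Newton A
    module B = Newton B
    Q≐ : ∀ k → A.Q k ≐ B.Q k
    Q≐ zero    d = trans (sym (A.euler-p d)) (trans (cong (+ suc d *_) (p≐ (suc d))) (B.euler-p d))
    Q≐ (suc k) d = begin
      A.Q (suc k) d                           ≡⟨ isolate ((coeff X ⊛ A.Q k) d) (A.Q-step k d) ⟩
      (coeff X ⊛ A.Q k) d - tr A k * A.p d    ≡⟨ cong₂ _-_ (⊛-cong {coeff X} {coeff X} (λ _ → refl) (Q≐ k) d)
                                                   (cong₂ _*_ tr≡ (p≐ d)) ⟩
      (coeff X ⊛ B.Q k) d - tr B k * B.p d    ≡⟨ sym (isolate ((coeff X ⊛ B.Q k) d) (B.Q-step k d)) ⟩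
      B.Q (suc k) d ∎
      where
      tr≡ : tr A k ≡ tr B k
      tr≡ = trans (tr-from-Q A k) (trans (Q≐ k n) (sym (tr-from-Q B k)))
      isolate : ∀ {a y} x → a ≡ x - y → y ≡ x - a
      isolate {y = y} x refl = lemma x y
        where
        lemma : ∀ x y → y ≡ x - (x - y)
        lemma = solve-∀

  charSeries : ∀ {n} (G : Graph n) → coeff (charPoly G) ≐ Newton.p (adjℤ G)
  charSeries {n} G = coeff-det n (Newton.charEntry (adjℤ G))

  -- A characteristic polynomial is monic of degree the number of vertices. At the larger of two
  -- different orders one coefficient would be 1 and the other 0.
  cospectral-order : ∀ {n m} (G : Graph n) (H : Graph m) → Cospectral G H → n ≡ m
  cospectral-order {n} {m} G H co with ℕ.<-cmp n m
  ... | tri≈ _ n≡m _ = n≡m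
  ... | tri< n<m _ _ = contradiction
          (trans (sym (Newton.degree-p (adjℤ G) m n<m)) (trans (sym (charSeries G m)) (trans (co m)
            (trans (charSeries H m) (Newton.p-monic (adjℤ H)))))) λ ()
  ... | tri> _ _ m<n = contradiction
          (trans (sym (Newton.degree-p (adjℤ H) n m<n)) (trans (sym (charSeries H n)) (trans (sym (co n))
            (trans (charSeries G n) (Newton.p-monic (adjℤ G)))))) λ ()

  cospectral-traces : ∀ {n} (G H : Graph n) → Cospectral G H → ∀ k → tr (adjℤ G) k ≡ tr (adjℤ H) k
  cospectral-traces G H co = traces-determined (adjℤ G) (adjℤ H) λ d →
    trans (sym (charSeries G d)) (trans (co d) (charSeries H d))

  -- Walks

  sum₂ : ∀ {m n} → (Fin m → Fin n → ℤ) → ℤ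
  sum₂ f = sum (λ i → sum (f i))

  sum₂-cong : ∀ {m n} {f g : Fin m → Fin n → ℤ} → (∀ i j → f i j ≡ g i j) → sum₂ f ≡ sum₂ g
  sum₂-cong f≡g = sum-cong-≗ λ i → sum-cong-≗ (f≡g i)

  sum₂-distrib-+ : ∀ {m n} (f g : Fin m → Fin n → ℤ) → sum₂ (λ i j → f i j + g i j) ≡ sum₂ f + sum₂ g
  sum₂-distrib-+ f g = trans (sum-cong-≗ λ i → ∑-distrib-+ (f i) (g i)) (∑-distrib-+ (sum ∘ f) (sum ∘ g))

  *-distribˡ-sum₂ : ∀ {m n} a (f : Fin m → Fin n → ℤ) → a * sum₂ f ≡ sum₂ (λ i j → a * f i j)
  *-distribˡ-sum₂ a f = trans (*-distribˡ-sum a (sum ∘ f)) (sum-cong-≗ λ i → *-distribˡ-sum a (f i))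

  sum-nonneg : ∀ {n} {f : Fin n → ℤ} → (∀ i → + 0 ℤ.≤ f i) → + 0 ℤ.≤ sum f
  sum-nonneg {zero}  f≥0 = ℤ.≤-refl
  sum-nonneg {suc n} f≥0 = ℤ.+-mono-≤ (f≥0 zero) (sum-nonneg (f≥0 ∘ suc))

  sum-mono : ∀ {n} {f g : Fin n → ℤ} → (∀ i → f i ℤ.≤ g i) → sum f ℤ.≤ sum g
  sum-mono {zero}  f≤g = ℤ.≤-refl
  sum-mono {suc n} f≤g = ℤ.+-mono-≤ (f≤g zero) (sum-mono (f≤g ∘ suc))

  term≤sum : ∀ {n} {f : Fin n → ℤ} → (∀ i → + 0 ℤ.≤ f i) → ∀ i → f i ℤ.≤ sum f
  term≤sum {f = f} f≥0 zero = subst (ℤ._≤ sum f) (ℤ.+-identityʳ (f zero))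
    (ℤ.+-monoʳ-≤ (f zero) (sum-nonneg (f≥0 ∘ suc)))
  term≤sum {f = f} f≥0 (suc i) = subst (ℤ._≤ sum f) (ℤ.+-identityˡ (f (suc i)))
    (ℤ.+-mono-≤ (f≥0 zero) (term≤sum (f≥0 ∘ suc) i))

  sum≡0⇒term≡0 : ∀ {n} {f : Fin n → ℤ} → (∀ i → + 0 ℤ.≤ f i) → sum f ≡ + 0 → ∀ i → f i ≡ + 0
  sum≡0⇒term≡0 {f = f} f≥0 sum≡0 i = ℤ.≤-antisym (subst (f i ℤ.≤_) sum≡0 (term≤sum f≥0 i)) (f≥0 i)

  sum₂≡0⇒term≡0 : ∀ {m n} {f : Fin m → Fin n → ℤ} → (∀ i j → + 0 ℤ.≤ f i j) → sum₂ f ≡ + 0 → ∀ i j → f i j ≡ + 0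
  sum₂≡0⇒term≡0 f≥0 sum≡0 i = sum≡0⇒term≡0 (f≥0 i) (sum≡0⇒term≡0 (sum-nonneg ∘ f≥0) sum≡0 i)

  pow-1 : ∀ {n} (A : IntMatrix n) i j → pow A 1 i j ≡ A i j
  pow-1 A i j = trans (sum-cong-≗ λ s → ℤ.*-comm (δ i s) (A s j))
    (trans (sum-cong-≗ λ s → cong (A s j *_) (δ-sym i s)) (sum-δʳ (λ s → A s j) i))
    where
    δ-sym : ∀ {n} (i j : Fin n) → δ i j ≡ δ j i
    δ-sym i j with i ≟ j
    ... | yes refl = sym (δ-refl i)
    ... | no i≢j = sym (δ-≢ (i≢j ∘ sym))

  pow-+ : ∀ {n} (A : IntMatrix n) a b i j → pow A (b ℕ.+ a) i j ≡ sum (λ s → pow A a i s * pow A b s j)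
  pow-+ A a zero    i j = sym (sum-δʳ (pow A a i) j)
  pow-+ A a (suc b) i j = begin
    sum (λ t → pow A (b ℕ.+ a) i t * A t j)
      ≡⟨ sum-cong-≗ (λ t → trans (cong (_* A t j) (pow-+ A a b i t)) (*-distribʳ-sum (A t j) (λ s → pow A a i s * pow A b s t))) ⟩
    sum (λ t → sum (λ s → pow A a i s * pow A b s t * A t j))
      ≡⟨ ∑-comm (λ t s → pow A a i s * pow A b s t * A t j) ⟩
    sum (λ s → sum (λ t → pow A a i s * pow A b s t * A t j))
      ≡⟨ sum-cong-≗ (λ s → trans (sum-cong-≗ λ t → ℤ.*-assoc (pow A a i s) (pow A b s t) (A t j))
           (sym (*-distribˡ-sum (pow A a i s) (λ t → pow A b s t * A t j)))) ⟩
    sum (λ s → pow A a i s * pow A (suc b) s j) ∎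

  pow-sym : ∀ {n} (A : IntMatrix n) → (∀ i j → A i j ≡ A j i) → ∀ k i j → pow A k i j ≡ pow A k j i
  pow-sym A A-sym zero i j with i ≟ j
  ... | yes refl = sym (δ-refl i)
  ... | no i≢j = sym (δ-≢ (i≢j ∘ sym))
  pow-sym A A-sym (suc k) i j = begin
    sum (λ s → pow A k i s * A s j)
      ≡⟨ sum-cong-≗ (λ s → trans (ℤ.*-comm (pow A k i s) (A s j))
           (cong₂ _*_ (trans (A-sym s j) (sym (pow-1 A j s))) (pow-sym A A-sym k i s))) ⟩
    sum (λ s → pow A 1 j s * pow A k s i)
      ≡⟨ sym (pow-+ A 1 k j i) ⟩
    pow A (k ℕ.+ 1) j i
      ≡⟨ cong (λ m → pow A m j i) (ℕ.+-comm k 1) ⟩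
    pow A (suc k) j i ∎

  -- Transposing the second factor turns the entrywise inner product into the trace of AᵃAᵇ.
  frobenius : ∀ {n} (A : IntMatrix n) → (∀ i j → A i j ≡ A j i) → ∀ a b →
    sum₂ (λ i j → pow A a i j * pow A b i j) ≡ tr A (b ℕ.+ a)
  frobenius A A-sym a b = sum-cong-≗ λ i → trans
    (sum-cong-≗ λ j → cong (pow A a i j *_) (pow-sym A A-sym b i j)) (sym (pow-+ A a b i i))

  quintic : ∀ {n} → ℤ → ℤ → IntMatrix n → IntMatrix n
  quintic e P A i j = pow A 5 i j + - e * pow A 3 i j + P * pow A 1 i j

  -- For t k = tr Aᵏ, `row a` is the inner product of Aᵃ with A⁵ - eA³ + PA, and the three rows add
  -- up to the squared norm of that matrix. As a function of the trace sequence alone it visibly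
  -- agrees on cospectral graphs.
  quinticNorm : ℤ → ℤ → (ℕ → ℤ) → ℤ
  quinticNorm e P t = row 5 + - e * row 3 + P * row 1
    where
    row : ℕ → ℤ
    row a = t (5 ℕ.+ a) + - e * t (3 ℕ.+ a) + P * t (1 ℕ.+ a)

  quintic-norm : ∀ {n} e P (A : IntMatrix n) → (∀ i j → A i j ≡ A j i) →
    sum₂ (λ i j → quintic e P A i j * quintic e P A i j) ≡ quinticNorm e P (tr A)
  quintic-norm e P A A-sym = begin
    sum₂ (λ i j → F i j * F i j)
      ≡⟨ sum₂-cong (λ i j → distrib (F i j) (pow A 5 i j) (pow A 3 i j) (pow A 1 i j) e P) ⟩
    sum₂ (λ i j → pow A 5 i j * F i j + - e * (pow A 3 i j * F i j) + P * (pow A 1 i j * F i j))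
      ≡⟨ linear (λ i j → pow A 5 i j * F i j) (λ i j → pow A 3 i j * F i j) (λ i j → pow A 1 i j * F i j) ⟩
    sum₂ (λ i j → pow A 5 i j * F i j) + - e * sum₂ (λ i j → pow A 3 i j * F i j) + P * sum₂ (λ i j → pow A 1 i j * F i j)
      ≡⟨ cong₂ _+_ (cong₂ _+_ (row 5) (cong (- e *_) (row 3))) (cong (P *_) (row 1)) ⟩
    quinticNorm e P (tr A) ∎
    where
    F = quintic e P A
    distrib : ∀ f a b c e P → f * (a + - e * b + P * c) ≡ a * f + - e * (b * f) + P * (c * f)
    distrib = solve-∀
    distrib′ : ∀ f a b c e P → f * (a + - e * b + P * c) ≡ f * a + - e * (f * b) + P * (f * c)
    distrib′ = solve-∀
    linear : ∀ f g h → sum₂ (λ i j → f i j + - e * g i j + P * h i j) ≡ sum₂ f + - e * sum₂ g + P * sum₂ h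
    linear f g h = begin
      sum₂ (λ i j → f i j + - e * g i j + P * h i j)
        ≡⟨ sum₂-distrib-+ (λ i j → f i j + - e * g i j) (λ i j → P * h i j) ⟩
      sum₂ (λ i j → f i j + - e * g i j) + sum₂ (λ i j → P * h i j)
        ≡⟨ cong₂ _+_ (sum₂-distrib-+ f (λ i j → - e * g i j)) (sym (*-distribˡ-sum₂ P h)) ⟩
      sum₂ f + sum₂ (λ i j → - e * g i j) + P * sum₂ h
        ≡⟨ cong (λ x → sum₂ f + x + P * sum₂ h) (sym (*-distribˡ-sum₂ (- e) g)) ⟩
      sum₂ f + - e * sum₂ g + P * sum₂ h ∎
    row : ∀ a → sum₂ (λ i j → pow A a i j * F i j) ≡ tr A (5 ℕ.+ a) + - e * tr A (3 ℕ.+ a) + P * tr A (1 ℕ.+ a)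
    row a = begin
      sum₂ (λ i j → pow A a i j * F i j)
        ≡⟨ sum₂-cong (λ i j → distrib′ (pow A a i j) (pow A 5 i j) (pow A 3 i j) (pow A 1 i j) e P) ⟩
      sum₂ (λ i j → pow A a i j * pow A 5 i j + - e * (pow A a i j * pow A 3 i j) + P * (pow A a i j * pow A 1 i j))
        ≡⟨ linear (λ i j → pow A a i j * pow A 5 i j) (λ i j → pow A a i j * pow A 3 i j) (λ i j → pow A a i j * pow A 1 i j) ⟩
      _ ≡⟨ cong₂ _+_ (cong₂ _+_ (frobenius A A-sym a 5) (cong (- e *_) (frobenius A A-sym a 3))) (cong (P *_) (frobenius A A-sym a 1)) ⟩
      tr A (5 ℕ.+ a) + - e * tr A (3 ℕ.+ a) + P * tr A (1 ℕ.+ a) ∎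

  0≤square : ∀ x → + 0 ℤ.≤ x * x
  0≤square (+ zero)     = ℤ.≤-refl
  0≤square (+ suc n)    = +≤+ z≤n
  0≤square (-[1+ n ])   = +≤+ z≤n

  square≡0 : ∀ x → x * x ≡ + 0 → x ≡ + 0
  square≡0 (+ zero) _ = refl

  quintic-transfer : ∀ {n} e P (A B : IntMatrix n) →
    (∀ i j → A i j ≡ A j i) → (∀ i j → B i j ≡ B j i) → (∀ k → tr A k ≡ tr B k) →
    (∀ i j → quintic e P A i j ≡ + 0) → ∀ i j → quintic e P B i j ≡ + 0
  quintic-transfer {n} e P A B A-sym B-sym tr≡ A-zero i j = square≡0 _
    (sum₂≡0⇒term≡0 (λ i j → 0≤square (quintic e P B i j)) norm-zero i j)
    where
    norm-zero : sum₂ (λ i j → quintic e P B i j * quintic e P B i j) ≡ + 0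
    norm-zero = begin
      sum₂ (λ i j → quintic e P B i j * quintic e P B i j)
        ≡⟨ quintic-norm e P B B-sym ⟩
      quinticNorm e P (tr B)
        ≡⟨ norm-cong (λ k → sym (tr≡ k)) ⟩
      quinticNorm e P (tr A)
        ≡⟨ sym (quintic-norm e P A A-sym) ⟩
      sum₂ (λ i j → quintic e P A i j * quintic e P A i j)
        ≡⟨ sum₂-cong (λ i j → cong (λ x → x * x) (A-zero i j)) ⟩
      sum₂ {n} {n} (λ i j → + 0)
        ≡⟨ trans (sum-cong-≗ {n} (λ i → sum-replicate-zero n)) (sum-replicate-zero n) ⟩
      + 0 ∎
      where
      norm-cong : ∀ {s t : ℕ → ℤ} → (∀ k → s k ≡ t k) → quinticNorm e P s ≡ quinticNorm e P t
      norm-cong {s} {t} eq = cong₂ _+_ (cong₂ _+_ (row 5) (cong (- e *_) (row 3))) (cong (P *_) (row 1))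
        where
        row : ∀ a → s (5 ℕ.+ a) + - e * s (3 ℕ.+ a) + P * s (1 ℕ.+ a) ≡ t (5 ℕ.+ a) + - e * t (3 ℕ.+ a) + P * t (1 ℕ.+ a)
        row a = cong₂ _+_ (cong₂ _+_ (eq (5 ℕ.+ a)) (cong (- e *_) (eq (3 ℕ.+ a)))) (cong (P *_) (eq (1 ℕ.+ a)))

  -- Labelled graphs

  -- `R₁` and `R₂` are classes of one side, `C₁` and `C₂` of the other, and `Z` collects isolated
  -- vertices. Across the sides only `R₂` and `C₂` are not joined, so each side has at most two
  -- nonempty neighbourhoods, one inside the other. In K⁻ the classes `R₂` and `C₂` are the ends of
  -- the deleted edge.
  data Label : Set where
    R₁ R₂ C₁ C₂ Z : Label

  link : Label → Label → Bool
  link R₁ C₁ = true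
  link R₁ C₂ = true
  link R₂ C₁ = true
  link C₁ R₁ = true
  link C₁ R₂ = true
  link C₂ R₁ = true
  link _  _  = false

  _==_ : Label → Label → Bool
  R₁ == R₁ = true
  R₂ == R₂ = true
  C₁ == C₁ = true
  C₂ == C₂ = true
  Z  == Z  = true
  _  == _  = false

  count : ∀ {n} → (Fin n → Label) → Label → ℕ
  count {zero}  ℓ x = 0
  count {suc n} ℓ x = (if ℓ zero == x then 1 else 0) ℕ.+ count (ℓ ∘ suc) x

  ι : Bool → ℤ
  ι b = if b then + 1 else + 0

  total : (Label → ℤ) → ℤ
  total f = f R₁ + f R₂ + f C₁ + f C₂ + f Z

  sum-by-label : ∀ {n} (ℓ : Fin n → Label) (f : Label → ℤ) →
    sum (λ i → f (ℓ i)) ≡ total (λ x → + count ℓ x * f x)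
  sum-by-label {zero}  ℓ f = refl
  sum-by-label {suc n} ℓ f = trans (cong (_+_ (f (ℓ zero))) (sum-by-label (ℓ ∘ suc) f))
    (step (ℓ zero) (count (ℓ ∘ suc)))
    where
    bump : Label → (Label → ℕ) → Label → ℕ
    bump y k x = (if y == x then 1 else 0) ℕ.+ k x
    step : ∀ y k → f y + total (λ x → + k x * f x) ≡ total (λ x → + bump y k x * f x)
    step R₁ k = lemma (f R₁) (+ k R₁) (+ k R₂ * f R₂) (+ k C₁ * f C₁) (+ k C₂ * f C₂) (+ k Z * f Z)
      where
      lemma : ∀ a r s t u v → a + (r * a + s + t + u + v) ≡ (+ 1 + r) * a + s + t + u + v
      lemma = solve-∀
    step R₂ k = lemma (f R₂) (+ k R₁ * f R₁) (+ k R₂) (+ k C₁ * f C₁) (+ k C₂ * f C₂) (+ k Z * f Z)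
      where
      lemma : ∀ a r s t u v → a + (r + s * a + t + u + v) ≡ r + (+ 1 + s) * a + t + u + v
      lemma = solve-∀
    step C₁ k = lemma (f C₁) (+ k R₁ * f R₁) (+ k R₂ * f R₂) (+ k C₁) (+ k C₂ * f C₂) (+ k Z * f Z)
      where
      lemma : ∀ a r s t u v → a + (r + s + t * a + u + v) ≡ r + s + (+ 1 + t) * a + u + v
      lemma = solve-∀
    step C₂ k = lemma (f C₂) (+ k R₁ * f R₁) (+ k R₂ * f R₂) (+ k C₁ * f C₁) (+ k C₂) (+ k Z * f Z)
      where
      lemma : ∀ a r s t u v → a + (r + s + t + u * a + v) ≡ r + s + t + (+ 1 + u) * a + v
      lemma = solve-∀
    step Z k = lemma (f Z) (+ k R₁ * f R₁) (+ k R₂ * f R₂) (+ k C₁ * f C₁) (+ k C₂ * f C₂) (+ k Z)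
      where
      lemma : ∀ a r s t u v → a + (r + s + t + u + v * a) ≡ r + s + t + u + (+ 1 + v) * a
      lemma = solve-∀

  open +-*-Solver using (Polynomial; con; var; _:+_; _:*_; _:-_; :-_; ⟦_⟧; prove)

  private
    :r₁ :r₂ :c₁ :c₂ :e :P : Polynomial 4
    :r₁ = var zero
    :r₂ = var (suc zero)
    :c₁ = var (suc (suc zero))
    :c₂ = var (suc (suc (suc zero)))
    :e = :r₁ :* :c₁ :+ :r₁ :* :c₂ :+ :r₂ :* :c₁
    :P = :r₁ :* :c₁ :* (:r₂ :* :c₂)

    -- Numbers of walks between two labels as polynomials in r₁, r₂, c₁, c₂, kept as solver syntax
    -- so that the identities below are checked by normalisation. Index k stands for length k + 1:
    -- the walks of length 0 depend on the vertices and not only on their labels. The size of `Z`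
    -- does not occur, since no walk of positive length visits an isolated vertex.
    :walks : ℕ → Label → Label → Polynomial 4
    :step : (Label → Polynomial 4) → Label → Polynomial 4
    :walks zero    x y = con (ι (link x y))
    :walks (suc k) x y = :step (:walks k x) y
    :step w R₁ = :c₁ :* w C₁ :+ :c₂ :* w C₂
    :step w R₂ = :c₁ :* w C₁
    :step w C₁ = :r₁ :* w R₁ :+ :r₂ :* w R₂
    :step w C₂ = :r₁ :* w R₁
    :step w Z  = con (+ 0)

    :trace : ℕ → Polynomial 4
    :trace k = :r₁ :* :walks k R₁ R₁ :+ :r₂ :* :walks k R₂ R₂ :+ :c₁ :* :walks k C₁ C₁ :+ :c₂ :* :walks k C₂ C₂

    :quintic : Label → Label → Polynomial 4
    :quintic x y = :walks 4 x y :+ :- :e :* :walks 2 x y :+ :P :* :walks 0 x y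

  record Labelling {n} (G : Graph n) : Set where
    field
      label    : Fin n → Label
      adj-link : ∀ i j → adj G i j ≡ link (label i) (label j)

    r₁ r₂ c₁ c₂ z : ℕ
    r₁ = count label R₁
    r₂ = count label R₂
    c₁ = count label C₁
    c₂ = count label C₂
    z  = count label Z

    edges product : ℤ
    edges   = + r₁ * + c₁ + + r₁ * + c₂ + + r₂ * + c₁
    product = + r₁ * + c₁ * (+ r₂ * + c₂)

    private
      ρ : Vec ℤ 4
      ρ = + r₁ ∷ + r₂ ∷ + c₁ ∷ + c₂ ∷ []

      walks : ℕ → Label → Label → ℤ
      walks k x y = ⟦ :walks k x y ⟧ ρ

      total-step : ∀ k x y → total (λ s → + count label s * (walks k x s * ι (link s y))) ≡ walks (suc k) x y
      total-step k x R₁ = lemma (+ r₁) (+ r₂) (+ c₁) (+ c₂) (+ z) (walks k x R₁) (walks k x R₂) (walks k x C₁) (walks k x C₂) (walks k x Z)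
        where
        lemma : ∀ r s t u v a b c d e → r * (a * + 0) + s * (b * + 0) + t * (c * + 1) + u * (d * + 1) + v * (e * + 0) ≡ t * c + u * d
        lemma = solve-∀
      total-step k x R₂ = lemma (+ r₁) (+ r₂) (+ c₁) (+ c₂) (+ z) (walks k x R₁) (walks k x R₂) (walks k x C₁) (walks k x C₂) (walks k x Z)
        where
        lemma : ∀ r s t u v a b c d e → r * (a * + 0) + s * (b * + 0) + t * (c * + 1) + u * (d * + 0) + v * (e * + 0) ≡ t * c
        lemma = solve-∀
      total-step k x C₁ = lemma (+ r₁) (+ r₂) (+ c₁) (+ c₂) (+ z) (walks k x R₁) (walks k x R₂) (walks k x C₁) (walks k x C₂) (walks k x Z)
        where
        lemma : ∀ r s t u v a b c d e → r * (a * + 1) + s * (b * + 1) + t * (c * + 0) + u * (d * + 0) + v * (e * + 0) ≡ r * a + s * b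
        lemma = solve-∀
      total-step k x C₂ = lemma (+ r₁) (+ r₂) (+ c₁) (+ c₂) (+ z) (walks k x R₁) (walks k x R₂) (walks k x C₁) (walks k x C₂) (walks k x Z)
        where
        lemma : ∀ r s t u v a b c d e → r * (a * + 1) + s * (b * + 0) + t * (c * + 0) + u * (d * + 0) + v * (e * + 0) ≡ r * a
        lemma = solve-∀
      total-step k x Z = lemma (+ r₁) (+ r₂) (+ c₁) (+ c₂) (+ z) (walks k x R₁) (walks k x R₂) (walks k x C₁) (walks k x C₂) (walks k x Z)
        where
        lemma : ∀ r s t u v a b c d e → r * (a * + 0) + s * (b * + 0) + t * (c * + 0) + u * (d * + 0) + v * (e * + 0) ≡ + 0
        lemma = solve-∀

      pow-walks : ∀ k i j → pow (adjℤ G) (suc k) i j ≡ walks k (label i) (label j)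
      pow-walks zero    i j = trans (pow-1 (adjℤ G) i j) (cong ι (adj-link i j))
      pow-walks (suc k) i j = begin
        sum (λ s → pow (adjℤ G) (suc k) i s * adjℤ G s j)
          ≡⟨ sum-cong-≗ (λ s → cong₂ _*_ (pow-walks k i s) (cong ι (adj-link s j))) ⟩
        sum (λ s → walks k (label i) (label s) * ι (link (label s) (label j)))
          ≡⟨ sum-by-label label (λ s → walks k (label i) s * ι (link s (label j))) ⟩
        total (λ s → + count label s * (walks k (label i) s * ι (link s (label j))))
          ≡⟨ total-step k (label i) (label j) ⟩
        walks (suc k) (label i) (label j) ∎

      walks-Z : ∀ k → walks k Z Z ≡ + 0
      walks-Z zero    = refl
      walks-Z (suc k) = refl

      tr-walks : ∀ k → tr (adjℤ G) (suc k) ≡ ⟦ :trace k ⟧ ρ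
      tr-walks k = begin
        sum (λ i → pow (adjℤ G) (suc k) i i)
          ≡⟨ sum-cong-≗ (λ i → pow-walks k i i) ⟩
        sum (λ i → walks k (label i) (label i))
          ≡⟨ sum-by-label label (λ x → walks k x x) ⟩
        total (λ x → + count label x * walks k x x)
          ≡⟨ trans (cong (λ w → ⟦ :trace k ⟧ ρ + + z * w) (walks-Z k)) (trans (cong (_+_ (⟦ :trace k ⟧ ρ)) (ℤ.*-zeroʳ (+ z))) (ℤ.+-identityʳ _)) ⟩
        ⟦ :trace k ⟧ ρ ∎

    tr-2 : tr (adjℤ G) 2 ≡ + 2 * edges
    tr-2 = trans (tr-walks 1) (prove ρ (:trace 1) (con (+ 2) :* :e) refl)

    tr-3 : tr (adjℤ G) 3 ≡ + 0
    tr-3 = trans (tr-walks 2) (prove ρ (:trace 2) (con (+ 0)) refl)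

    tr-4 : tr (adjℤ G) 4 ≡ + 2 * edges * edges - + 4 * product
    tr-4 = trans (tr-walks 3) (prove ρ (:trace 3) (con (+ 2) :* :e :* :e :- con (+ 4) :* :P) refl)

    -- The entries of positive powers depend only on two labels, so the matrix equation is a finite
    -- list of polynomial identities. They hold for all class sizes, not just those of K⁻.
    quintic-zero : ∀ i j → quintic edges product (adjℤ G) i j ≡ + 0
    quintic-zero i j = trans
      (cong₂ _+_ (cong₂ _+_ (pow-walks 4 i j) (cong (- edges *_) (pow-walks 2 i j))) (cong (product *_) (pow-walks 0 i j)))
      (vanish (label i) (label j))
      where
      vanish : ∀ x y → ⟦ :quintic x y ⟧ ρ ≡ + 0
      vanish R₁ R₁ = prove ρ (:quintic R₁ R₁) (con (+ 0)) refl
      vanish R₁ R₂ = prove ρ (:quintic R₁ R₂) (con (+ 0)) refl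
      vanish R₁ C₁ = prove ρ (:quintic R₁ C₁) (con (+ 0)) refl
      vanish R₁ C₂ = prove ρ (:quintic R₁ C₂) (con (+ 0)) refl
      vanish R₁ Z  = prove ρ (:quintic R₁ Z)  (con (+ 0)) refl
      vanish R₂ R₁ = prove ρ (:quintic R₂ R₁) (con (+ 0)) refl
      vanish R₂ R₂ = prove ρ (:quintic R₂ R₂) (con (+ 0)) refl
      vanish R₂ C₁ = prove ρ (:quintic R₂ C₁) (con (+ 0)) refl
      vanish R₂ C₂ = prove ρ (:quintic R₂ C₂) (con (+ 0)) refl
      vanish R₂ Z  = prove ρ (:quintic R₂ Z)  (con (+ 0)) refl
      vanish C₁ R₁ = prove ρ (:quintic C₁ R₁) (con (+ 0)) refl
      vanish C₁ R₂ = prove ρ (:quintic C₁ R₂) (con (+ 0)) refl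
      vanish C₁ C₁ = prove ρ (:quintic C₁ C₁) (con (+ 0)) refl
      vanish C₁ C₂ = prove ρ (:quintic C₁ C₂) (con (+ 0)) refl
      vanish C₁ Z  = prove ρ (:quintic C₁ Z)  (con (+ 0)) refl
      vanish C₂ R₁ = prove ρ (:quintic C₂ R₁) (con (+ 0)) refl
      vanish C₂ R₂ = prove ρ (:quintic C₂ R₂) (con (+ 0)) refl
      vanish C₂ C₁ = prove ρ (:quintic C₂ C₁) (con (+ 0)) refl
      vanish C₂ C₂ = prove ρ (:quintic C₂ C₂) (con (+ 0)) refl
      vanish C₂ Z  = prove ρ (:quintic C₂ Z)  (con (+ 0)) refl
      vanish Z  R₁ = prove ρ (:quintic Z  R₁) (con (+ 0)) refl
      vanish Z  R₂ = prove ρ (:quintic Z  R₂) (con (+ 0)) refl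
      vanish Z  C₁ = prove ρ (:quintic Z  C₁) (con (+ 0)) refl
      vanish Z  C₂ = prove ρ (:quintic Z  C₂) (con (+ 0)) refl
      vanish Z  Z  = prove ρ (:quintic Z  Z)  (con (+ 0)) refl

open Spectra

-- Induced 2K₂

0≤ι : ∀ b → + 0 ℤ.≤ ι b
0≤ι true  = +≤+ z≤n
0≤ι false = +≤+ z≤n

sum₄ : ∀ {n} → (Fin n → Fin n → Fin n → Fin n → ℤ) → ℤ
sum₄ f = sum₂ (λ a b → sum₂ (f a b))

sum₄-cong : ∀ {n} {f g : Fin n → Fin n → Fin n → Fin n → ℤ} → (∀ a b c d → f a b c d ≡ g a b c d) → sum₄ f ≡ sum₄ g
sum₄-cong eq = sum₂-cong λ a b → sum₂-cong (eq a b)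

sum₄-distrib-+ : ∀ {n} (f g : Fin n → Fin n → Fin n → Fin n → ℤ) →
  sum₄ (λ a b c d → f a b c d + g a b c d) ≡ sum₄ f + sum₄ g
sum₄-distrib-+ f g = trans (sum₂-cong λ a b → sum₂-distrib-+ (f a b) (g a b))
  (sum₂-distrib-+ (λ a b → sum₂ (f a b)) (λ a b → sum₂ (g a b)))

sum₂-*-sum₂ : ∀ {n} (f g : Fin n → Fin n → ℤ) → sum₂ f * sum₂ g ≡ sum₄ (λ a b c d → f a b * g c d)
sum₂-*-sum₂ f g = trans (ℤ.*-comm (sum₂ f) (sum₂ g)) (trans (*-distribˡ-sum₂ (sum₂ g) f)
  (sum₂-cong λ a b → trans (ℤ.*-comm (sum₂ g) (f a b)) (*-distribˡ-sum₂ (f a b) g)))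

sum₂-comm : ∀ {n} (f : Fin n → Fin n → Fin n → Fin n → ℤ) →
  sum₄ f ≡ sum₄ (λ c d a b → f a b c d)
sum₂-comm f = begin
  sum (λ a → sum (λ b → sum (λ c → sum (λ d → f a b c d))))
    ≡⟨ sum-cong-≗ (λ a → ∑-comm (λ b c → sum (λ d → f a b c d))) ⟩
  sum (λ a → sum (λ c → sum (λ b → sum (λ d → f a b c d))))
    ≡⟨ ∑-comm (λ a c → sum (λ b → sum (λ d → f a b c d))) ⟩
  sum (λ c → sum (λ a → sum (λ b → sum (λ d → f a b c d))))
    ≡⟨ sum-cong-≗ (λ c → trans (sum-cong-≗ λ a → ∑-comm (λ b d → f a b c d)) (∑-comm (λ a d → sum (λ b → f a b c d)))) ⟩
  sum (λ c → sum (λ d → sum (λ a → sum (λ b → f a b c d)))) ∎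
  where open ≡-Reasoning

module Counting {n} (H : Graph n)
  (triangle-free : ∀ {i j k} → adj H i j ≡ true → adj H j k ≡ true → adj H i k ≡ true → ⊥) where

  A : IntMatrix n
  A = adjℤ H

  adj-sym : ∀ {i j} → adj H i j ≡ true → adj H j i ≡ true
  adj-sym {i} {j} eq = trans (Graph.sym H j i) eq

  A-sym : ∀ i j → A i j ≡ A j i
  A-sym i j = cong ι (Graph.sym H i j)

  -- ab and cd are disjoint edges not contained in a common 4-cycle
  apart : Fin n → Fin n → Fin n → Fin n → Bool
  apart a b c d = adj H a b ∧ adj H c d ∧ not (adj H b c ∧ adj H a d) ∧ not (adj H a c ∧ adj H b d)

  β : Fin n → Fin n → Fin n → Fin n → ℤ
  β a b c d = ι (apart a b c d)

  walk₁ walk₂ : Fin n → Fin n → Fin n → Fin n → ℤ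
  walk₁ a b c d = A a b * A b c * A c d * A d a
  walk₂ a b c d = A a b * A b d * A d c * A c a

  -- Two edges fail to be apart exactly when one of the closed walks a b c d and a b d c exists.
  -- Both cannot exist, since b ~ c and a ~ c would close a triangle on ab. Edges that share a
  -- vertex close a degenerate walk, so `apart` implies disjointness.
  β-expand : ∀ a b c d → A a b * A c d ≡ β a b c d + walk₁ a b c d + walk₂ a b c d
  β-expand a b c d rewrite Graph.sym H d c | Graph.sym H c a | Graph.sym H d a =
    go (adj H a b) (adj H c d) (adj H b c) (adj H a d) (adj H a c) (adj H b d) triangle-free
    where
    go : ∀ ab cd bc ad ac bd → (ab ≡ true → bc ≡ true → ac ≡ true → ⊥) →
      ι ab * ι cd ≡ ι (ab ∧ cd ∧ not (bc ∧ ad) ∧ not (ac ∧ bd))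
        + ι ab * ι bc * ι cd * ι ad + ι ab * ι bd * ι cd * ι ac
    go false cd bc ad ac bd _ = refl
    go true false true ad ac true _ = refl
    go true false true ad ac false _ = refl
    go true false false ad ac true _ = refl
    go true false false ad ac false _ = refl
    go true true true ad true bd ¬t = ⊥-elim (¬t refl refl refl)
    go true true true true false true _ = refl
    go true true true true false false _ = refl
    go true true true false false true _ = refl
    go true true true false false false _ = refl
    go true true false ad true true _ = refl
    go true true false ad true false _ = refl
    go true true false ad false true _ = refl
    go true true false ad false false _ = refl

  sum-walk₁ : sum₄ walk₁ ≡ tr A 4
  sum-walk₁ = begin
    sum (λ a → sum (λ b → sum (λ c → sum (λ d → walk₁ a b c d))))
      ≡⟨ sum-cong-≗ (λ a → trans (sum-cong-≗ λ b → ∑-comm (λ c d → walk₁ a b c d)) (∑-comm (λ b d → sum (λ c → walk₁ a b c d)))) ⟩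
    sum (λ a → sum (λ d → sum (λ b → sum (λ c → walk₁ a b c d))))
      ≡⟨ sum-cong-≗ (λ a → sum-cong-≗ λ d → ∑-comm (λ b c → walk₁ a b c d)) ⟩
    sum (λ a → sum (λ d → sum (λ c → sum (λ b → walk₁ a b c d))))
      ≡⟨ sum-cong-≗ (λ a → sum-cong-≗ λ d → inner a d) ⟩
    tr A 4 ∎
    where
    open ≡-Reasoning
    inner : ∀ a d → sum (λ c → sum (λ b → walk₁ a b c d)) ≡ pow A 3 a d * A d a
    inner a d = begin
      sum (λ c → sum (λ b → A a b * A b c * A c d * A d a))
        ≡⟨ sum-cong-≗ (λ c → sym (*-distribʳ-sum (A d a) (λ b → A a b * A b c * A c d))) ⟩
      sum (λ c → sum (λ b → A a b * A b c * A c d) * A d a)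
        ≡⟨ sym (*-distribʳ-sum (A d a) (λ c → sum (λ b → A a b * A b c * A c d))) ⟩
      sum (λ c → sum (λ b → A a b * A b c * A c d)) * A d a
        ≡⟨ cong (_* A d a) (sum-cong-≗ λ c → trans (sym (*-distribʳ-sum (A c d) (λ b → A a b * A b c)))
             (cong (_* A c d) (sum-cong-≗ λ b → cong (_* A b c) (sym (pow-1 A a b))))) ⟩
      pow A 3 a d * A d a ∎

  sum-walk₂ : sum₄ walk₂ ≡ tr A 4
  sum-walk₂ = trans (sum₂-cong λ a b → ∑-comm (λ c d → walk₂ a b c d)) sum-walk₁

  tr-2-sum : tr A 2 ≡ sum₂ A
  tr-2-sum = sum-cong-≗ λ i → sum-cong-≗ λ s → trans (cong₂ _*_ (pow-1 A i s) (sym (A-sym i s))) (square (adj H i s))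
    where
    square : ∀ b → ι b * ι b ≡ ι b
    square true  = refl
    square false = refl

  -- With tr A² = 2e and tr A⁴ = 2e² - 4P this yields `sum₄ β` = 8P. An unordered pair of disjoint
  -- edges is listed eight times, so P is the number of apart pairs.
  apart-count : tr A 2 * tr A 2 ≡ sum₄ β + tr A 4 + tr A 4
  apart-count = begin
    tr A 2 * tr A 2
      ≡⟨ cong₂ _*_ tr-2-sum tr-2-sum ⟩
    sum₂ A * sum₂ A
      ≡⟨ sum₂-*-sum₂ A A ⟩
    sum₄ (λ a b c d → A a b * A c d)
      ≡⟨ sum₄-cong β-expand ⟩
    sum₄ (λ a b c d → β a b c d + walk₁ a b c d + walk₂ a b c d)
      ≡⟨ sum₄-distrib-+ (λ a b c d → β a b c d + walk₁ a b c d) walk₂ ⟩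
    sum₄ (λ a b c d → β a b c d + walk₁ a b c d) + sum₄ walk₂
      ≡⟨ cong₂ _+_ (trans (sum₄-distrib-+ β walk₁) (cong (_+_ (sum₄ β)) sum-walk₁)) sum-walk₂ ⟩
    sum₄ β + tr A 4 + tr A 4 ∎
    where open ≡-Reasoning

  true≢false : true ≢ false
  true≢false ()

  adj⇒≢ : ∀ {i j} → adj H i j ≡ true → i ≢ j
  adj⇒≢ {i} eq refl = true≢false (trans (sym eq) (Graph.irrefl H i))

  separated : ∀ {i j k} → adj H i k ≡ true → adj H j k ≡ false → i ≢ j
  separated p q refl = true≢false (trans (sym p) q)

  apart-swap : ∀ a b c d → apart b a c d ≡ apart a b c d
  apart-swap a b c d rewrite Graph.sym H b a =
    go (adj H a b) (adj H c d) (adj H b c) (adj H a d) (adj H a c) (adj H b d)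
    where
    go : ∀ ab cd bc ad ac bd → ab ∧ cd ∧ not (ac ∧ bd) ∧ not (bc ∧ ad) ≡ ab ∧ cd ∧ not (bc ∧ ad) ∧ not (ac ∧ bd)
    go false cd bc ad ac bd = refl
    go true false bc ad ac bd = refl
    go true true true true true true = refl
    go true true true true true false = refl
    go true true true true false bd = refl
    go true true true false true true = refl
    go true true true false true false = refl
    go true true true false false bd = refl
    go true true false ad true true = refl
    go true true false ad true false = refl
    go true true false ad false bd = refl

  apart-comm : ∀ a b c d → apart c d a b ≡ apart a b c d
  apart-comm a b c d rewrite Graph.sym H d a | Graph.sym H c b | Graph.sym H c a | Graph.sym H d b =
    go (adj H a b) (adj H c d) (adj H b c) (adj H a d) (adj H a c) (adj H b d)
    where
    go : ∀ ab cd bc ad ac bd → cd ∧ ab ∧ not (ad ∧ bc) ∧ not (ac ∧ bd) ≡ ab ∧ cd ∧ not (bc ∧ ad) ∧ not (ac ∧ bd)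
    go false false bc ad ac bd = refl
    go false true bc ad ac bd = refl
    go true false bc ad ac bd = refl
    go true true true true ac bd = refl
    go true true true false ac bd = refl
    go true true false true ac bd = refl
    go true true false false ac bd = refl

  apart-intro : ∀ {a b c d} → adj H a b ≡ true → adj H c d ≡ true →
    (adj H b c ≡ true → adj H a d ≡ true → ⊥) → (adj H a c ≡ true → adj H b d ≡ true → ⊥) → apart a b c d ≡ true
  apart-intro {a} {b} {c} {d} ab cd = go (adj H a b) (adj H c d) (adj H b c) (adj H a d) (adj H a c) (adj H b d) ab cd
    where
    go : ∀ ab cd bc ad ac bd → ab ≡ true → cd ≡ true → (bc ≡ true → ad ≡ true → ⊥) → (ac ≡ true → bd ≡ true → ⊥) →
      ab ∧ cd ∧ not (bc ∧ ad) ∧ not (ac ∧ bd) ≡ true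
    go true true true true ac bd _ _ p q = ⊥-elim (p refl refl)
    go true true true false true true _ _ p q = ⊥-elim (q refl refl)
    go true true true false true false _ _ p q = refl
    go true true true false false bd _ _ p q = refl
    go true true false ad true true _ _ p q = ⊥-elim (q refl refl)
    go true true false ad true false _ _ p q = refl
    go true true false ad false bd _ _ p q = refl

  apart-elim : ∀ {a b c d} → adj H a b ≡ true → adj H c d ≡ true → apart a b c d ≡ false →
    (adj H b c ≡ true × adj H a d ≡ true) ⊎ (adj H a c ≡ true × adj H b d ≡ true)
  apart-elim {a} {b} {c} {d} ab cd = go (adj H a b) (adj H c d) (adj H b c) (adj H a d) (adj H a c) (adj H b d) ab cd
    where
    go : ∀ ab cd bc ad ac bd → ab ≡ true → cd ≡ true → ab ∧ cd ∧ not (bc ∧ ad) ∧ not (ac ∧ bd) ≡ false →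
      (bc ≡ true × ad ≡ true) ⊎ (ac ≡ true × bd ≡ true)
    go true true true true ac bd _ _ _ = inj₁ (refl , refl)
    go true true true false true true _ _ _ = inj₂ (refl , refl)
    go true true false ad true true _ _ _ = inj₂ (refl , refl)

  -- The lower bound on apart pairs from an induced 2K₂

  record Induced2K₂ (f₁ f₂ g₁ g₂ : Fin n) : Set where
    field
      f : adj H f₁ f₂ ≡ true
      g : adj H g₁ g₂ ≡ true
      ¬f₁g₁ : adj H f₁ g₁ ≡ false
      ¬f₁g₂ : adj H f₁ g₂ ≡ false
      ¬f₂g₁ : adj H f₂ g₁ ≡ false
      ¬f₂g₂ : adj H f₂ g₂ ≡ false

    f₁≢f₂ : f₁ ≢ f₂
    f₁≢f₂ = adj⇒≢ f
    g₁≢g₂ : g₁ ≢ g₂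
    g₁≢g₂ = adj⇒≢ g
    f₁≢g₁ : f₁ ≢ g₁
    f₁≢g₁ = separated f (trans (Graph.sym H _ _) ¬f₂g₁)
    f₁≢g₂ : f₁ ≢ g₂
    f₁≢g₂ = separated f (trans (Graph.sym H _ _) ¬f₂g₂)
    f₂≢g₁ : f₂ ≢ g₁
    f₂≢g₁ = separated (adj-sym f) (trans (Graph.sym H _ _) ¬f₁g₁)
    f₂≢g₂ : f₂ ≢ g₂
    f₂≢g₂ = separated (adj-sym f) (trans (Graph.sym H _ _) ¬f₁g₂)

  reverse-f : ∀ {f₁ f₂ g₁ g₂} → Induced2K₂ f₁ f₂ g₁ g₂ → Induced2K₂ f₂ f₁ g₁ g₂
  reverse-f K = record { f = adj-sym f ; g = g ; ¬f₁g₁ = ¬f₂g₁ ; ¬f₁g₂ = ¬f₂g₂ ; ¬f₂g₁ = ¬f₁g₁ ; ¬f₂g₂ = ¬f₁g₂ }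
    where open Induced2K₂ K

  exchange : ∀ {f₁ f₂ g₁ g₂} → Induced2K₂ f₁ f₂ g₁ g₂ → Induced2K₂ g₁ g₂ f₁ f₂
  exchange K = record { f = g ; g = f
    ; ¬f₁g₁ = trans (Graph.sym H _ _) ¬f₁g₁ ; ¬f₁g₂ = trans (Graph.sym H _ _) ¬f₂g₁
    ; ¬f₂g₁ = trans (Graph.sym H _ _) ¬f₁g₂ ; ¬f₂g₂ = trans (Graph.sym H _ _) ¬f₂g₂ }
    where open Induced2K₂ K

  -- Indicator of xy being f = f₁f₂ or g = g₁g₂ in either direction; it is arithmetic rather than
  -- Boolean so that `pick` can evaluate weighted sums by linearity. Accordingly `keep` selects the
  -- other pairs, and `γ` the apart edges ab, cd neither of which is f or g.
  φ : Fin n → Fin n → Fin n → Fin n → Fin n → Fin n → ℤ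
  φ f₁ f₂ g₁ g₂ x y = δ x f₁ * δ y f₂ + δ x f₂ * δ y f₁ + δ x g₁ * δ y g₂ + δ x g₂ * δ y g₁

  keep : Fin n → Fin n → Fin n → Fin n → Fin n → Fin n → ℤ
  keep f₁ f₂ g₁ g₂ x y = + 1 - φ f₁ f₂ g₁ g₂ x y

  γ : Fin n → Fin n → Fin n → Fin n → Fin n → Fin n → Fin n → Fin n → ℤ
  γ f₁ f₂ g₁ g₂ a b c d = keep f₁ f₂ g₁ g₂ a b * keep f₁ f₂ g₁ g₂ c d * β a b c d

  -- For an induced 2K₂ these are the edges that lie on a 4-cycle with f and on another with g. The
  -- edges f and g are not among them, being apart from each other.
  uncovered : Fin n → Fin n → Fin n → Fin n → Fin n → Fin n → Bool
  uncovered f₁ f₂ g₁ g₂ u v = adj H u v ∧ not (apart f₁ f₂ u v) ∧ not (apart g₁ g₂ u v)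

  δ≤1 : ∀ (i j : Fin n) → δ i j ℤ.≤ + 1
  δ≤1 i j with i ≟ j
  ... | yes _ = ℤ.≤-refl
  ... | no _  = +≤+ z≤n

  0≤* : ∀ {x y} → + 0 ℤ.≤ x → + 0 ℤ.≤ y → + 0 ℤ.≤ x * y
  0≤* {+ a} {+ b} _ _ = subst (+ 0 ℤ.≤_) (ℤ.pos-* a b) (+≤+ z≤n)

  -- The four vertices are distinct, so at most one δ at x is nonzero. In `0≤keep` the weights are
  -- the δ at y, which makes the sum equal to `φ`; in `rest-bound` all weights are 1.
  distinct⇒Σδ≤1 : ∀ {f₁ f₂ g₁ g₂} → Induced2K₂ f₁ f₂ g₁ g₂ → ∀ x p q r s →
    p ℤ.≤ + 1 → q ℤ.≤ + 1 → r ℤ.≤ + 1 → s ℤ.≤ + 1 →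
    δ x f₁ * p + δ x f₂ * q + δ x g₁ * r + δ x g₂ * s ℤ.≤ + 1
  distinct⇒Σδ≤1 {f₁} {f₂} {g₁} {g₂} K x p q r s p≤ q≤ r≤ s≤ with x ≟ f₁
  ... | yes refl rewrite δ-≢ (Induced2K₂.f₁≢f₂ K) | δ-≢ (Induced2K₂.f₁≢g₁ K) | δ-≢ (Induced2K₂.f₁≢g₂ K) = subst (ℤ._≤ + 1) (lemma p q r s) p≤
    where
    lemma : ∀ p q r s → p ≡ + 1 * p + + 0 * q + + 0 * r + + 0 * s
    lemma = solve-∀
  ... | no _ with x ≟ f₂
  ... | yes refl rewrite δ-≢ (Induced2K₂.f₂≢g₁ K) | δ-≢ (Induced2K₂.f₂≢g₂ K) = subst (ℤ._≤ + 1) (lemma p q r s) q≤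
    where
    lemma : ∀ p q r s → q ≡ + 0 * p + + 1 * q + + 0 * r + + 0 * s
    lemma = solve-∀
  ... | no _ with x ≟ g₁
  ... | yes refl rewrite δ-≢ (Induced2K₂.g₁≢g₂ K) = subst (ℤ._≤ + 1) (lemma p q r s) r≤
    where
    lemma : ∀ p q r s → r ≡ + 0 * p + + 0 * q + + 1 * r + + 0 * s
    lemma = solve-∀
  ... | no _ with x ≟ g₂
  ... | yes refl = subst (ℤ._≤ + 1) (lemma p q r s) s≤
    where
    lemma : ∀ p q r s → s ≡ + 0 * p + + 0 * q + + 0 * r + + 1 * s
    lemma = solve-∀
  ... | no _ = subst (ℤ._≤ + 1) (lemma p q r s) (+≤+ z≤n)
    where
    lemma : ∀ p q r s → + 0 ≡ + 0 * p + + 0 * q + + 0 * r + + 0 * s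
    lemma = solve-∀

  0≤keep : ∀ {f₁ f₂ g₁ g₂} → Induced2K₂ f₁ f₂ g₁ g₂ → ∀ x y → + 0 ℤ.≤ keep f₁ f₂ g₁ g₂ x y
  0≤keep {f₁} {f₂} {g₁} {g₂} K x y = ℤ.i≤j⇒0≤j-i
    (distinct⇒Σδ≤1 K x (δ y f₂) (δ y f₁) (δ y g₂) (δ y g₁) (δ≤1 y f₂) (δ≤1 y f₁) (δ≤1 y g₂) (δ≤1 y g₁))

  0≤γ : ∀ {f₁ f₂ g₁ g₂} → Induced2K₂ f₁ f₂ g₁ g₂ → ∀ a b c d → + 0 ℤ.≤ γ f₁ f₂ g₁ g₂ a b c d
  0≤γ K a b c d = 0≤* (0≤* (0≤keep K a b) (0≤keep K c d)) (0≤ι (apart a b c d))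

  δδ≡0 : ∀ {x y s t : Fin n} → x ≢ s ⊎ y ≢ t → δ x s * δ y t ≡ + 0
  δδ≡0 {y = y} {t = t} (inj₁ x≢s) = cong (_* δ y t) (δ-≢ x≢s)
  δδ≡0 {x = x} {s = s} (inj₂ y≢t) = trans (cong (δ x s *_) (δ-≢ y≢t)) (ℤ.*-zeroʳ (δ x s))

  keep≡1 : ∀ {f₁ f₂ g₁ g₂ x y} → x ≢ f₁ ⊎ y ≢ f₂ → x ≢ f₂ ⊎ y ≢ f₁ → x ≢ g₁ ⊎ y ≢ g₂ → x ≢ g₂ ⊎ y ≢ g₁ →
    keep f₁ f₂ g₁ g₂ x y ≡ + 1
  keep≡1 p q r s = cong (_-_ (+ 1)) (cong₂ _+_ (cong₂ _+_ (cong₂ _+_ (δδ≡0 p) (δδ≡0 q)) (δδ≡0 r)) (δδ≡0 s))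

  sum-δ : ∀ (h : Fin n → ℤ) s → sum (λ x → δ x s * h x) ≡ h s
  sum-δ h s = trans (sum-cong-≗ λ x → ℤ.*-comm (δ x s) (h x)) (sum-δʳ h s)

  sum₂-δδ : ∀ (h : Fin n → Fin n → ℤ) s t → sum₂ (λ x y → δ x s * δ y t * h x y) ≡ h s t
  sum₂-δδ h s t = trans
    (sum-cong-≗ λ x → trans (sum-cong-≗ λ y → ℤ.*-assoc (δ x s) (δ y t) (h x y))
      (trans (sym (*-distribˡ-sum (δ x s) (λ y → δ y t * h x y))) (cong (δ x s *_) (sum-δ (h x) t))))
    (sum-δ (λ x → h x t) s)

  pick : ∀ f₁ f₂ g₁ g₂ (h : Fin n → Fin n → ℤ) →
    sum₂ (λ x y → φ f₁ f₂ g₁ g₂ x y * h x y) ≡ h f₁ f₂ + h f₂ f₁ + h g₁ g₂ + h g₂ g₁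
  pick f₁ f₂ g₁ g₂ h = begin
    sum₂ (λ x y → φ f₁ f₂ g₁ g₂ x y * h x y)
      ≡⟨ sum₂-cong (λ x y → lemma (δ x f₁ * δ y f₂) (δ x f₂ * δ y f₁) (δ x g₁ * δ y g₂) (δ x g₂ * δ y g₁) (h x y)) ⟩
    sum₂ (λ x y → t f₁ f₂ x y + t f₂ f₁ x y + t g₁ g₂ x y + t g₂ g₁ x y)
      ≡⟨ sum₂-distrib-+ (λ x y → t f₁ f₂ x y + t f₂ f₁ x y + t g₁ g₂ x y) (t g₂ g₁) ⟩
    sum₂ (λ x y → t f₁ f₂ x y + t f₂ f₁ x y + t g₁ g₂ x y) + sum₂ (t g₂ g₁)
      ≡⟨ cong₂ _+_ (trans (sum₂-distrib-+ (λ x y → t f₁ f₂ x y + t f₂ f₁ x y) (t g₁ g₂))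
           (cong₂ _+_ (trans (sum₂-distrib-+ (t f₁ f₂) (t f₂ f₁)) (cong₂ _+_ (sum₂-δδ h f₁ f₂) (sum₂-δδ h f₂ f₁)))
             (sum₂-δδ h g₁ g₂))) (sum₂-δδ h g₂ g₁) ⟩
    h f₁ f₂ + h f₂ f₁ + h g₁ g₂ + h g₂ g₁ ∎
    where
    open ≡-Reasoning
    t : Fin n → Fin n → Fin n → Fin n → ℤ
    t a b x y = δ x a * δ y b * h x y
    lemma : ∀ a b c d e → (a + b + c + d) * e ≡ a * e + b * e + c * e + d * e
    lemma = solve-∀

  -- The left-hand side lists the entries in the rows and columns s and t. Only the four entries
  -- that lie in such a row and such a column at once are listed twice, and these vanish by
  -- hypothesis.
  cross : ∀ s t → s ≢ t → (h : Fin n → Fin n → ℤ) → (∀ x y → + 0 ℤ.≤ h x y) →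
    h s s ≡ + 0 → h s t ≡ + 0 → h t s ≡ + 0 → h t t ≡ + 0 →
    sum (λ v → h v s + h v t + h s v + h t v) ℤ.≤ sum₂ h
  cross s t s≢t h 0≤h ss st ts tt = subst (ℤ._≤ sum₂ h) weighted (sum-mono λ x → sum-mono λ y → bound x y)
    where
    open ≡-Reasoning
    bound : ∀ x y → (δ x s + δ x t + δ y s + δ y t) * h x y ℤ.≤ h x y
    bound x y with x ≟ s
    ... | yes refl rewrite δ-≢ s≢t = left
      where
      lemma : ∀ p q h → p * h ≡ + 0 → q * h ≡ + 0 → (+ 1 + + 0 + p + q) * h ≡ h
      lemma p q h ph qh = trans (expand p q h) (trans (cong₂ _+_ (cong (_+_ h) ph) qh) (trans (ℤ.+-identityʳ _) (ℤ.+-identityʳ h)))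
        where
        expand : ∀ p q h → (+ 1 + + 0 + p + q) * h ≡ h + p * h + q * h
        expand = solve-∀
      δh : ∀ w → h s w ≡ + 0 → δ y w * h s y ≡ + 0
      δh w eq with y ≟ w
      ... | yes refl = trans (ℤ.*-identityˡ _) eq
      ... | no _ = refl
      left : (+ 1 + + 0 + δ y s + δ y t) * h s y ℤ.≤ h s y
      left = ℤ.≤-reflexive (lemma (δ y s) (δ y t) (h s y) (δh s ss) (δh t st))
    ... | no _ with x ≟ t
    ... | yes refl = ℤ.≤-reflexive (lemma (δ y s) (δ y t) (h t y) (δh s ts) (δh t tt))
      where
      lemma : ∀ p q h → p * h ≡ + 0 → q * h ≡ + 0 → (+ 0 + + 1 + p + q) * h ≡ h
      lemma p q h ph qh = trans (expand p q h) (trans (cong₂ _+_ (cong (_+_ h) ph) qh) (trans (ℤ.+-identityʳ _) (ℤ.+-identityʳ h)))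
        where
        expand : ∀ p q h → (+ 0 + + 1 + p + q) * h ≡ h + p * h + q * h
        expand = solve-∀
      δh : ∀ w → h t w ≡ + 0 → δ y w * h t y ≡ + 0
      δh w eq with y ≟ w
      ... | yes refl = trans (ℤ.*-identityˡ _) eq
      ... | no _ = refl
    ... | no _ with y ≟ s
    ... | yes refl rewrite δ-≢ s≢t = ℤ.≤-reflexive (ℤ.*-identityˡ (h x s))
    ... | no _ = go (δ y t) (δ≤1 y t) (0≤δ y t)
      where
      0≤δ : ∀ (i j : Fin n) → + 0 ℤ.≤ δ i j
      0≤δ i j = 0≤ι (does (i ≟ j))
      go : ∀ p → p ℤ.≤ + 1 → + 0 ℤ.≤ p → (+ 0 + + 0 + + 0 + p) * h x y ℤ.≤ h x y
      go (+ 0) _ _ = 0≤h x y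
      go (+ 1) _ _ = ℤ.≤-reflexive (ℤ.*-identityˡ (h x y))
      go (+ suc (suc p)) (+≤+ (s≤s ())) _
    weighted : sum₂ (λ x y → (δ x s + δ x t + δ y s + δ y t) * h x y) ≡ sum (λ v → h v s + h v t + h s v + h t v)
    weighted = begin
      sum₂ (λ x y → (δ x s + δ x t + δ y s + δ y t) * h x y)
        ≡⟨ sum₂-cong (λ x y → lemma (δ x s) (δ x t) (δ y s) (δ y t) (h x y)) ⟩
      sum₂ (λ x y → (δ y s * h x y + δ y t * h x y) + (δ x s * h x y + δ x t * h x y))
        ≡⟨ sum₂-distrib-+ (λ x y → δ y s * h x y + δ y t * h x y) (λ x y → δ x s * h x y + δ x t * h x y) ⟩
      sum₂ (λ x y → δ y s * h x y + δ y t * h x y) + sum₂ (λ x y → δ x s * h x y + δ x t * h x y)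
        ≡⟨ cong₂ _+_ (sum-cong-≗ λ x → trans (∑-distrib-+ (λ y → δ y s * h x y) (λ y → δ y t * h x y))
                        (cong₂ _+_ (sum-δ (h x) s) (sum-δ (h x) t)))
             (trans (∑-comm (λ x y → δ x s * h x y + δ x t * h x y))
               (sum-cong-≗ λ y → trans (∑-distrib-+ (λ x → δ x s * h x y) (λ x → δ x t * h x y))
                        (cong₂ _+_ (sum-δ (λ x → h x y) s) (sum-δ (λ x → h x y) t)))) ⟩
      sum (λ v → h v s + h v t) + sum (λ v → h s v + h t v)
        ≡⟨ sym (∑-distrib-+ (λ v → h v s + h v t) (λ v → h s v + h t v)) ⟩
      sum (λ v → (h v s + h v t) + (h s v + h t v))
        ≡⟨ sum-cong-≗ (λ v → sym (ℤ.+-assoc (h v s + h v t) (h s v) (h t v))) ⟩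
      sum (λ v → h v s + h v t + h s v + h t v) ∎
      where
      lemma : ∀ a b c d e → (a + b + c + d) * e ≡ (c * e + d * e) + (a * e + b * e)
      lemma = solve-∀

  module _ {f₁ f₂ g₁ g₂} (K : Induced2K₂ f₁ f₂ g₁ g₂) where
    open Induced2K₂ K

    private
      Γ : Fin n → Fin n → Fin n → ℤ
      Γ = γ f₁ f₂ g₁ g₂ f₁
      Unc : Fin n → Fin n → Bool
      Unc = uncovered f₁ f₂ g₁ g₂

    -- If f₁ ~ u, the 4-cycle on f and uv must join f₁ to u and f₂ to v, because f₂ ~ u would close
    -- a triangle. For g both ways remain possible.
    uncovered-edge : ∀ {u v} → Unc u v ≡ true → adj H f₁ u ≡ true →
      adj H u v ≡ true × adj H f₂ v ≡ true ×
      ((adj H g₁ u ≡ true × adj H g₂ v ≡ true) ⊎ (adj H g₂ u ≡ true × adj H g₁ v ≡ true))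
    uncovered-edge {u} {v} unc f₁u with split (adj H u v) (apart f₁ f₂ u v) (apart g₁ g₂ u v) unc
      where
      split : ∀ a b c → a ∧ not b ∧ not c ≡ true → a ≡ true × b ≡ false × c ≡ false
      split true false false _ = refl , refl , refl
    ... | uv , af , ag = uv , ff (apart-elim f uv af) , gg (apart-elim g uv ag)
      where
      ff : (adj H f₂ u ≡ true × adj H f₁ v ≡ true) ⊎ (adj H f₁ u ≡ true × adj H f₂ v ≡ true) → adj H f₂ v ≡ true
      ff (inj₁ (f₂u , f₁v)) = ⊥-elim (triangle-free f f₂u f₁u)
      ff (inj₂ (_ , f₂v)) = f₂v
      gg : (adj H g₂ u ≡ true × adj H g₁ v ≡ true) ⊎ (adj H g₁ u ≡ true × adj H g₂ v ≡ true) →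
        (adj H g₁ u ≡ true × adj H g₂ v ≡ true) ⊎ (adj H g₂ u ≡ true × adj H g₁ v ≡ true)
      gg (inj₁ p) = inj₂ p
      gg (inj₂ p) = inj₁ p

    -- If uv forms a 4-cycle with each of f and g, where f₁ ~ u and v ~ g′, then f₁u and vg′ are apart.
    γ≡1 : ∀ {u v} → adj H u v ≡ true → adj H f₁ u ≡ true → adj H f₂ v ≡ true → ∀ {g′ g″} →
      g′ ≢ f₁ → g′ ≢ f₂ → adj H f₁ g′ ≡ false → adj H f₂ g″ ≡ false →
      adj H g″ u ≡ true → adj H g′ v ≡ true →
      (v ≢ g″ → v ≢ f₁ → v ≢ f₂ → keep f₁ f₂ g₁ g₂ v g′ ≡ + 1 × keep f₁ f₂ g₁ g₂ g′ v ≡ + 1) →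
      Γ u v g′ ≡ + 1 × Γ u g′ v ≡ + 1
    γ≡1 {u} {v} uv f₁u f₂v {g′} {g″} g′≢f₁ g′≢f₂ ¬f₁g′ ¬f₂g″ g″u g′v keeps
      = one (proj₁ kept) a₁ , one (proj₂ kept) a₂
      where
      kept = keeps (separated (adj-sym f₂v) (trans (Graph.sym H g″ f₂) ¬f₂g″))
                   (λ { refl → true≢false (trans (sym g′v) (trans (Graph.sym H g′ f₁) ¬f₁g′)) })
                   (adj⇒≢ (adj-sym f₂v))
      ¬f₁v : adj H f₁ v ≡ true → ⊥
      ¬f₁v f₁v = triangle-free f₁u uv f₁v
      ¬f₁g : adj H f₁ g′ ≡ true → ⊥
      ¬f₁g p = true≢false (trans (sym p) ¬f₁g′)
      a₁ : apart f₁ u v g′ ≡ true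
      a₁ = apart-intro f₁u (adj-sym g′v) (λ _ → ¬f₁g) (λ p _ → ¬f₁v p)
      a₂ : apart f₁ u g′ v ≡ true
      a₂ = apart-intro f₁u g′v (λ _ → ¬f₁v) (λ p _ → ¬f₁g p)
      kf : keep f₁ f₂ g₁ g₂ f₁ u ≡ + 1
      kf = keep≡1 {y = u} (inj₂ (λ { refl → true≢false (trans (sym (adj-sym g″u)) ¬f₂g″) }))
        (inj₁ f₁≢f₂) (inj₁ f₁≢g₁) (inj₁ f₁≢g₂)
      one : ∀ {c d} → keep f₁ f₂ g₁ g₂ c d ≡ + 1 → apart f₁ u c d ≡ true → Γ u c d ≡ + 1
      one k a = cong₂ _*_ (cong₂ _*_ kf k) (cong ι a)

    private
      sums≥0 : ∀ u v → + 0 ℤ.≤ Γ u v g₁ + Γ u v g₂ + Γ u g₁ v + Γ u g₂ v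
      sums≥0 u v = ℤ.+-mono-≤ (ℤ.+-mono-≤ (ℤ.+-mono-≤ (0≤γ K f₁ u v g₁) (0≤γ K f₁ u v g₂)) (0≤γ K f₁ u g₁ v)) (0≤γ K f₁ u g₂ v)

    -- With g′ the end of g that is joined to v, the edges f₁u and vg′ are apart and differ from f
    -- and g. The factor 2 counts the orientations vg′ and g′v.
    part-bound : ∀ u v → + 2 * ι (Unc u v ∧ adj H f₁ u) ℤ.≤ Γ u v g₁ + Γ u v g₂ + Γ u g₁ v + Γ u g₂ v
    part-bound u v = go (Unc u v ∧ adj H f₁ u) refl
      where
      Bound : Bool → Set
      Bound b = + 2 * ι b ℤ.≤ Γ u v g₁ + Γ u v g₂ + Γ u g₁ v + Γ u g₂ v
      ∧-split : ∀ a b → a ∧ b ≡ true → a ≡ true × b ≡ true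
      ∧-split true true _ = refl , refl
      from-g₂ : Γ u v g₂ ≡ + 1 × Γ u g₂ v ≡ + 1 → Bound true
      from-g₂ (e₁ , e₂) = ℤ.+-mono-≤ (ℤ.+-mono-≤ (ℤ.+-mono-≤ (0≤γ K f₁ u v g₁) (ℤ.≤-reflexive (sym e₁))) (0≤γ K f₁ u g₁ v)) (ℤ.≤-reflexive (sym e₂))
      from-g₁ : Γ u v g₁ ≡ + 1 × Γ u g₁ v ≡ + 1 → Bound true
      from-g₁ (e₁ , e₂) = ℤ.+-mono-≤ (ℤ.+-mono-≤ (ℤ.+-mono-≤ (ℤ.≤-reflexive (sym e₁)) (0≤γ K f₁ u v g₂)) (ℤ.≤-reflexive (sym e₂))) (0≤γ K f₁ u g₂ v)
      covered : adj H f₁ u ≡ true → adj H u v ≡ true × adj H f₂ v ≡ true ×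
        ((adj H g₁ u ≡ true × adj H g₂ v ≡ true) ⊎ (adj H g₂ u ≡ true × adj H g₁ v ≡ true)) → Bound true
      covered f₁u (uv , f₂v , inj₁ (g₁u , g₂v)) = from-g₂ (γ≡1 uv f₁u f₂v (f₁≢g₂ ∘ sym) (f₂≢g₂ ∘ sym) ¬f₁g₂ ¬f₂g₁ g₁u g₂v
        (λ v≢g₁ v≢f₁ v≢f₂ → keep≡1 (inj₁ v≢f₁) (inj₁ v≢f₂) (inj₁ v≢g₁) (inj₂ (g₁≢g₂ ∘ sym)) ,
                            keep≡1 (inj₂ v≢f₂) (inj₂ v≢f₁) (inj₁ (g₁≢g₂ ∘ sym)) (inj₂ v≢g₁)))
      covered f₁u (uv , f₂v , inj₂ (g₂u , g₁v)) = from-g₁ (γ≡1 uv f₁u f₂v (f₁≢g₁ ∘ sym) (f₂≢g₁ ∘ sym) ¬f₁g₁ ¬f₂g₂ g₂u g₁v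
        (λ v≢g₂ v≢f₁ v≢f₂ → keep≡1 (inj₁ v≢f₁) (inj₁ v≢f₂) (inj₂ g₁≢g₂) (inj₁ v≢g₂) ,
                            keep≡1 (inj₂ v≢f₂) (inj₂ v≢f₁) (inj₂ v≢g₂) (inj₁ g₁≢g₂)))
      go : ∀ b → Unc u v ∧ adj H f₁ u ≡ b → Bound b
      go false _ = sums≥0 u v
      go true eq with ∧-split (Unc u v) (adj H f₁ u) eq
      ... | unc , f₁u = covered f₁u (uncovered-edge unc f₁u)

    keep-g≡0 : keep f₁ f₂ g₁ g₂ g₁ g₂ ≡ + 0 × keep f₁ f₂ g₁ g₂ g₂ g₁ ≡ + 0
    keep-g≡0 = vanish g₁ g₂ (δδ≡0 {g₁} {g₂} (inj₁ (f₁≢g₁ ∘ sym))) (δδ≡0 {g₁} {g₂} (inj₁ (f₂≢g₁ ∘ sym)))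
               (cong₂ _+_ (cong₂ _*_ (δ-refl g₁) (δ-refl g₂)) (δδ≡0 {g₁} {g₂} (inj₁ g₁≢g₂))) ,
             vanish g₂ g₁ (δδ≡0 {g₂} {g₁} (inj₁ (f₁≢g₂ ∘ sym))) (δδ≡0 {g₂} {g₁} (inj₁ (f₂≢g₂ ∘ sym)))
               (cong₂ _+_ (δδ≡0 {g₂} {g₁} (inj₁ (g₁≢g₂ ∘ sym))) (cong₂ _*_ (δ-refl g₂) (δ-refl g₁)))
      where
      vanish : ∀ x y → δ x f₁ * δ y f₂ ≡ + 0 → δ x f₂ * δ y f₁ ≡ + 0 → δ x g₁ * δ y g₂ + δ x g₂ * δ y g₁ ≡ + 1 →
        keep f₁ f₂ g₁ g₂ x y ≡ + 0
      vanish x y p q r = cong (_-_ (+ 1)) (trans (ℤ.+-assoc (δ x f₁ * δ y f₂ + δ x f₂ * δ y f₁) (δ x g₁ * δ y g₂) (δ x g₂ * δ y g₁))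
        (cong₂ _+_ (cong₂ _+_ p q) r))

    -- For fixed u, different v give different second edges, since one end lies in {g₁, g₂} and the
    -- other end is v. This is the situation of `cross`, whose four exceptional entries are the
    -- loops at g₁, g₂ and g itself.
    part : sum₂ (λ u v → + 2 * ι (Unc u v ∧ adj H f₁ u)) ℤ.≤ sum (λ u → sum₂ (Γ u))
    part = sum-mono λ u → ℤ.≤-trans (sum-mono (part-bound u))
      (cross g₁ g₂ g₁≢g₂ (Γ u) (0≤γ K f₁ u) (loop u g₁) (dropped u (proj₁ keep-g≡0)) (dropped u (proj₂ keep-g≡0)) (loop u g₂))
      where
      loop : ∀ u w → Γ u w w ≡ + 0
      loop u w = trans (cong (k *_) (cong ι apart-ww)) (ℤ.*-zeroʳ k)
        where
        k = keep f₁ f₂ g₁ g₂ f₁ u * keep f₁ f₂ g₁ g₂ w w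
        apart-ww : apart f₁ u w w ≡ false
        apart-ww rewrite Graph.irrefl H w with adj H f₁ u
        ... | true  = refl
        ... | false = refl
      dropped : ∀ u {c d} → keep f₁ f₂ g₁ g₂ c d ≡ + 0 → Γ u c d ≡ + 0
      dropped u {c} {d} k≡0 = trans (cong (λ k → keep f₁ f₂ g₁ g₂ f₁ u * k * β f₁ u c d) k≡0)
        (cong (_* β f₁ u c d) (ℤ.*-zeroʳ (keep f₁ f₂ g₁ g₂ f₁ u)))

  N : Fin n → Fin n → Fin n → Fin n → Fin n → ℤ
  N f₁ f₂ g₁ g₂ a = sum (λ b → sum₂ (γ f₁ f₂ g₁ g₂ a b))

  U : Fin n → Fin n → Fin n → Fin n → ℤ
  U f₁ f₂ g₁ g₂ = sum₂ (λ u v → ι (uncovered f₁ f₂ g₁ g₂ u v))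

  γ-cong : ∀ {f₁ f₂ g₁ g₂ f₁′ f₂′ g₁′ g₂′} → (∀ x y → φ f₁ f₂ g₁ g₂ x y ≡ φ f₁′ f₂′ g₁′ g₂′ x y) →
    ∀ a b c d → γ f₁ f₂ g₁ g₂ a b c d ≡ γ f₁′ f₂′ g₁′ g₂′ a b c d
  γ-cong eq a b c d = cong (_* β a b c d) (cong₂ (λ x y → (+ 1 - x) * (+ 1 - y)) (eq a b) (eq c d))

  N-cong : ∀ {f₁ f₂ g₁ g₂ f₁′ f₂′ g₁′ g₂′} → (∀ x y → φ f₁ f₂ g₁ g₂ x y ≡ φ f₁′ f₂′ g₁′ g₂′ x y) →
    ∀ a → N f₁ f₂ g₁ g₂ a ≡ N f₁′ f₂′ g₁′ g₂′ a
  N-cong eq a = sum-cong-≗ λ b → sum₂-cong (γ-cong eq a b)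

  -- An uncovered uv lies on a 4-cycle with f, so u is joined to f₁ or to f₂. The first case is
  -- `part`, the second is `part` with f reversed.
  half : ∀ {f₁ f₂ g₁ g₂} → Induced2K₂ f₁ f₂ g₁ g₂ →
    + 2 * U f₁ f₂ g₁ g₂ ℤ.≤ N f₁ f₂ g₁ g₂ f₁ + N f₁ f₂ g₁ g₂ f₂
  half {f₁} {f₂} {g₁} {g₂} K = begin
    + 2 * U f₁ f₂ g₁ g₂
      ≡⟨ *-distribˡ-sum₂ (+ 2) (λ u v → ι (unc u v)) ⟩
    sum₂ (λ u v → + 2 * ι (unc u v))
      ≤⟨ sum-mono (λ u → sum-mono λ v → split u v) ⟩
    sum₂ (λ u v → + 2 * ι (unc u v ∧ adj H f₁ u) + + 2 * ι (unc u v ∧ adj H f₂ u))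
      ≡⟨ sum₂-distrib-+ (λ u v → + 2 * ι (unc u v ∧ adj H f₁ u)) (λ u v → + 2 * ι (unc u v ∧ adj H f₂ u)) ⟩
    sum₂ (λ u v → + 2 * ι (unc u v ∧ adj H f₁ u)) + sum₂ (λ u v → + 2 * ι (unc u v ∧ adj H f₂ u))
      ≡⟨ cong (_+_ (sum₂ (λ u v → + 2 * ι (unc u v ∧ adj H f₁ u)))) (sum₂-cong λ u v →
           cong (λ b → + 2 * ι ((adj H u v ∧ not b ∧ not (apart g₁ g₂ u v)) ∧ adj H f₂ u)) (sym (apart-swap f₁ f₂ u v))) ⟩
    sum₂ (λ u v → + 2 * ι (unc u v ∧ adj H f₁ u)) + sum₂ (λ u v → + 2 * ι (uncovered f₂ f₁ g₁ g₂ u v ∧ adj H f₂ u))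
      ≤⟨ ℤ.+-mono-≤ (part K) (part (reverse-f K)) ⟩
    N f₁ f₂ g₁ g₂ f₁ + N f₂ f₁ g₁ g₂ f₂
      ≡⟨ cong (_+_ (N f₁ f₂ g₁ g₂ f₁)) (N-cong (λ x y → lemma (δ x f₂ * δ y f₁) (δ x f₁ * δ y f₂) (δ x g₁ * δ y g₂) (δ x g₂ * δ y g₁)) f₂) ⟩
    N f₁ f₂ g₁ g₂ f₁ + N f₁ f₂ g₁ g₂ f₂ ∎
    where
    open ℤ.≤-Reasoning
    unc = uncovered f₁ f₂ g₁ g₂
    lemma : ∀ a b c d → a + b + c + d ≡ b + a + c + d
    lemma = solve-∀
    split : ∀ u v → + 2 * ι (unc u v) ℤ.≤ + 2 * ι (unc u v ∧ adj H f₁ u) + + 2 * ι (unc u v ∧ adj H f₂ u)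
    split u v = go (adj H u v) (apart f₁ f₂ u v) (apart g₁ g₂ u v) (adj H f₁ u) (adj H f₂ u) refl refl refl refl
      where
      go : ∀ a b c x y → adj H u v ≡ a → apart f₁ f₂ u v ≡ b → adj H f₁ u ≡ x → adj H f₂ u ≡ y →
        + 2 * ι (a ∧ not b ∧ not c) ℤ.≤ + 2 * ι ((a ∧ not b ∧ not c) ∧ x) + + 2 * ι ((a ∧ not b ∧ not c) ∧ y)
      go false b c x y _ _ _ _ = ℤ.≤-refl
      go true true c x y _ _ _ _ = ℤ.≤-refl
      go true false true x y _ _ _ _ = ℤ.≤-refl
      go true false false true true _ _ _ _ = +≤+ (s≤s (s≤s z≤n))
      go true false false true false _ _ _ _ = ℤ.≤-refl
      go true false false false true _ _ _ _ = ℤ.≤-refl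
      go true false false false false uv af f₁u f₂u with apart-elim (Induced2K₂.f K) uv af
      ... | inj₁ (p , _) = ⊥-elim (true≢false (trans (sym p) f₂u))
      ... | inj₂ (p , _) = ⊥-elim (true≢false (trans (sym p) f₁u))

  -- `half` for f and, by `exchange`, for g bounds the quadruples that start at f₁, f₂, g₁ or g₂.
  -- These vertices are distinct, so the four numbers `N` belong to different first indices of the
  -- sum.
  rest-bound : ∀ {f₁ f₂ g₁ g₂} → Induced2K₂ f₁ f₂ g₁ g₂ → + 4 * U f₁ f₂ g₁ g₂ ℤ.≤ sum₄ (γ f₁ f₂ g₁ g₂)
  rest-bound {f₁} {f₂} {g₁} {g₂} K = begin
    + 4 * U f₁ f₂ g₁ g₂
      ≡⟨ double (U f₁ f₂ g₁ g₂) ⟩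
    + 2 * U f₁ f₂ g₁ g₂ + + 2 * U f₁ f₂ g₁ g₂
      ≡⟨ cong (λ x → + 2 * U f₁ f₂ g₁ g₂ + + 2 * x) (sum₂-cong λ u v → cong ι (unc-comm (adj H u v) (apart f₁ f₂ u v) (apart g₁ g₂ u v))) ⟩
    + 2 * U f₁ f₂ g₁ g₂ + + 2 * U g₁ g₂ f₁ f₂
      ≤⟨ ℤ.+-mono-≤ (half K) (half (exchange K)) ⟩
    (M f₁ + M f₂) + (N g₁ g₂ f₁ f₂ g₁ + N g₁ g₂ f₁ f₂ g₂)
      ≡⟨ cong (_+_ (M f₁ + M f₂)) (cong₂ _+_ (N-cong φ-comm g₁) (N-cong φ-comm g₂)) ⟩
    (M f₁ + M f₂) + (M g₁ + M g₂)
      ≡⟨ sym (ℤ.+-assoc (M f₁ + M f₂) (M g₁) (M g₂)) ⟩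
    M f₁ + M f₂ + M g₁ + M g₂
      ≡⟨ sym (cong₂ _+_ (cong₂ _+_ (cong₂ _+_ (sum-δ M f₁) (sum-δ M f₂)) (sum-δ M g₁)) (sum-δ M g₂)) ⟩
    sum (w f₁) + sum (w f₂) + sum (w g₁) + sum (w g₂)
      ≡⟨ sym (trans (∑-distrib-+ (λ x → w f₁ x + w f₂ x + w g₁ x) (w g₂)) (cong (_+ sum (w g₂))
           (trans (∑-distrib-+ (λ x → w f₁ x + w f₂ x) (w g₁)) (cong (_+ sum (w g₁)) (∑-distrib-+ (w f₁) (w f₂)))))) ⟩
    sum (λ x → w f₁ x + w f₂ x + w g₁ x + w g₂ x)
      ≤⟨ sum-mono (λ x → subst₂ ℤ._≤_ (factor (δ x f₁) (δ x f₂) (δ x g₁) (δ x g₂) (M x)) (ℤ.*-identityˡ (M x))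
           (ℤ.*-monoʳ-≤-nonNeg (M x) {{ℤ.nonNegative (0≤M x)}}
             (distinct⇒Σδ≤1 K x (+ 1) (+ 1) (+ 1) (+ 1) ℤ.≤-refl ℤ.≤-refl ℤ.≤-refl ℤ.≤-refl))) ⟩
    sum M ∎
    where
    open ℤ.≤-Reasoning
    M : Fin n → ℤ
    M = N f₁ f₂ g₁ g₂
    w : Fin n → Fin n → ℤ
    w a x = δ x a * M x
    0≤M : ∀ x → + 0 ℤ.≤ M x
    0≤M x = sum-nonneg λ b → sum-nonneg λ c → sum-nonneg λ d → 0≤γ K x b c d
    double : ∀ u → + 4 * u ≡ + 2 * u + + 2 * u
    double = solve-∀
    factor : ∀ a b c d m → (a * + 1 + b * + 1 + c * + 1 + d * + 1) * m ≡ a * m + b * m + c * m + d * m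
    factor = solve-∀
    φ-comm : ∀ x y → φ g₁ g₂ f₁ f₂ x y ≡ φ f₁ f₂ g₁ g₂ x y
    φ-comm x y = lemma (δ x g₁ * δ y g₂) (δ x g₂ * δ y g₁) (δ x f₁ * δ y f₂) (δ x f₂ * δ y f₁)
      where
      lemma : ∀ a b c d → a + b + c + d ≡ c + d + a + b
      lemma = solve-∀
    unc-comm : ∀ a b c → a ∧ not b ∧ not c ≡ a ∧ not c ∧ not b
    unc-comm false b c = refl
    unc-comm true true true = refl
    unc-comm true true false = refl
    unc-comm true false true = refl
    unc-comm true false false = refl

  -- With f = f₁f₂ and g = g₁g₂, send an edge uv ∉ {f, g} to the pair {uv, f} or {uv, g} if it is apart,
  -- and otherwise, labelled so that f₁ ~ u and v ~ g′ ∈ {g₁, g₂}, to {f₁u, vg′}.  Together with {f, g}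
  -- these are distinct pairs of apart edges; sum₄ β counts each such pair eight times.
  induced-2K₂-bound : ∀ {f₁ f₂ g₁ g₂} → Induced2K₂ f₁ f₂ g₁ g₂ → + 4 * tr A 2 ℤ.≤ sum₄ β + + 8
  induced-2K₂-bound {f₁} {f₂} {g₁} {g₂} K = begin
    + 4 * tr A 2
      ≡⟨ cong (+ 4 *_) tr-2-sum ⟩
    + 4 * sum₂ A
      ≤⟨ ℤ.*-monoˡ-≤-nonNeg (+ 4) (sum-mono λ u → sum-mono λ v → cover (adj H u v) (apart f₁ f₂ u v) (apart g₁ g₂ u v)) ⟩
    + 4 * sum₂ (λ u v → β f₁ f₂ u v + β g₁ g₂ u v + ι (uncovered f₁ f₂ g₁ g₂ u v))
      ≡⟨ cong (+ 4 *_) (trans (sum₂-distrib-+ (λ u v → β f₁ f₂ u v + β g₁ g₂ u v) (λ u v → ι (uncovered f₁ f₂ g₁ g₂ u v)))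
           (cong (_+ U f₁ f₂ g₁ g₂) (sum₂-distrib-+ (β f₁ f₂) (β g₁ g₂)))) ⟩
    + 4 * (Cf + Cg + U f₁ f₂ g₁ g₂)
      ≡⟨ ℤ.*-distribˡ-+ (+ 4) (Cf + Cg) (U f₁ f₂ g₁ g₂) ⟩
    + 4 * (Cf + Cg) + + 4 * U f₁ f₂ g₁ g₂
      ≤⟨ ℤ.+-monoʳ-≤ (+ 4 * (Cf + Cg)) (rest-bound K) ⟩
    + 4 * (Cf + Cg) + sum₄ Γ
      ≡⟨ regroup Cf Cg (sum₄ Γ) ⟩
    ((Cf + Cf + Cg + Cg) + (Cf + Cf + Cg + Cg) + sum₄ Γ - + 8) + + 8
      ≡⟨ cong (_+ + 8) (sym sum-β) ⟩
    sum₄ β + + 8 ∎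
    where
    open ℤ.≤-Reasoning
    open Induced2K₂ K
    Cf Cg : ℤ
    Cf = sum₂ (β f₁ f₂)
    Cg = sum₂ (β g₁ g₂)
    Γ = γ f₁ f₂ g₁ g₂
    Φ = φ f₁ f₂ g₁ g₂
    regroup : ∀ a b c → + 4 * (a + b) + c ≡ ((a + a + b + b) + (a + a + b + b) + c - + 8) + + 8
    regroup = solve-∀
    cover : ∀ a b c → ι a ℤ.≤ ι b + ι c + ι (a ∧ not b ∧ not c)
    cover false b c = ℤ.+-mono-≤ (ℤ.+-mono-≤ (0≤ι b) (0≤ι c)) ℤ.≤-refl
    cover true false false = ℤ.≤-refl
    cover true false true = ℤ.≤-refl
    cover true true false = ℤ.≤-refl
    cover true true true = +≤+ (s≤s z≤n)
    β-swap : ∀ a b c d → β b a c d ≡ β a b c d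
    β-swap a b c d = cong ι (apart-swap a b c d)
    β-comm : ∀ a b c d → β c d a b ≡ β a b c d
    β-comm a b c d = cong ι (apart-comm a b c d)
    first : sum₄ (λ a b c d → Φ a b * β a b c d) ≡ Cf + Cf + Cg + Cg
    first = ≡.trans (sum₂-cong λ a b → ≡.sym (*-distribˡ-sum₂ (Φ a b) (β a b)))
      (≡.trans (pick f₁ f₂ g₁ g₂ (λ a b → sum₂ (β a b)))
        (cong₂ _+_ (cong₂ _+_ (cong (_+_ Cf) (sum₂-cong (β-swap f₁ f₂))) ≡.refl) (sum₂-cong (β-swap g₁ g₂))))
    second : sum₄ (λ a b c d → Φ c d * β a b c d) ≡ Cf + Cf + Cg + Cg
    second = ≡.trans (sum₂-comm (λ a b c d → Φ c d * β a b c d))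
      (≡.trans (sum₄-cong λ c d a b → cong (Φ c d *_) (β-comm c d a b)) first)
    -- Both edges lie in {f, g}. An edge is not apart from itself, so only the pair {f, g} remains,
    -- listed eight times; `first` and `second` both contain it, hence the correction in `sum-β`.
    both : sum₄ (λ a b c d → Φ a b * (Φ c d * β a b c d)) ≡ + 8
    both = ≡.trans (sum₂-cong λ a b → ≡.sym (*-distribˡ-sum₂ (Φ a b) (λ c d → Φ c d * β a b c d)))
      (≡.trans (sum₂-cong λ a b → cong (Φ a b *_) (pick f₁ f₂ g₁ g₂ (β a b)))
        (≡.trans (pick f₁ f₂ g₁ g₂ (λ a b → β a b f₁ f₂ + β a b f₂ f₁ + β a b g₁ g₂ + β a b g₂ g₁))
          (cong₂ _+_ (cong₂ _+_ (cong₂ _+_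
            (two (self f) (self′ f) (disjoint K) (disjoint (exchange (reverse-f (exchange K)))))
            (two (self′ (adj-sym f)) (self (adj-sym f)) (disjoint (reverse-f K)) (disjoint (reverse-f (exchange (reverse-f (exchange K)))))))
            (two′ (disjoint (exchange K)) (disjoint (exchange (reverse-f K))) (self g) (self′ g)))
            (two′ (disjoint (reverse-f (exchange K))) (disjoint (reverse-f (exchange (reverse-f K)))) (self′ (adj-sym g)) (self (adj-sym g))))))
      where
      self : ∀ {s t} → adj H s t ≡ true → apart s t s t ≡ false
      self {s} {t} st rewrite Graph.sym H t s | st = refl
      self′ : ∀ {s t} → adj H s t ≡ true → apart s t t s ≡ false
      self′ {s} {t} st rewrite Graph.sym H t s | st | Graph.irrefl H t = refl
      disjoint : ∀ {s₁ s₂ t₁ t₂} → Induced2K₂ s₁ s₂ t₁ t₂ → apart s₁ s₂ t₁ t₂ ≡ true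
      disjoint K = apart-intro (Induced2K₂.f K) (Induced2K₂.g K)
        (λ p _ → true≢false (≡.trans (≡.sym p) (Induced2K₂.¬f₂g₁ K)))
        (λ p _ → true≢false (≡.trans (≡.sym p) (Induced2K₂.¬f₁g₁ K)))
      two : ∀ {a b c d} → a ≡ false → b ≡ false → c ≡ true → d ≡ true → ι a + ι b + ι c + ι d ≡ + 2
      two refl refl refl refl = refl
      two′ : ∀ {a b c d} → a ≡ true → b ≡ true → c ≡ false → d ≡ false → ι a + ι b + ι c + ι d ≡ + 2
      two′ refl refl refl refl = refl
    sum-β : sum₄ β ≡ (Cf + Cf + Cg + Cg) + (Cf + Cf + Cg + Cg) + sum₄ Γ - + 8
    sum-β = isolate (≡.trans (cong (_+_ (sum₄ β)) (≡.sym both)) (≡.trans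
      (≡.sym (sum₄-distrib-+ β (λ a b c d → Φ a b * (Φ c d * β a b c d))))
      (≡.trans (sum₄-cong λ a b c d → inclusion-exclusion (Φ a b) (Φ c d) (β a b c d))
        (≡.trans (sum₄-distrib-+ (λ a b c d → Φ a b * β a b c d + Φ c d * β a b c d) Γ)
          (cong (_+ sum₄ Γ) (≡.trans (sum₄-distrib-+ (λ a b c d → Φ a b * β a b c d) (λ a b c d → Φ c d * β a b c d))
            (cong₂ _+_ first second)))))))
      where
      inclusion-exclusion : ∀ p q b → b + p * (q * b) ≡ p * b + q * b + (+ 1 - p) * (+ 1 - q) * b
      inclusion-exclusion = solve-∀
      isolate : ∀ {x y} → x + + 8 ≡ y → x ≡ y - + 8
      isolate {x} refl = lemma x
        where
        lemma : ∀ x → x ≡ x + + 8 - + 8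
        lemma = solve-∀

  -- By `apart-count` the sum of β is 8P, so `induced-2K₂-bound` reads 8e ≤ 8P + 8, against P + 2 ≤
  -- e.
  no-induced-2K₂ : ∀ e P → tr A 2 ≡ + 2 * e → tr A 4 ≡ + 2 * e * e - + 4 * P → P + + 2 ℤ.≤ e →
    ∀ {f₁ f₂ g₁ g₂} → Induced2K₂ f₁ f₂ g₁ g₂ → ⊥
  no-induced-2K₂ e P t₂ t₄ P+2≤e K = impossible (ℤ.+-mono-≤ bound (ℤ.*-monoˡ-≤-nonNeg (+ 8) P+2≤e))
    where
    expand : ∀ e P → + 2 * e * (+ 2 * e) - (+ 2 * e * e - + 4 * P) - (+ 2 * e * e - + 4 * P) ≡ + 8 * P
    expand = solve-∀
    isolate : ∀ {x y t} → y ≡ x + t + t → x ≡ y - t - t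
    isolate {x} {t = t} refl = lemma x t
      where
      lemma : ∀ x t → x ≡ x + t + t - t - t
      lemma = solve-∀
    sum-β : sum₄ β ≡ + 8 * P
    sum-β = trans (isolate apart-count) (trans (cong₂ (λ x y → x * x - y - y) t₂ t₄) (expand e P))
    bound : + 4 * (+ 2 * e) ℤ.≤ + 8 * P + + 8
    bound = subst₂ ℤ._≤_ (cong (+ 4 *_) t₂) (cong (_+ + 8) sum-β) (induced-2K₂-bound K)
    impossible : + 4 * (+ 2 * e) + + 8 * (P + + 2) ℤ.≤ + 8 * P + + 8 + + 8 * e → ⊥
    impossible le with ℤ.i≤j⇒0≤j-i le
    ... | 0≤ with subst (+ 0 ℤ.≤_) (collapse e P) 0≤
      where
      collapse : ∀ e P → + 8 * P + + 8 + + 8 * e - (+ 4 * (+ 2 * e) + + 8 * (P + + 2)) ≡ - (+ 8)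
      collapse = solve-∀
    ... | ()

-- The structure of a cospectral mate

argmax : ∀ {n} → Fin n → (f : Fin n → ℤ) → ∃[ i ] (∀ j → f j ℤ.≤ f i)
argmax {suc zero}    _ f = zero , λ { zero → ℤ.≤-refl }
argmax {suc (suc n)} _ f with argmax zero (f ∘ suc)
... | i , max with ℤ.≤-total (f zero) (f (suc i))
...   | inj₁ le = suc i , λ { zero → le ; (suc j) → max j }
...   | inj₂ ge = zero , λ { zero → ℤ.≤-refl ; (suc j) → ℤ.≤-trans (max j) ge }

module Walking {n} (H : Graph n) where

  private
    A = adjℤ H

  pow-nonneg : ∀ k i j → + 0 ℤ.≤ pow A k i j
  pow-nonneg zero    i j = 0≤ι (does (i ≟ j))
  pow-nonneg (suc k) i j = sum-nonneg λ s → 0≤x*ι (pow-nonneg k i s) (adj H s j)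
    where
    0≤x*ι : ∀ {x} → + 0 ℤ.≤ x → ∀ b → + 0 ℤ.≤ x * ι b
    0≤x*ι {x} 0≤x true  = subst (+ 0 ℤ.≤_) (sym (ℤ.*-identityʳ x)) 0≤x
    0≤x*ι {x} 0≤x false = ℤ.≤-reflexive (sym (ℤ.*-zeroʳ x))

  stay : ∀ i → + 1 ℤ.≤ pow A 0 i i
  stay i = ℤ.≤-reflexive (sym (δ-refl i))

  -- All entries are nonnegative, so a single summand gives a lower bound. Extending `stay` edge by
  -- edge turns a closed walk into a positive diagonal entry.
  walk : ∀ k i {s j} → + 1 ℤ.≤ pow A k i s → adj H s j ≡ true → + 1 ℤ.≤ pow A (suc k) i j
  walk k i {s} {j} 1≤ sj = ℤ.≤-trans
    (subst (+ 1 ℤ.≤_) (trans (sym (ℤ.*-identityʳ (pow A k i s))) (cong (λ b → pow A k i s * ι b) (sym sj))) 1≤)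
    (term≤sum (λ t → nonneg t) s)
    where
    nonneg : ∀ t → + 0 ℤ.≤ pow A k i t * A t j
    nonneg t with adj H t j
    ... | true  = subst (+ 0 ℤ.≤_) (sym (ℤ.*-identityʳ _)) (pow-nonneg k i t)
    ... | false = ℤ.≤-reflexive (sym (ℤ.*-zeroʳ (pow A k i t)))

  1≰0 : ∀ {x} → x ≡ + 0 → + 1 ℤ.≤ x → ⊥
  1≰0 refl (+≤+ ())

  tr-3⇒triangle-free : tr A 3 ≡ + 0 → ∀ {i j k} →
    adj H i j ≡ true → adj H j k ≡ true → adj H i k ≡ true → ⊥
  tr-3⇒triangle-free t₃ {i} ij jk ik = 1≰0 (sum≡0⇒term≡0 (λ i → pow-nonneg 3 i i) t₃ i)
    (walk 2 i (walk 1 i (walk 0 i (stay i) ij) jk) (trans (Graph.sym H _ _) ik))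

module Structure {n} (H : Graph n) (e P : ℤ)
  (t₂ : tr (adjℤ H) 2 ≡ + 2 * e) (t₃ : tr (adjℤ H) 3 ≡ + 0) (t₄ : tr (adjℤ H) 4 ≡ + 2 * e * e - + 4 * P)
  (quintic≡0 : ∀ i j → quintic e P (adjℤ H) i j ≡ + 0) (P+2≤e : P + + 2 ℤ.≤ e) where

  open Walking H
  private
    triangle-free : ∀ {i j k} → adj H i j ≡ true → adj H j k ≡ true → adj H i k ≡ true → ⊥
    triangle-free = tr-3⇒triangle-free t₃
  open Counting H triangle-free

  clash : ∀ {b} → b ≡ true → b ≡ false → ⊥
  clash refl ()

  ≢true⇒false : ∀ {b} → (b ≡ true → ⊥) → b ≡ false
  ≢true⇒false {true}  ¬t = ⊥-elim (¬t refl)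
  ≢true⇒false {false} ¬t = refl

  ≢false⇒true : ∀ {b} → (b ≡ false → ⊥) → b ≡ true
  ≢false⇒true {true}  ¬f = refl
  ≢false⇒true {false} ¬f = ⊥-elim (¬f refl)

  2K₂-free : ∀ {f₁ f₂ g₁ g₂} → Induced2K₂ f₁ f₂ g₁ g₂ → ⊥
  2K₂-free = no-induced-2K₂ e P t₂ t₄ P+2≤e

  pow-3-diag : ∀ i → pow A 3 i i ≡ + 0
  pow-3-diag = sum≡0⇒term≡0 (λ i → pow-nonneg 3 i i) t₃

  -- On the diagonal the matrix equation says A⁵ = eA³ - PA, and A³ and A vanish there. This
  -- excludes all closed walks of length five, with repeated vertices or not, so its uses have no
  -- distinctness to check.
  pentagon-free : ∀ {a b c d f} → adj H a b ≡ true → adj H b c ≡ true → adj H c d ≡ true → adj H d f ≡ true →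
    adj H f a ≡ true → ⊥
  pentagon-free {a} ab bc cd df fa = 1≰0 pow-5-diag
    (walk 4 a (walk 3 a (walk 2 a (walk 1 a (walk 0 a (stay a) ab) bc) cd) df) fa)
    where
    reduce : ∀ w x y → x ≡ + 0 → y ≡ + 0 → w + - e * x + P * y ≡ + 0 → w ≡ + 0
    reduce w x y refl refl eq = trans (lemma w e P) eq
      where
      lemma : ∀ w e P → w ≡ w + - e * + 0 + P * + 0
      lemma = solve-∀
    pow-5-diag : pow A 5 a a ≡ + 0
    pow-5-diag = reduce _ _ _ (pow-3-diag a) (trans (pow-1 A a a) (cong ι (Graph.irrefl H a))) (quintic≡0 a a)

  degree : Fin n → ℤ
  degree v = sum (A v)

  degree-strict : ∀ {x z w} → (∀ y → adj H x y ≡ true → adj H z y ≡ true) → adj H x w ≡ false → adj H z w ≡ true →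
    degree z ℤ.≤ degree x → ⊥
  degree-strict {x} {z} {w} x⊆z xw zw z≤x = x+1≰x (degree x) (ℤ.≤-trans x+1≤z z≤x)
    where
    bound : ∀ y → A x y + δ y w * + 1 ℤ.≤ A z y
    bound y with y ≟ w
    ... | yes refl rewrite xw | zw = ℤ.≤-refl
    ... | no _ with adj H x y in xy
    ...   | true rewrite x⊆z y xy = ℤ.≤-refl
    ...   | false = 0≤ι (adj H z y)
    x+1≤z : degree x + + 1 ℤ.≤ degree z
    x+1≤z = subst (ℤ._≤ degree z)
      (trans (∑-distrib-+ (A x) (λ y → δ y w * + 1)) (cong (_+_ (degree x)) (sum-δ (λ _ → + 1) w)))
      (sum-mono bound)
    x+1≰x : ∀ d → d + + 1 ℤ.≤ d → ⊥
    x+1≰x d le with subst (+ 0 ℤ.≤_) (lemma d) (ℤ.i≤j⇒0≤j-i le)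
      where
      lemma : ∀ d → d - (d + + 1) ≡ - (+ 1)
      lemma = solve-∀
    ... | ()

  HasNeighbour : Fin n → Set
  HasNeighbour u = ∃[ a ] adj H u a ≡ true

  hasNeighbour? : ∀ u → Dec (HasNeighbour u)
  hasNeighbour? u = any? λ a → adj H u a Bool.≟ true

  -- The nonneighbours of x₀, among them x₀ itself, are called rows and its neighbours columns.
  -- Columns are independent by the absence of triangles, rows by the maximality of x₀.
  module Sides (x₀ : Fin n) (x₀-max : ∀ v → degree v ℤ.≤ degree x₀) where

    -- Suppose z ~ w are rows. N(x₀) ⊆ N(z) would be a proper inclusion because of w, against
    -- maximal degree; so some column y is not joined to z, and likewise some y′ not to w. Since x₀y
    -- and zw are not an induced 2K₂, y ~ w, and similarly y′ ~ z. Then x₀ y w z y′ is a closed walk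
    -- of length five.
    row-independent : ∀ {z w} → adj H x₀ z ≡ false → adj H x₀ w ≡ false → adj H z w ≡ false
    row-independent {z} {w} xz xw = ≢true⇒false λ zw → 5-cycle zw (missing xw zw) (missing xz (adj-sym zw))
      where
      missing : ∀ {z w} → adj H x₀ w ≡ false → adj H z w ≡ true → ∃[ y ] (adj H x₀ y ≡ true × adj H z y ≡ false)
      missing {z} {w} xw zw with any? (λ y → (adj H x₀ y Bool.≟ true) ×-dec (adj H z y Bool.≟ false))
      ... | yes found = found
      ... | no none = ⊥-elim (degree-strict (λ y xy → ≢false⇒true λ zy → none (y , xy , zy)) xw zw (x₀-max z))
      5-cycle : adj H z w ≡ true → ∃[ y ] (adj H x₀ y ≡ true × adj H z y ≡ false) →
        ∃[ y ] (adj H x₀ y ≡ true × adj H w y ≡ false) → ⊥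
      5-cycle zw (y , xy , ¬zy) (y′ , xy′ , ¬wy′) = pentagon-free xy
        (≢false⇒true λ ¬yw → 2K₂-free record { f = xy ; g = zw ; ¬f₁g₁ = xz ; ¬f₁g₂ = xw
          ; ¬f₂g₁ = trans (Graph.sym H _ _) ¬zy ; ¬f₂g₂ = ¬yw })
        (adj-sym zw)
        (≢false⇒true λ ¬zy′ → 2K₂-free record { f = xy′ ; g = zw ; ¬f₁g₁ = xz ; ¬f₁g₂ = xw
          ; ¬f₂g₁ = trans (Graph.sym H _ _) ¬zy′ ; ¬f₂g₂ = trans (Graph.sym H _ _) ¬wy′ })
        (adj-sym xy′)

    column-independent : ∀ {z w} → adj H x₀ z ≡ true → adj H x₀ w ≡ true → adj H z w ≡ false
    column-independent xz xw = ≢true⇒false λ zw → triangle-free xz zw xw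

    neighbour-is-column : ∀ {u v} → adj H x₀ u ≡ false → adj H u v ≡ true → adj H x₀ v ≡ true
    neighbour-is-column xu uv = ≢false⇒true λ xv → clash uv (row-independent xu xv)

    neighbour-is-row : ∀ {u v} → adj H x₀ u ≡ true → adj H u v ≡ true → adj H x₀ v ≡ false
    neighbour-is-row xu uv = ≢true⇒false λ xv → clash uv (column-independent xu xv)

    -- For a row i and a non-adjacent column j the hypothesis reads 2 A⁵ᵢⱼ = tr A² · A³ᵢⱼ.  Both sides
    -- count pairs of a walk i a b j and an edge cd, and on the left only those pairs for which
    -- the edge can be spliced into the walk.
    module NonAdjacent {i j} (xi : adj H x₀ i ≡ false) (xj : adj H x₀ j ≡ true) (ij : adj H i j ≡ false) where

      path splice₁ splice₂ : Fin n → Fin n → Fin n → Fin n → ℤ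
      path    a b c d = A i a * A a b * A b j * A c d
      splice₁ a b c d = A i a * A a c * A c d * A d b * A b j
      splice₂ a b c d = A i a * A a d * A d c * A c b * A b j

      -- Neither detour from a to b through cd is present. The edge ab is not listed because
      -- `inner-edge` supplies it: otherwise ia and bj would be an induced 2K₂.
      blocked : Fin n → Fin n → Fin n → Fin n → Bool
      blocked a b c d = adj H i a ∧ adj H b j ∧ adj H c d ∧ not (adj H a c ∧ adj H d b) ∧ not (adj H a d ∧ adj H c b)

      inner-edge : ∀ {a b} → adj H i a ≡ true → adj H b j ≡ true → adj H a b ≡ true
      inner-edge ia bj = ≢false⇒true λ ¬ab → 2K₂-free record { f = ia ; g = adj-sym bj
        ; ¬f₁g₁ = ij
        ; ¬f₁g₂ = row-independent xi (neighbour-is-row xj (adj-sym bj))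
        ; ¬f₂g₁ = column-independent (neighbour-is-column xi ia) xj
        ; ¬f₂g₂ = ¬ab }

      -- The splices replace the middle edge ab by a c d b and by a d c b. Both at once would need a
      -- ~ c and a ~ d, a triangle with cd.
      path-split : ∀ a b c d → path a b c d ≡ ι (blocked a b c d) + splice₁ a b c d + splice₂ a b c d
      path-split a b c d rewrite Graph.sym H d c =
        go (adj H i a) (adj H a b) (adj H b j) (adj H c d) (adj H a c) (adj H d b) (adj H a d) (adj H c b)
          inner-edge triangle-free
        where
        go : ∀ ia ab bj cd ac db ad cb → (ia ≡ true → bj ≡ true → ab ≡ true) → (ac ≡ true → cd ≡ true → ad ≡ true → ⊥) →
          ι ia * ι ab * ι bj * ι cd ≡ ι (ia ∧ bj ∧ cd ∧ not (ac ∧ db) ∧ not (ad ∧ cb))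
            + ι ia * ι ac * ι cd * ι db * ι bj + ι ia * ι ad * ι cd * ι cb * ι bj
        go false ab bj cd ac db ad cb _ _ = refl
        go true ab false cd ac db ad cb _ _ = trans
          (cong (_* ι cd) (ℤ.*-zeroʳ (+ 1 * ι ab)))
          (sym (cong₂ _+_ (trans (ℤ.+-identityˡ _) (ℤ.*-zeroʳ (+ 1 * ι ac * ι cd * ι db))) (ℤ.*-zeroʳ (+ 1 * ι ad * ι cd * ι cb))))
        go true false true cd ac db ad cb ab _ with ab refl refl
        ... | ()
        go true true true false true db true cb _ _ = refl
        go true true true false true db false cb _ _ = refl
        go true true true false false db true cb _ _ = refl
        go true true true false false db false cb _ _ = refl
        go true true true true true db true cb _ ¬t = ⊥-elim (¬t refl refl refl)
        go true true true true true true false cb _ _ = refl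
        go true true true true true false false cb _ _ = refl
        go true true true true false db true true _ _ = refl
        go true true true true false db true false _ _ = refl
        go true true true true false db false cb _ _ = refl

      sum-path : sum₄ path ≡ pow A 3 i j * tr A 2
      sum-path = begin
        sum₄ path
          ≡⟨ sym (sum₂-*-sum₂ (λ a b → A i a * A a b * A b j) A) ⟩
        sum₂ (λ a b → A i a * A a b * A b j) * sum₂ A
          ≡⟨ cong₂ _*_ (trans (∑-comm (λ a b → A i a * A a b * A b j)) (sum-cong-≗ λ b → expand b)) (sym tr-2-sum) ⟩
        pow A 3 i j * tr A 2 ∎
        where
        open ≡-Reasoning
        expand : ∀ b → sum (λ a → A i a * A a b * A b j) ≡ pow A 2 i b * A b j
        expand b = trans (sym (*-distribʳ-sum (A b j) (λ a → A i a * A a b)))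
          (cong (_* A b j) (sum-cong-≗ λ a → cong (_* A a b) (sym (pow-1 A i a))))

      sum-splice₁ : sum₄ splice₁ ≡ pow A 5 i j
      sum-splice₁ = begin
        sum (λ a → sum (λ b → sum (λ c → sum (λ d → splice₁ a b c d))))
          ≡⟨ ∑-comm (λ a b → sum (λ c → sum (λ d → splice₁ a b c d))) ⟩
        sum (λ b → sum (λ a → sum (λ c → sum (λ d → splice₁ a b c d))))
          ≡⟨ sum-cong-≗ (λ b → trans (sum-cong-≗ λ a → ∑-comm (λ c d → splice₁ a b c d))
               (trans (∑-comm (λ a d → sum (λ c → splice₁ a b c d))) (sum-cong-≗ λ d → ∑-comm (λ a c → splice₁ a b c d)))) ⟩
        sum (λ b → sum (λ d → sum (λ c → sum (λ a → splice₁ a b c d))))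
          ≡⟨ sum-cong-≗ (λ b → factor b) ⟩
        pow A 5 i j ∎
        where
        open ≡-Reasoning
        factor : ∀ b → sum (λ d → sum (λ c → sum (λ a → splice₁ a b c d))) ≡ pow A 4 i b * A b j
        factor b = begin
          sum (λ d → sum (λ c → sum (λ a → A i a * A a c * A c d * A d b * A b j)))
            ≡⟨ sum-cong-≗ (λ d → trans (sum-cong-≗ λ c → sym (*-distribʳ-sum (A b j) (λ a → A i a * A a c * A c d * A d b)))
                 (sym (*-distribʳ-sum (A b j) (λ c → sum (λ a → A i a * A a c * A c d * A d b))))) ⟩
          sum (λ d → sum (λ c → sum (λ a → A i a * A a c * A c d * A d b)) * A b j)
            ≡⟨ sym (*-distribʳ-sum (A b j) (λ d → sum (λ c → sum (λ a → A i a * A a c * A c d * A d b)))) ⟩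
          sum (λ d → sum (λ c → sum (λ a → A i a * A a c * A c d * A d b))) * A b j
            ≡⟨ cong (_* A b j) (sum-cong-≗ λ d → trans
                 (sum-cong-≗ λ c → sym (*-distribʳ-sum (A d b) (λ a → A i a * A a c * A c d)))
                 (trans (sym (*-distribʳ-sum (A d b) (λ c → sum (λ a → A i a * A a c * A c d))))
                   (cong (_* A d b) (sum-cong-≗ λ c → trans (sym (*-distribʳ-sum (A c d) (λ a → A i a * A a c)))
                     (cong (_* A c d) (sum-cong-≗ λ a → cong (_* A a c) (sym (pow-1 A i a)))))))) ⟩
          pow A 4 i b * A b j ∎

      sum-splice₂ : sum₄ splice₂ ≡ pow A 5 i j
      sum-splice₂ = trans (sum₂-cong λ a b → ∑-comm (λ c d → splice₂ a b c d)) sum-splice₁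

      sum-blocked : sum₄ (λ a b c d → ι (blocked a b c d)) ≡ + 0
      sum-blocked = cancel _ (pow A 3 i j) (pow A 5 i j) (pow A 1 i j)
        (begin
          sum₄ (λ a b c d → ι (blocked a b c d)) + pow A 5 i j + pow A 5 i j
            ≡⟨ sym (trans (sum₄-distrib-+ (λ a b c d → ι (blocked a b c d) + splice₁ a b c d) splice₂)
                 (cong₂ _+_ (trans (sum₄-distrib-+ (λ a b c d → ι (blocked a b c d)) splice₁)
                   (cong (_+_ (sum₄ (λ a b c d → ι (blocked a b c d)))) sum-splice₁)) sum-splice₂)) ⟩
          sum₄ (λ a b c d → ι (blocked a b c d) + splice₁ a b c d + splice₂ a b c d)
            ≡⟨ sym (sum₄-cong path-split) ⟩
          sum₄ path
            ≡⟨ trans sum-path (cong (pow A 3 i j *_) t₂) ⟩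
          pow A 3 i j * (+ 2 * e) ∎)
        (trans (pow-1 A i j) (cong ι ij)) (quintic≡0 i j)
        where
        open ≡-Reasoning
        cancel : ∀ s p₃ p₅ p₁ → s + p₅ + p₅ ≡ p₃ * (+ 2 * e) → p₁ ≡ + 0 → p₅ + - e * p₃ + P * p₁ ≡ + 0 → s ≡ + 0
        cancel s p₃ p₅ _ eq refl q = begin
          s
            ≡⟨ lemma₁ s p₅ ⟩
          s + p₅ + p₅ - + 2 * p₅
            ≡⟨ cong (_- + 2 * p₅) eq ⟩
          p₃ * (+ 2 * e) - + 2 * p₅
            ≡⟨ lemma₂ p₃ p₅ e P ⟩
          - (+ 2) * (p₅ + - e * p₃ + P * + 0)
            ≡⟨ cong (- (+ 2) *_) q ⟩
          + 0 ∎
          where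
          lemma₁ : ∀ s p → s ≡ s + p + p - + 2 * p
          lemma₁ = solve-∀
          lemma₂ : ∀ p q e P → p * (+ 2 * e) - + 2 * q ≡ - (+ 2) * (q + - e * p + P * + 0)
          lemma₂ = solve-∀

      -- No quadruple is blocked, so cd can be spliced in between a and b. As a and d are both
      -- columns, only a c d b is possible. Hence N(i) lies in the neighbourhood of every row that
      -- has a neighbour and, if i has a neighbour, N(j) lies in that of every column.
      nested : ∀ {a b c d} → adj H i a ≡ true → adj H j b ≡ true → adj H x₀ c ≡ false → adj H c d ≡ true →
        adj H c a ≡ true × adj H d b ≡ true
      nested {a} {b} {c} {d} ia jb xc cd = unblock (adj H a c) (adj H d b) (adj H a d) (adj H c b)
          refl refl refl (unblocked ia (adj-sym jb) cd)
        where
        ι≡0 : ∀ {b} → ι b ≡ + 0 → b ≡ false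
        ι≡0 {false} _ = refl
        none : blocked a b c d ≡ false
        none = ι≡0 (sum₂≡0⇒term≡0 (λ c d → 0≤ι (blocked a b c d))
          (sum₂≡0⇒term≡0 (λ a b → sum-nonneg λ c → sum-nonneg λ d → 0≤ι (blocked a b c d)) sum-blocked a b) c d)
        unblocked : adj H i a ≡ true → adj H b j ≡ true → adj H c d ≡ true →
          not (adj H a c ∧ adj H d b) ∧ not (adj H a d ∧ adj H c b) ≡ false
        unblocked p q r = subst (λ x → x ≡ false) (simp p q r) none
          where
          simp : ∀ {x y z w} → x ≡ true → y ≡ true → z ≡ true → x ∧ y ∧ z ∧ w ≡ w
          simp refl refl refl = refl
        unblock : ∀ ac db ad cb → adj H a c ≡ ac → adj H d b ≡ db → adj H a d ≡ ad →
          not (ac ∧ db) ∧ not (ad ∧ cb) ≡ false → adj H c a ≡ true × adj H d b ≡ true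
        unblock true true ad cb eac edb ead _ = adj-sym eac , edb
        unblock true false true true eac edb ead _ = ⊥-elim (clash ead
          (column-independent (neighbour-is-column xi ia) (neighbour-is-column xc cd)))
        unblock false db true true eac edb ead _ = ⊥-elim (clash ead
          (column-independent (neighbour-is-column xi ia) (neighbour-is-column xc cd)))

    -- From nested neighbourhoods to labels

    lab : Bool → Bool → Bool → Label
    lab true  true  _     = C₁
    lab true  false _     = C₂
    lab false _     false = Z
    lab false true  true  = R₁
    lab false false true  = R₂

    -- The mark x separates the two classes of each side: marked rows are joined to all columns, and
    -- unmarked rows with a neighbour exactly to the marked columns. A column is joined to x₀, so
    -- only rows can be isolated and receive `Z`.
    labelling : (x : Fin n → Bool) →
      (∀ u v → adj H x₀ u ≡ false → adj H x₀ v ≡ true → HasNeighbour u → x u ≡ true → adj H u v ≡ true) →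
      (∀ u v → adj H x₀ u ≡ false → adj H x₀ v ≡ true → HasNeighbour u → x u ≡ false → adj H u v ≡ x v) →
      Labelling H
    labelling x full partial = record { label = label ; adj-link = adj-link }
      where
      label : Fin n → Label
      label v = lab (adj H x₀ v) (x v) (does (hasNeighbour? v))
      lab-link : ∀ p q r s {b} → (r ≡ false → b ≡ false) → (r ≡ true → p ≡ true → b ≡ true) →
        (r ≡ true → p ≡ false → b ≡ q) → b ≡ link (lab false p r) (lab true q s)
      lab-link p     true  false s i f g = i refl
      lab-link p     false false s i f g = i refl
      lab-link true  true  true  s i f g = f refl refl
      lab-link true  false true  s i f g = f refl refl
      lab-link false true  true  s i f g = g refl refl
      lab-link false false true  s i f g = g refl refl
      link-sym : ∀ p q r s → link (lab true q s) (lab false p r) ≡ link (lab false p r) (lab true q s)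
      link-sym p     true  false s = refl
      link-sym p     false false s = refl
      link-sym true  true  true  s = refl
      link-sym true  false true  s = refl
      link-sym false true  true  s = refl
      link-sym false false true  s = refl
      rows : ∀ p r q s → link (lab false p r) (lab false q s) ≡ false
      rows p     false q     s     = refl
      rows true  true  q     false = refl
      rows true  true  true  true  = refl
      rows true  true  false true  = refl
      rows false true  q     false = refl
      rows false true  true  true  = refl
      rows false true  false true  = refl
      columns : ∀ p r q s → link (lab true p r) (lab true q s) ≡ false
      columns true  r true  s = refl
      columns true  r false s = refl
      columns false r true  s = refl
      columns false r false s = refl
      row-column : ∀ u v → adj H x₀ u ≡ false → adj H x₀ v ≡ true →
        adj H u v ≡ link (lab false (x u) (does (hasNeighbour? u))) (lab true (x v) (does (hasNeighbour? v)))
      row-column u v xu xv = lab-link (x u) (x v) (does (hasNeighbour? u)) (does (hasNeighbour? v))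
        (λ isolated → ≢true⇒false λ uv → clash (dec-true (hasNeighbour? u) (v , uv)) isolated)
        (λ nb → full u v xu xv (witness (hasNeighbour? u) nb))
        (λ nb → partial u v xu xv (witness (hasNeighbour? u) nb))
        where
        witness : ∀ {Q : Set} (Q? : Dec Q) → does Q? ≡ true → Q
        witness (yes q) _ = q
      adj-link : ∀ u v → adj H u v ≡ link (label u) (label v)
      adj-link u v = go (adj H x₀ u) (adj H x₀ v) refl refl
        where
        nu = does (hasNeighbour? u)
        nv = does (hasNeighbour? v)
        go : ∀ p q → adj H x₀ u ≡ p → adj H x₀ v ≡ q → adj H u v ≡ link (lab p (x u) nu) (lab q (x v) nv)
        go false false xu xv = trans (row-independent xu xv) (sym (rows (x u) nu (x v) nv))
        go false true  xu xv = row-column u v xu xv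
        go true  false xu xv = trans (Graph.sym H u v) (trans (row-column v u xv xu) (sym (link-sym (x v) (x u) nv nu)))
        go true  true  xu xv = trans (column-independent xu xv) (sym (columns (x u) nu (x v) nv))

    Witness : Fin n → Fin n → Set
    Witness i j = adj H x₀ i ≡ false × HasNeighbour i × adj H x₀ j ≡ true × adj H i j ≡ false

    witness? : Dec (∃[ i ] ∃[ j ] Witness i j)
    witness? = any? λ i → any? λ j → (adj H x₀ i Bool.≟ false) ×-dec (hasNeighbour? i) ×-dec
      (adj H x₀ j Bool.≟ true) ×-dec (adj H i j Bool.≟ false)

    -- Without a witness the graph is complete bipartite up to isolated vertices, and all marks are
    -- true. Otherwise a nonadjacent pair i, j fixes the marks: the rows in N(j) are full, and N(i)
    -- is the neighbourhood of every other row that is not isolated.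
    classify : Dec (∃[ i ] ∃[ j ] Witness i j) → Labelling H
    classify (no none) = labelling (λ _ → true)
      (λ u v xu xv nb _ → ≢false⇒true λ uv → none (u , v , xu , nb , xv , uv))
      (λ _ _ _ _ _ ())
    classify (yes (i , j , xi , (a , ia) , xj , ij)) = labelling x full partial
      where
      x : Fin n → Bool
      x v = if adj H x₀ v then adj H i v else adj H v j
      x-row : ∀ {u} → adj H x₀ u ≡ false → x u ≡ adj H u j
      x-row xu rewrite xu = refl
      x-column : ∀ {u} → adj H x₀ u ≡ true → x u ≡ adj H i u
      x-column xu rewrite xu = refl
      full : ∀ u v → adj H x₀ u ≡ false → adj H x₀ v ≡ true → HasNeighbour u → x u ≡ true → adj H u v ≡ true
      -- `nested` with c = x₀ and d = v, and with u as the neighbour of j.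
      full u v xu xv _ x≡ = adj-sym (proj₂ (NonAdjacent.nested xi xj ij ia
        (adj-sym (trans (sym (x-row xu)) x≡)) (Graph.irrefl H x₀) xv))
      partial : ∀ u v → adj H x₀ u ≡ false → adj H x₀ v ≡ true → HasNeighbour u → x u ≡ false → adj H u v ≡ x v
      -- Neither u nor i is joined to j, so `nested` applies to the pair u, j and to the pair i, j,
      -- and each use gives one inclusion between N(u) and N(i). The neighbour of j that it asks for
      -- is x₀.
      partial u v xu xv (b , ub) x≡ = trans (bool-⇔
        (λ uv → proj₁ (NonAdjacent.nested xu xj (trans (sym (x-row xu)) x≡) uv (adj-sym xj) xi ia))
        (λ iv → proj₁ (NonAdjacent.nested xi xj ij iv (adj-sym xj) xu ub)))
        (sym (x-column xv))
        where
        bool-⇔ : ∀ {p q} → (p ≡ true → q ≡ true) → (q ≡ true → p ≡ true) → p ≡ q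
        bool-⇔ {true}  {q}     f g = sym (f refl)
        bool-⇔ {false} {false} f g = refl
        bool-⇔ {false} {true}  f g = g refl

  labelled : Fin n → Labelling H
  labelled v = Sides.classify (proj₁ most) (proj₂ most) (Sides.witness? (proj₁ most) (proj₂ most))
    where
    most = argmax v degree

-- Counting labels

count-total : ∀ {n} (ℓ : Fin n → Label) → count ℓ R₁ ℕ.+ count ℓ R₂ ℕ.+ count ℓ C₁ ℕ.+ count ℓ C₂ ℕ.+ count ℓ Z ≡ n
count-total {zero}  ℓ = refl
count-total {suc n} ℓ = trans (go (ℓ zero)) (cong suc (count-total (ℓ ∘ suc)))
  where
  k = count (ℓ ∘ suc)
  bump : Label → Label → ℕ
  bump y x = (if y == x then 1 else 0) ℕ.+ k x
  go : ∀ y → bump y R₁ ℕ.+ bump y R₂ ℕ.+ bump y C₁ ℕ.+ bump y C₂ ℕ.+ bump y Z ≡ suc (k R₁ ℕ.+ k R₂ ℕ.+ k C₁ ℕ.+ k C₂ ℕ.+ k Z)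
  go R₁ = refl
  go R₂ = lemma (k R₁) (k R₂) (k C₁) (k C₂) (k Z)
    where
    lemma : ∀ a b c d e → a ℕ.+ suc b ℕ.+ c ℕ.+ d ℕ.+ e ≡ suc (a ℕ.+ b ℕ.+ c ℕ.+ d ℕ.+ e)
    lemma = ℕSolver.solve-∀
  go C₁ = lemma (k R₁) (k R₂) (k C₁) (k C₂) (k Z)
    where
    lemma : ∀ a b c d e → a ℕ.+ b ℕ.+ suc c ℕ.+ d ℕ.+ e ≡ suc (a ℕ.+ b ℕ.+ c ℕ.+ d ℕ.+ e)
    lemma = ℕSolver.solve-∀
  go C₂ = lemma (k R₁) (k R₂) (k C₁) (k C₂) (k Z)
    where
    lemma : ∀ a b c d e → a ℕ.+ b ℕ.+ c ℕ.+ suc d ℕ.+ e ≡ suc (a ℕ.+ b ℕ.+ c ℕ.+ d ℕ.+ e)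
    lemma = ℕSolver.solve-∀
  go Z = lemma (k R₁) (k R₂) (k C₁) (k C₂) (k Z)
    where
    lemma : ∀ a b c d e → a ℕ.+ b ℕ.+ c ℕ.+ d ℕ.+ suc e ≡ suc (a ℕ.+ b ℕ.+ c ℕ.+ d ℕ.+ e)
    lemma = ℕSolver.solve-∀

==-sound : ∀ x y → (if x == y then 1 else 0) ≢ 0 → x ≡ y
==-sound R₁ R₁ _ = refl
==-sound R₂ R₂ _ = refl
==-sound C₁ C₁ _ = refl
==-sound C₂ C₂ _ = refl
==-sound Z  Z  _ = refl
==-sound R₁ R₂ ≢0 = ⊥-elim (≢0 refl)
==-sound R₁ C₁ ≢0 = ⊥-elim (≢0 refl)
==-sound R₁ C₂ ≢0 = ⊥-elim (≢0 refl)
==-sound R₁ Z  ≢0 = ⊥-elim (≢0 refl)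
==-sound R₂ R₁ ≢0 = ⊥-elim (≢0 refl)
==-sound R₂ C₁ ≢0 = ⊥-elim (≢0 refl)
==-sound R₂ C₂ ≢0 = ⊥-elim (≢0 refl)
==-sound R₂ Z  ≢0 = ⊥-elim (≢0 refl)
==-sound C₁ R₁ ≢0 = ⊥-elim (≢0 refl)
==-sound C₁ R₂ ≢0 = ⊥-elim (≢0 refl)
==-sound C₁ C₂ ≢0 = ⊥-elim (≢0 refl)
==-sound C₁ Z  ≢0 = ⊥-elim (≢0 refl)
==-sound C₂ R₁ ≢0 = ⊥-elim (≢0 refl)
==-sound C₂ R₂ ≢0 = ⊥-elim (≢0 refl)
==-sound C₂ C₁ ≢0 = ⊥-elim (≢0 refl)
==-sound C₂ Z  ≢0 = ⊥-elim (≢0 refl)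
==-sound Z  R₁ ≢0 = ⊥-elim (≢0 refl)
==-sound Z  R₂ ≢0 = ⊥-elim (≢0 refl)
==-sound Z  C₁ ≢0 = ⊥-elim (≢0 refl)
==-sound Z  C₂ ≢0 = ⊥-elim (≢0 refl)

==-refl : ∀ x → (x == x) ≡ true
==-refl R₁ = refl
==-refl R₂ = refl
==-refl C₁ = refl
==-refl C₂ = refl
==-refl Z  = refl

count-positive : ∀ {n} (ℓ : Fin n → Label) x → count ℓ x ≢ 0 → ∃[ j ] ℓ j ≡ x
count-positive {zero}  ℓ x ≢0 = ⊥-elim (≢0 refl)
count-positive {suc n} ℓ x ≢0 with (if ℓ zero == x then 1 else 0) ℕ.≟ 0
... | no here = zero , ==-sound (ℓ zero) x here
... | yes eq with count-positive (ℓ ∘ suc) x (λ rest → ≢0 (cong₂ ℕ._+_ eq rest))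
...   | j , ℓj = suc j , ℓj

count-punchIn : ∀ {n} (ℓ : Fin (suc n) → Label) j x →
  count ℓ x ≡ (if ℓ j == x then 1 else 0) ℕ.+ count (ℓ ∘ punchIn j) x
count-punchIn         ℓ zero    x = refl
count-punchIn {suc n} ℓ (suc j) x = trans (cong (ℕ._+_ (if ℓ zero == x then 1 else 0)) (count-punchIn (ℓ ∘ suc) j x))
  (lemma (if ℓ zero == x then 1 else 0) (if ℓ (suc j) == x then 1 else 0) _)
  where
  lemma : ∀ a b c → a ℕ.+ (b ℕ.+ c) ≡ b ℕ.+ (a ℕ.+ c)
  lemma = ℕSolver.solve-∀

-- Any position of ℓ′ that carries the label of `zero` may serve as its image: removing both keeps
-- all counts equal, and `insert` restores the pair.
match : ∀ {n} (ℓ ℓ′ : Fin n → Label) → (∀ x → count ℓ x ≡ count ℓ′ x) →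
  ∃[ π ] (∀ i → ℓ′ (_⟨$⟩ʳ_ {n} {n} π i) ≡ ℓ i)
match {zero}  ℓ ℓ′ eq = idₚ , λ ()
match {suc n} ℓ ℓ′ eq with count-positive ℓ′ (ℓ zero) nonzero
  where
  nonzero : count ℓ′ (ℓ zero) ≢ 0
  nonzero ≡0 with trans (sym (cong (λ b → (if b then 1 else 0) ℕ.+ count (ℓ ∘ suc) (ℓ zero)) (==-refl (ℓ zero))))
                        (trans (eq (ℓ zero)) ≡0)
  ... | ()
... | j , ℓ′j with match (ℓ ∘ suc) (ℓ′ ∘ punchIn j) (λ x → ℕ.+-cancelˡ-≡ (if ℓ zero == x then 1 else 0) _ _
        (trans (eq x) (trans (count-punchIn ℓ′ j x)
          (cong (λ y → (if y == x then 1 else 0) ℕ.+ count (ℓ′ ∘ punchIn j) x) ℓ′j))))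
... | π , commutes = insert zero j π , λ { zero → ℓ′j ; (suc i) → commutes i }

same-counts⇒isomorphic : ∀ {n} {G H : Graph n} (LG : Labelling G) (LH : Labelling H) →
  (∀ x → count (Labelling.label LG) x ≡ count (Labelling.label LH) x) → Isomorphic G H
same-counts⇒isomorphic LG LH eq with match (Labelling.label LG) (Labelling.label LH) eq
... | π , commutes = π , λ i j → trans (Labelling.adj-link LH (π ⟨$⟩ʳ i) (π ⟨$⟩ʳ j))
        (trans (cong₂ link (commutes i) (commutes j)) (sym (Labelling.adj-link LG i j)))

-- Which side is called rows depends on where x₀ lies in the mate. If the sizes come out as r₁ = b
-- and c₁ = a, exchanging the sides brings the labels into agreement.
transposed : Label → Label
transposed R₁ = C₁
transposed R₂ = C₂
transposed C₁ = R₁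
transposed C₂ = R₂
transposed Z  = Z

transpose : ∀ {n} {G : Graph n} → Labelling G → Labelling G
transpose {G = G} L = record
  { label = transposed ∘ label
  ; adj-link = λ i j → trans (adj-link i j) (link-transposed (label i) (label j))
  }
  where
  open Labelling L
  link-transposed : ∀ x y → link x y ≡ link (transposed x) (transposed y)
  link-transposed R₁ R₁ = refl
  link-transposed R₁ R₂ = refl
  link-transposed R₁ C₁ = refl
  link-transposed R₁ C₂ = refl
  link-transposed R₁ Z  = refl
  link-transposed R₂ R₁ = refl
  link-transposed R₂ R₂ = refl
  link-transposed R₂ C₁ = refl
  link-transposed R₂ C₂ = refl
  link-transposed R₂ Z  = refl
  link-transposed C₁ R₁ = refl
  link-transposed C₁ R₂ = refl
  link-transposed C₁ C₁ = refl
  link-transposed C₁ C₂ = refl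
  link-transposed C₁ Z  = refl
  link-transposed C₂ R₁ = refl
  link-transposed C₂ R₂ = refl
  link-transposed C₂ C₁ = refl
  link-transposed C₂ C₂ = refl
  link-transposed C₂ Z  = refl
  link-transposed Z  y  = refl

count-transposed : ∀ {n} (ℓ : Fin n → Label) x → count (transposed ∘ ℓ) x ≡ count ℓ (transposed x)
count-transposed {zero}  ℓ x = refl
count-transposed {suc n} ℓ x = cong₂ (λ b m → (if b then 1 else 0) ℕ.+ m) (==-transposed (ℓ zero) x) (count-transposed (ℓ ∘ suc) x)
  where
  ==-transposed : ∀ x y → (transposed x == y) ≡ (x == transposed y)
  ==-transposed R₁ R₁ = refl
  ==-transposed R₁ R₂ = refl
  ==-transposed R₁ C₁ = refl
  ==-transposed R₁ C₂ = refl
  ==-transposed R₁ Z  = refl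
  ==-transposed R₂ R₁ = refl
  ==-transposed R₂ R₂ = refl
  ==-transposed R₂ C₁ = refl
  ==-transposed R₂ C₂ = refl
  ==-transposed R₂ Z  = refl
  ==-transposed C₁ R₁ = refl
  ==-transposed C₁ R₂ = refl
  ==-transposed C₁ C₁ = refl
  ==-transposed C₁ C₂ = refl
  ==-transposed C₁ Z  = refl
  ==-transposed C₂ R₁ = refl
  ==-transposed C₂ R₂ = refl
  ==-transposed C₂ C₁ = refl
  ==-transposed C₂ C₂ = refl
  ==-transposed C₂ Z  = refl
  ==-transposed Z  R₁ = refl
  ==-transposed Z  R₂ = refl
  ==-transposed Z  C₁ = refl
  ==-transposed Z  C₂ = refl
  ==-transposed Z  Z  = refl

-- The labelling of K⁻

tailLabel : ℕ → ℕ → Label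
tailLabel m k = if k <ᵇ m then R₁ else (if k ≡ᵇ m then C₂ else C₁)

-- Here m = p - 1, and the vertices 0 and m + 1 are the ends of the deleted edge. Splitting off
-- vertex 0 leaves labels in blocks, m times `R₁`, once `C₂`, then `C₁`, which `count-tail` counts
-- by recursion on m.
KpqLabel : ℕ → ℕ → Label
KpqLabel m zero    = R₂
KpqLabel m (suc k) = tailLabel m k

times : Bool → ℕ → ℕ
times b m = if b then m else 0

count-tail : ∀ m q x → count {m ℕ.+ suc q} (λ i → tailLabel m (toℕ i)) x ≡
  times (R₁ == x) m ℕ.+ ((if C₂ == x then 1 else 0) ℕ.+ times (C₁ == x) q)
count-tail zero q x = trans (cong (ℕ._+_ (if C₂ == x then 1 else 0)) (count-const q)) (sym (zeros (R₁ == x)))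
  where
  bump : ∀ b m → (if b then 1 else 0) ℕ.+ times b m ≡ times b (suc m)
  bump true  m = refl
  bump false m = refl
  count-const : ∀ q → count {q} (λ _ → C₁) x ≡ times (C₁ == x) q
  count-const zero    = sym (zeros′ (C₁ == x))
    where
    zeros′ : ∀ b → times b 0 ≡ 0
    zeros′ true  = refl
    zeros′ false = refl
  count-const (suc q) = trans (cong (ℕ._+_ (if C₁ == x then 1 else 0)) (count-const q)) (bump (C₁ == x) q)
  zeros : ∀ b {m} → times b 0 ℕ.+ m ≡ m
  zeros true  = refl
  zeros false = refl
count-tail (suc m) q x = trans (cong (ℕ._+_ (if R₁ == x then 1 else 0)) (count-tail m q x)) (bump (R₁ == x))
  where
  bump : ∀ b {r} → (if b then 1 else 0) ℕ.+ (times b m ℕ.+ r) ≡ times b (suc m) ℕ.+ r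
  bump true  = refl
  bump false = refl

-- The outcomes that occur for the three tests in `KpqMinusAdj`, namely in the first part, equal to
-- 0, equal to p, each with its label. Adjacency becomes a finite table with no arithmetic left.
data View : Bool → Bool → Bool → Label → Set where
  is-R₁ : View true  false false R₁
  is-R₂ : View true  true  false R₂
  is-C₁ : View false false false C₁
  is-C₂ : View false false true  C₂

view-tail : ∀ m k → View (k <ᵇ m) false (k ≡ᵇ m) (tailLabel m k)
view-tail zero    zero    = is-C₂
view-tail zero    (suc k) = is-C₁
view-tail (suc m) zero    = is-R₁
view-tail (suc m) (suc k) = view-tail m k

view : ∀ m k → View (k <ᵇ suc m) (does (k ℕ.≟ 0)) (does (k ℕ.≟ suc m)) (KpqLabel m k)
view m zero    = is-R₂
view m (suc k) = view-tail m k

view-link : ∀ {f z d x f′ z′ d′ y} → View f z d x → View f′ z′ d′ y →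
  (f xor f′) ∧ not ((z ∧ d′) ∨ (z′ ∧ d)) ≡ link x y
view-link is-R₁ is-R₁ = refl
view-link is-R₁ is-R₂ = refl
view-link is-R₁ is-C₁ = refl
view-link is-R₁ is-C₂ = refl
view-link is-R₂ is-R₁ = refl
view-link is-R₂ is-R₂ = refl
view-link is-R₂ is-C₁ = refl
view-link is-R₂ is-C₂ = refl
view-link is-C₁ is-R₁ = refl
view-link is-C₁ is-R₂ = refl
view-link is-C₁ is-C₁ = refl
view-link is-C₁ is-C₂ = refl
view-link is-C₂ is-R₁ = refl
view-link is-C₂ is-R₂ = refl
view-link is-C₂ is-C₁ = refl
view-link is-C₂ is-C₂ = refl

KpqLabelling : ∀ a b → Labelling (KpqMinus (suc a) (suc b))
KpqLabelling a b = record
  { label = λ i → KpqLabel a (toℕ i)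
  ; adj-link = λ i j → view-link (view a (toℕ i)) (view a (toℕ j))
  }

count-Kpq : ∀ a b x → count (Labelling.label (KpqLabelling a b)) x ≡
  (if R₂ == x then 1 else 0) ℕ.+ (times (R₁ == x) a ℕ.+ ((if C₂ == x then 1 else 0) ℕ.+ times (C₁ == x) b))
count-Kpq a b x = cong (ℕ._+_ (if R₂ == x then 1 else 0)) (count-tail a b x)

-- Transfer of the parameters to a cospectral mate

edgesℕ productℕ : ∀ {n} {G : Graph n} → Labelling G → ℕ
edgesℕ L = r₁ ℕ.* c₁ ℕ.+ r₁ ℕ.* c₂ ℕ.+ r₂ ℕ.* c₁
  where open Labelling L
productℕ L = r₁ ℕ.* c₁ ℕ.* (r₂ ℕ.* c₂)
  where open Labelling L

edges-ℕ : ∀ {n} {G : Graph n} (L : Labelling G) → Labelling.edges L ≡ + edgesℕ L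
edges-ℕ L = sym (trans (ℤ.pos-+ (r₁ ℕ.* c₁ ℕ.+ r₁ ℕ.* c₂) (r₂ ℕ.* c₁)) (cong₂ _+_
  (trans (ℤ.pos-+ (r₁ ℕ.* c₁) (r₁ ℕ.* c₂)) (cong₂ _+_ (ℤ.pos-* r₁ c₁) (ℤ.pos-* r₁ c₂))) (ℤ.pos-* r₂ c₁)))
  where open Labelling L

product-ℕ : ∀ {n} {G : Graph n} (L : Labelling G) → Labelling.product L ≡ + productℕ L
product-ℕ L = sym (trans (ℤ.pos-* (r₁ ℕ.* c₁) (r₂ ℕ.* c₂)) (cong₂ _*_ (ℤ.pos-* r₁ c₁) (ℤ.pos-* r₂ c₂)))
  where open Labelling L

module _ {n} {G H : Graph n} (tr≡ : ∀ k → tr (adjℤ G) k ≡ tr (adjℤ H) k) (LG : Labelling G) where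
  private
    module G = Labelling LG

  -- What `Structure` asks of H consists of trace identities and the matrix equation, which are
  -- inherited from the labelled graph G. The vertex guarantees that one of maximal degree exists.
  transfer-labelling : Fin n → productℕ LG ℕ.+ 2 ≤ edgesℕ LG → Labelling H
  transfer-labelling v P+2≤e = Structure.labelled H G.edges G.product
    (trans (sym (tr≡ 2)) G.tr-2) (trans (sym (tr≡ 3)) G.tr-3) (trans (sym (tr≡ 4)) G.tr-4)
    (quintic-transfer G.edges G.product (adjℤ G) (adjℤ H)
      (λ i j → cong ι (Graph.sym G i j)) (λ i j → cong ι (Graph.sym H i j)) tr≡ G.quintic-zero)
    (subst₂ ℤ._≤_ (trans (ℤ.pos-+ (productℕ LG) 2) (cong (_+ + 2) (sym (product-ℕ LG)))) (sym (edges-ℕ LG)) (ℤ.+≤+ P+2≤e))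
    v

  same-edges : (LH : Labelling H) → edgesℕ LG ≡ edgesℕ LH
  same-edges LH = ℤ.+-injective (trans (sym (edges-ℕ LG)) (trans
    (ℤ.*-cancelˡ-≡ (+ 2) G.edges (Labelling.edges LH) (trans (sym G.tr-2) (trans (tr≡ 2) (Labelling.tr-2 LH))))
    (edges-ℕ LH)))

  -- Once e is known, tr A⁴ = 2e² - 4P determines P.
  same-product : (LH : Labelling H) → productℕ LG ≡ productℕ LH
  same-product LH = ℤ.+-injective (trans (sym (product-ℕ LG)) (trans
    (ℤ.*-cancelˡ-≡ (+ 4) G.product (Labelling.product LH)
      (cancel _ _ _ _ (cong₂ (λ x y → + 2 * x * y) e≡ e≡)
        (trans (sym G.tr-4) (trans (tr≡ 4) (Labelling.tr-4 LH)))))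
    (product-ℕ LH)))
    where
    e≡ : G.edges ≡ Labelling.edges LH
    e≡ = trans (edges-ℕ LG) (trans (cong +_ (same-edges LH)) (sym (edges-ℕ LH)))
    cancel : ∀ x y p q → x ≡ y → x - p ≡ y - q → p ≡ q
    cancel x .x p q refl eq = trans (lemma x p) (trans (cong (_-_ x) eq) (sym (lemma x q)))
      where
      lemma : ∀ x p → p ≡ x - (x - p)
      lemma = solve-∀

counts⇒isomorphic : ∀ {n} {G H : Graph n} a b {LG : Labelling G} → let open Labelling in
  r₁ LG ≡ a → r₂ LG ≡ 1 → c₁ LG ≡ b → c₂ LG ≡ 1 → z LG ≡ 0 → (LH : Labelling H) →
  r₂ LH ≡ 1 × c₂ LH ≡ 1 × z LH ≡ 0 × ((r₁ LH ≡ a × c₁ LH ≡ b) ⊎ (r₁ LH ≡ b × c₁ LH ≡ a)) → Isomorphic G H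
counts⇒isomorphic a b {LG} R₁≡ R₂≡ C₁≡ C₂≡ Z≡ LH (r₂≡ , c₂≡ , z≡ , inj₁ (r₁≡ , c₁≡)) = same-counts⇒isomorphic LG LH λ
  { R₁ → trans R₁≡ (sym r₁≡) ; R₂ → trans R₂≡ (sym r₂≡) ; C₁ → trans C₁≡ (sym c₁≡)
  ; C₂ → trans C₂≡ (sym c₂≡) ; Z → trans Z≡ (sym z≡) }
counts⇒isomorphic a b {LG} R₁≡ R₂≡ C₁≡ C₂≡ Z≡ LH (r₂≡ , c₂≡ , z≡ , inj₂ (r₁≡ , c₁≡)) =
  same-counts⇒isomorphic LG (transpose LH) λ x → trans (swapped x) (sym (count-transposed (Labelling.label LH) x))
  where
  swapped : ∀ x → count (Labelling.label LG) x ≡ count (Labelling.label LH) (transposed x)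
  swapped R₁ = trans R₁≡ (sym c₁≡)
  swapped R₂ = trans R₂≡ (sym c₂≡)
  swapped C₁ = trans C₁≡ (sym r₁≡)
  swapped C₂ = trans C₂≡ (sym r₂≡)
  swapped Z  = trans Z≡ (sym z≡)

determined : ∀ {n} {G H : Graph n} a b → 1 ≤ a → 1 ≤ b → n ≡ a ℕ.+ b ℕ.+ 2 → Fin n →
  (LG : Labelling G) → let open Labelling LG in r₁ ≡ a → r₂ ≡ 1 → c₁ ≡ b → c₂ ≡ 1 → z ≡ 0 →
  (∀ k → tr (adjℤ G) k ≡ tr (adjℤ H) k) → Isomorphic G H
determined {n} {G} {H} a b 1≤a 1≤b order v LG R₁≡ R₂≡ C₁≡ C₂≡ Z≡ tr≡ = counts⇒isomorphic a b {LG} R₁≡ R₂≡ C₁≡ C₂≡ Z≡ LH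
    (Diophantine.parameters a b (r₁ LH) (r₂ LH) (c₁ LH) (c₂ LH) (z LH) 1≤a 1≤b
      (trans (sym (same-edges tr≡ LG LH)) edges≡) (trans (sym (same-product tr≡ LG LH)) product≡)
      (trans (count-total (label LH)) order))
  where
  open Labelling
  edges≡ : edgesℕ LG ≡ a ℕ.* b ℕ.+ a ℕ.+ b
  edges≡ = cong₂ ℕ._+_ (cong₂ ℕ._+_ (cong₂ ℕ._*_ R₁≡ C₁≡) (trans (cong₂ ℕ._*_ R₁≡ C₂≡) (ℕ.*-identityʳ a)))
    (trans (cong₂ ℕ._*_ R₂≡ C₁≡) (ℕ.*-identityˡ b))
  product≡ : productℕ LG ≡ a ℕ.* b
  product≡ = trans (cong₂ ℕ._*_ (cong₂ ℕ._*_ R₁≡ C₁≡) (cong₂ ℕ._*_ R₂≡ C₂≡)) (ℕ.*-identityʳ _)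
  LH : Labelling H
  LH = transfer-labelling tr≡ LG v (subst₂ _≤_ (cong (ℕ._+ 2) (sym product≡)) (sym edges≡)
    (subst (a ℕ.* b ℕ.+ 2 ≤_) (sym (ℕ.+-assoc (a ℕ.* b) a b)) (ℕ.+-monoʳ-≤ (a ℕ.* b) (ℕ.+-mono-≤ 1≤a 1≤b))))

KpqMinus-determined : ∀ a b → 1 ≤ a → 1 ≤ b → (H : Graph (suc a ℕ.+ suc b)) →
  Cospectral (KpqMinus (suc a) (suc b)) H → Isomorphic (KpqMinus (suc a) (suc b)) H
KpqMinus-determined a b 1≤a 1≤b H co = determined {G = KpqMinus (suc a) (suc b)} {H} a b 1≤a 1≤b (order a b) zero (KpqLabelling a b)
  (trans (count-Kpq a b R₁) (ℕ.+-identityʳ a)) (count-Kpq a b R₂) (count-Kpq a b C₁) (count-Kpq a b C₂) (count-Kpq a b Z)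
  (cospectral-traces (KpqMinus (suc a) (suc b)) H co)
  where
  order : ∀ a b → suc a ℕ.+ suc b ≡ a ℕ.+ b ℕ.+ 2
  order = ℕSolver.solve-∀

theorem3p1 : ∀ (p q : ℕ) → 2 ≤ p → p ≤ q → DS (KpqMinus p q)
theorem3p1 (suc a) (suc b) (s≤s 1≤a) (s≤s a≤b) m H co with cospectral-order (KpqMinus (suc a) (suc b)) H co
... | refl = KpqMinus-determined a b 1≤a (ℕ.≤-trans 1≤a a≤b) H co
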